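{- For every $n\ge0$, the symmetric function $(2n)!\,A_n$ is $h$-integral and $h$-positive, i.e. it is a linear combination of the complete homogeneous symmetric functions $h_\lambda$, $\lambda\vdash n$, with nonnegative integer coefficients.
   Context: $A_n=\frac{1}{(2n)!}\sum_{\lambda\vdash n}|\phi(\lambda)|\,p_\lambda$, where for $\lambda=\langle 1^{m_1},\dots,n^{m_n}\rangle\vdash n$ ($m_k$ parts equal to $k$), $\phi(\lambda)=(2n)!\prod_{k=1}^n\frac{1}{m_k!}\left(\frac{4^k(4^k-1)B_{2k}}{(2k)(2k)!}\right)^{m_k}$ with $B_{2k}$ Bernoulli numbers, and $p_\lambda$ are power-sum symmetric functions. -}

module Defs where

open import Data.Nat as ℕ using (ℕ; zero; suc; _!)
open import Data.Nat.Combinatorics using (_C_)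
open import Data.Integer as ℤ using (ℤ; +_)
open import Data.Rational as ℚ using (ℚ)
open import Data.List using (List; []; _∷_; _++_; map; foldr; concatMap; upTo; zipWith; filterᵇ; length; applyUpTo)
open import Data.Vec as Vec using (Vec; []; _∷_)
open import Data.Fin as Fin using (Fin)
open import Data.Bool using (Bool; true; false; if_then_else_; _∧_)
open import Data.Product using (_×_; _,_; proj₁; proj₂)
open import Relation.Binary.PropositionalEquality using (_≡_)
open import Relation.Nullary.Decidable using (⌊_⌋)
import Data.Vec.Properties as VecP

-- 1/d for a natural number d (value at d = 0 is irrelevant; only used for d ≥ 1)
recipℕ : ℕ → ℚ
recipℕ zero    = ℚ.0ℚ
recipℕ (suc k) = (+ 1) ℚ./ suc k

ℕtoℚ : ℕ → ℚ
ℕtoℚ n = (+ n) ℚ./ 1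

sumℚ : List ℚ → ℚ
sumℚ = foldr ℚ._+_ ℚ.0ℚ

prodℚ : List ℚ → ℚ
prodℚ = foldr ℚ._*_ ℚ.1ℚ

powℚ : ℚ → ℕ → ℚ
powℚ q zero    = ℚ.1ℚ
powℚ q (suc k) = q ℚ.* powℚ q k

-- Bernoulli numbers (convention B₁ = -1/2; only even indices are used):
--   B₀ = 1,  B_m = - 1/(m+1) * Σ_{j<m} C(m+1, j) B_j.

private
  index : List ℚ → ℕ → ℚ
  index []       _       = ℚ.0ℚ
  index (x ∷ xs) zero    = x
  index (x ∷ xs) (suc k) = index xs k

bernList : ℕ → List ℚ
bernList zero    = ℚ.1ℚ ∷ []
bernList (suc m) =
  let bs = bernList m in
  bs ++ (ℚ.- (recipℕ (suc (suc m)) ℚ.*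
            sumℚ (map (λ j → ℕtoℚ (suc (suc m) C j) ℚ.* index bs j) (upTo (suc m))))) ∷ []

bernoulli : ℕ → ℚ
bernoulli m = index (bernList m) m

-- Partitions of n, as weakly decreasing lists of positive integers.

partsBounded : (fuel b n : ℕ) → List (List ℕ)
partsBounded fuel    b zero    = [] ∷ []
partsBounded zero    b (suc n) = []
partsBounded (suc f) b (suc n) =
  concatMap (λ i → let k = suc i in
                   if ⌊ k ℕ.≤? b ⌋ ∧ ⌊ k ℕ.≤? suc n ⌋
                   then map (k ∷_) (partsBounded f k (suc n ℕ.∸ k))
                   else [])
            (upTo (suc n))

partitions : ℕ → List (List ℕ)
partitions n = partsBounded n n n

mult : ℕ → List ℕ → ℕ
mult k λ′ = length (filterᵇ (λ x → ⌊ x ℕ.≟ k ⌋) λ′)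

coeffA : ℕ → ℚ
coeffA k = ℕtoℚ (4 ℕ.^ k ℕ.* (4 ℕ.^ k ℕ.∸ 1)) ℚ.* bernoulli (2 ℕ.* k)
           ℚ.* recipℕ ((2 ℕ.* k) ℕ.* (2 ℕ.* k) !)

φ : ℕ → List ℕ → ℚ
φ n λ′ = ℕtoℚ ((2 ℕ.* n) !) ℚ.*
         prodℚ (applyUpTo (λ i → let k = suc i in
                   recipℕ (mult k λ′ !) ℚ.* powℚ (coeffA k) (mult k λ′)) n)

-- Polynomials in N variables x₀,…,x_{N-1} over ℚ, as lists of terms
-- (coefficient, exponent vector).  Two polynomials are equal iff all
-- their monomial coefficients agree.

Poly : ℕ → Set
Poly N = List (ℚ × Vec ℕ N)

coeff : ∀ {N} → Poly N → Vec ℕ N → ℚ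
coeff P α = sumℚ (map proj₁ (filterᵇ (λ t → ⌊ VecP.≡-dec ℕ._≟_ (proj₂ t) α ⌋) P))

_≈P_ : ∀ {N} → Poly N → Poly N → Set
P ≈P Q = ∀ α → coeff P α ≡ coeff Q α

zeroP : ∀ {N} → Poly N
zeroP = []

oneP : ∀ {N} → Poly N
oneP {N} = (ℚ.1ℚ , Vec.replicate N 0) ∷ []

_+P_ : ∀ {N} → Poly N → Poly N → Poly N
P +P Q = P ++ Q

_*P_ : ∀ {N} → Poly N → Poly N → Poly N
P *P Q = concatMap (λ s → map (λ t → (proj₁ s ℚ.* proj₁ t , Vec.zipWith ℕ._+_ (proj₂ s) (proj₂ t))) Q) P

scaleP : ∀ {N} → ℚ → Poly N → Poly N
scaleP c = map (λ t → (c ℚ.* proj₁ t , proj₂ t))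

sumP : ∀ {N} → List (Poly N) → Poly N
sumP = foldr _+P_ zeroP

prodP : ∀ {N} → List (Poly N) → Poly N
prodP = foldr _*P_ oneP

expVecs : (N k : ℕ) → List (Vec ℕ N)
expVecs zero    zero    = [] ∷ []
expVecs zero    (suc k) = []
expVecs (suc N) k = concatMap (λ a → map (a ∷_) (expVecs N (k ℕ.∸ a))) (upTo (suc k))

powerSum : (N k : ℕ) → Poly N
powerSum N k = map (λ i → (ℚ.1ℚ , Vec.tabulate (λ j → if ⌊ i Fin.≟ j ⌋ then k else 0)))
                   (Data.List.allFin N)
  where import Data.List

completeH : (N k : ℕ) → Poly N
completeH N k = map (λ α → (ℚ.1ℚ , α)) (expVecs N k)

p[_] : ∀ {N} → List ℕ → Poly N
p[_] {N} λ′ = prodP (map (powerSum N) λ′)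

h[_] : ∀ {N} → List ℕ → Poly N
h[_] {N} λ′ = prodP (map (completeH N) λ′)

-- (2n)! A_n = Σ_{λ ⊢ n} |φ(λ)| p_λ, in N variables
scaledA : (n N : ℕ) → Poly N
scaledA n N = sumP (map (λ λ′ → scaleP (ℚ.∣ φ n λ′ ∣) p[ λ′ ]) (partitions n))

hCombination : (n : ℕ) → (List ℕ → ℕ) → (N : ℕ) → Poly N
hCombination n c N = sumP (map (λ λ′ → scaleP (ℕtoℚ (c λ′)) h[ λ′ ]) (partitions n))

-- Since ∑ₖ |4ᵏ(4ᵏ-1)B₂ₖ| tᵏ / (2k (2k)!) = log sec √t, the symmetric function ∑ₙ Aₙ is ∏ᵢ sec √xᵢ.  If cos √t were a
-- finite product ∏ⱼ (1 - yⱼ t) with yⱼ ≥ 0, Cauchy's identity ∏ᵢⱼ 1 / (1 - xᵢ yⱼ) = ∑_λ m_λ(y) h_λ(x) would give the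
-- h-expansion of Aₙ with coefficients m_λ(y) ≥ 0.  Euler's product for the cosine supplies infinitely many yⱼ,
-- proportional to 1/(2j+1)²; here they are replaced by the finite rational families yⱼ = τ/(2j+1)², j ≤ M, with τ such
-- that p₁(y) = 1/2, and M → ∞.
--
-- Convergence.  By the differential equation of tanh, the power sums pₖ of the limit satisfy
-- ∑_{i+j=k} pᵢ pⱼ = (k - 1/2) pₖ for k ≥ 2.  The finite families satisfy it up to O(1/M), by partial fractions and the
-- telescoping sum ∑_{j≠i} 1/((2j+1)² - (2i+1)²) = 1/(4(2i+1)²).  So pₖ(y), and with it every symmetric function of y,
-- converges; in particular eₖ(y) → 1/(2k)!.
--
-- Integrality.  Solving e_ℓ m_{λ-(1,…,1)} = m_λ + (terms of length > ℓ), ℓ the length of λ, for m_λ shows by induction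
-- that (2n)! times the limit of m_λ(y) is an integer, since (2n)! / ((2ℓ)! (2n-2ℓ)!) is one.

module Submission where

open import Defs
open import Algebra.Bundles using (CommutativeRing)
open import Algebra.Solver.Ring.AlmostCommutativeRing
  using (fromCommutativeRing; _-Raw-AlmostCommutative⟶_; Induced-equivalence)
import Algebra.Solver.Ring as RingSolver
open import Algebra.Structures using (IsCommutativeRing)
open import Data.Bool using (Bool; true; false; if_then_else_; _∧_)
open import Data.Empty using (⊥-elim)
open import Data.Fin as Fin using (Fin)
open import Data.Integer as ℤ using (ℤ)
import Data.Integer.Properties as ℤₚ
open import Data.List
  using (List; []; _∷_; _++_; map; concatMap; upTo; applyUpTo; length; filterᵇ; allFin; tabulate)
open import Data.List.Properties using (map-cong; length-++; map-tabulate; ≡-dec; ∷-injective)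
open import Data.List.Relation.Unary.All as All using (All; []; _∷_)
import Data.List.Relation.Unary.All.Properties as Allₚ
open import Data.Maybe using (Maybe; just; nothing)
open import Data.Nat as ℕ using (ℕ; zero; suc; _∸_; z≤n; s≤s; _!; _≤?_)
open import Data.Nat.Combinatorics using (nCk≡n!/k![n-k]!; k![n∸k]!∣n!) renaming (_C_ to _choose_)
open import Data.Nat.DivMod using (m/n*n≡m)
open import Data.Nat.Induction using (<-rec)
open import Data.Nat.ListAction using (sum)
import Data.Nat.Properties as ℕₚ
open import Data.Nat.Properties using (_!≢0; _!*_!≢0)
import Data.Nat.Solver as ℕ-Solver
open import Data.Product using (_×_; _,_; proj₁; proj₂; ∃)
open import Data.Rational
  using ( ℚ; mkℚ; 0ℚ; 1ℚ; ½; _+_; _*_; _-_; -_; 1/_; ∣_∣; _/_; _≤_; _<_; _≟_; toℚᵘ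
        ; Positive; NonZero; positive; nonNegative )
open import Data.Rational.Properties as ℚₚ hiding (_≟_; _≤?_)
open import Data.Rational.Solver
import Data.Rational.Unnormalised as ℚᵘ
import Data.Rational.Unnormalised.Properties as ℚᵘₚ
open import Data.Sum using (_⊎_; inj₁; inj₂)
open import Data.Vec as Vec using (Vec; []; _∷_; replicate; zipWith)
import Data.Vec.Properties as Vecₚ
open import Function using (_∘_; id)
open import Level using (0ℓ)
open import Relation.Binary using (tri<; tri≈; tri>)
open import Relation.Binary.PropositionalEquality
open import Relation.Nullary using (yes; no; ¬_; Dec)
open import Relation.Nullary.Decidable using (⌊_⌋)

open ≡-Reasoning
open +-*-Solver using (solve; _:+_; _:*_; _:-_; :-_; con; _:=_)
open ℕ-Solver.+-*-Solver using ()
  renaming (solve to solveₙ; _:+_ to _+ₙ_; _:*_ to _*ₙ_; con to conₙ; _:=_ to _=ₙ_)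

-- Euler's nodes are 4/((2j+1)²π²), irrational, while every limit taken here has to be named as a
-- rational number beforehand. This is what the quadratic relation is for: for k ≥ 2 it expresses pₖ
-- by earlier power sums, so that p₁ fixes all of them and π never enters. The value 1/2 of p₁ is
-- the coefficient of t in log sec √t; τ stands in for 4/π². With the signs absorbed all terms of
-- the relation are nonnegative, which also settles the signs of B₂ₖ and thus the absolute values in
-- φ.
--
-- Positivity and integrality live on different sides of the limit. At each finite stage m_λ(y) ≥ 0
-- is evident, but (2n)! m_λ(y) is in general no integer; in the limit integrality holds because
-- eₖ(y) tends to 1/(2k)!. The recursion for m_λ therefore constructs the limit and proves its
-- integrality at once, and nonnegativity is carried over from the finite stages.
--
-- The elementary functions are generated by ∏ⱼ (1 + yⱼ t), whose limit is cosh √t, so that no signs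
-- appear in eₖ. All generating functions are compared through their logarithmic derivatives, which
-- turns each comparison into a recursion on coefficients.

≡0-* : ∀ {x} y → x ≡ 0ℚ → x * y ≡ 0ℚ
≡0-* y refl = *-zeroˡ y

*-≡0 : ∀ x {y} → y ≡ 0ℚ → x * y ≡ 0ℚ
*-≡0 x refl = *-zeroʳ x

≡1-* : ∀ {x} y → x ≡ 1ℚ → x * y ≡ y
≡1-* y refl = *-identityˡ y

*-≡1 : ∀ x {y} → y ≡ 1ℚ → x * y ≡ x
*-≡1 x refl = *-identityʳ x

≡0-+ : ∀ {x} y → x ≡ 0ℚ → x + y ≡ y
≡0-+ y refl = +-identityˡ y

+-≡0 : ∀ x {y} → y ≡ 0ℚ → x + y ≡ x
+-≡0 x refl = +-identityʳ x

-- The embeddings of ℤ and ℕ into ℚ, reciprocals and order.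

ℤtoℚ : ℤ → ℚ
ℤtoℚ z = z / 1

/-num : ∀ z d → toℚᵘ (z / suc d) ℚᵘ.≃ ℚᵘ.mkℚᵘ z d
/-num z d = toℚᵘ-fromℚᵘ (ℚᵘ.mkℚᵘ z d)

ℤtoℚ-+ : ∀ a b → ℤtoℚ (a ℤ.+ b) ≡ ℤtoℚ a + ℤtoℚ b
ℤtoℚ-+ a b = toℚᵘ-injective
  (ℚᵘₚ.≃-trans (/-num (a ℤ.+ b) 0)
  (ℚᵘₚ.≃-sym (ℚᵘₚ.≃-trans (toℚᵘ-homo-+ (ℤtoℚ a) (ℤtoℚ b))
  (ℚᵘₚ.≃-trans (ℚᵘₚ.+-cong (/-num a 0) (/-num b 0))
  (ℚᵘ.*≡* (cong (ℤ._* ℤ.+ 1) (cong₂ ℤ._+_ (ℤₚ.*-identityʳ a) (ℤₚ.*-identityʳ b))))))))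

ℤtoℚ-* : ∀ a b → ℤtoℚ (a ℤ.* b) ≡ ℤtoℚ a * ℤtoℚ b
ℤtoℚ-* a b = toℚᵘ-injective
  (ℚᵘₚ.≃-trans (/-num (a ℤ.* b) 0)
  (ℚᵘₚ.≃-sym (ℚᵘₚ.≃-trans (toℚᵘ-homo-* (ℤtoℚ a) (ℤtoℚ b)) (ℚᵘₚ.*-cong (/-num a 0) (/-num b 0)))))

ℤtoℚ-neg : ∀ a → ℤtoℚ (ℤ.- a) ≡ - ℤtoℚ a
ℤtoℚ-neg a = toℚᵘ-injective
  (ℚᵘₚ.≃-trans (/-num (ℤ.- a) 0) (ℚᵘₚ.≃-sym (ℚᵘₚ.≃-trans (toℚᵘ-homo‿- (ℤtoℚ a)) (ℚᵘₚ.-‿cong (/-num a 0)))))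

ℕtoℚ-+ : ∀ m n → ℕtoℚ (m ℕ.+ n) ≡ ℕtoℚ m + ℕtoℚ n
ℕtoℚ-+ m n = ℤtoℚ-+ (ℤ.+ m) (ℤ.+ n)

ℕtoℚ-* : ∀ m n → ℕtoℚ (m ℕ.* n) ≡ ℕtoℚ m * ℕtoℚ n
ℕtoℚ-* m n = trans (cong ℤtoℚ (ℤₚ.pos-* m n)) (ℤtoℚ-* (ℤ.+ m) (ℤ.+ n))

ℕtoℚ-suc : ∀ n → ℕtoℚ (suc n) ≡ 1ℚ + ℕtoℚ n
ℕtoℚ-suc = ℕtoℚ-+ 1

recip*ℕ : ∀ k → recipℕ (suc k) * ℕtoℚ (suc k) ≡ 1ℚ
recip*ℕ k = toℚᵘ-injective
  (ℚᵘₚ.≃-trans (toℚᵘ-homo-* (recipℕ (suc k)) (ℕtoℚ (suc k)))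
  (ℚᵘₚ.≃-trans (ℚᵘₚ.*-cong (/-num (ℤ.+ 1) k) (/-num (ℤ.+ suc k) 0))
  (ℚᵘ.*≡* (trans (ℤₚ.*-identityʳ _)
  (trans (ℤₚ.*-identityˡ _) (sym (trans (ℤₚ.*-identityˡ _) (cong ℤ.+_ (ℕₚ.*-identityʳ (suc k))))))))))

0≤ℕtoℚ : ∀ n → 0ℚ ≤ ℕtoℚ n
0≤ℕtoℚ n = nonNegative⁻¹ (ℕtoℚ n) {{normalize-nonNeg n 1}}

0<ℕtoℚ : ∀ n → 0ℚ < ℕtoℚ (suc n)
0<ℕtoℚ n = positive⁻¹ (ℕtoℚ (suc n)) {{normalize-pos (suc n) 1}}

0≤recip : ∀ n → 0ℚ ≤ recipℕ n
0≤recip zero = ≤-refl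
0≤recip (suc n) = nonNegative⁻¹ (recipℕ (suc n)) {{normalize-nonNeg 1 (suc n)}}

*-nonNeg : ∀ {p q} → 0ℚ ≤ p → 0ℚ ≤ q → 0ℚ ≤ p * q
*-nonNeg {p} {q} a b = subst (_≤ p * q) (*-zeroʳ p) (*-monoˡ-≤-nonNeg p {{nonNegative a}} b)

+-nonNeg : ∀ {p q} → 0ℚ ≤ p → 0ℚ ≤ q → 0ℚ ≤ p + q
+-nonNeg a b = +-mono-≤ a b

*-monoˡ : ∀ {r p q} → 0ℚ ≤ r → p ≤ q → r * p ≤ r * q
*-monoˡ {r} h = *-monoˡ-≤-nonNeg r {{nonNegative h}}

*-monoʳ : ∀ {r p q} → 0ℚ ≤ r → p ≤ q → p * r ≤ q * r
*-monoʳ {r} h = *-monoʳ-≤-nonNeg r {{nonNegative h}}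

*-mono : ∀ {p q r s} → 0ℚ ≤ r → 0ℚ ≤ q → p ≤ q → r ≤ s → p * r ≤ q * s
*-mono hr hq pq rs = ≤-trans (*-monoʳ hr pq) (*-monoˡ hq rs)

*-cancel-ℕ : ∀ k {p q} → ℕtoℚ (suc k) * p ≡ ℕtoℚ (suc k) * q → p ≡ q
*-cancel-ℕ k {p} {q} e = begin
  p ≡⟨ h p ⟩
  recipℕ (suc k) * (ℕtoℚ (suc k) * p) ≡⟨ cong (recipℕ (suc k) *_) e ⟩
  recipℕ (suc k) * (ℕtoℚ (suc k) * q) ≡⟨ sym (h q) ⟩
  q ∎
  where
  h : ∀ p → p ≡ recipℕ (suc k) * (ℕtoℚ (suc k) * p)
  h p = sym (trans (sym (*-assoc (recipℕ (suc k)) (ℕtoℚ (suc k)) p)) (≡1-* p (recip*ℕ k)))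

ℕtoℚ-mono : ∀ {m n} → m ℕ.≤ n → ℕtoℚ m ≤ ℕtoℚ n
ℕtoℚ-mono {m} {n} h = subst₂ _≤_ (+-identityʳ (ℕtoℚ m)) (trans (sym (ℕtoℚ-+ m (n ∸ m))) (cong ℕtoℚ (ℕₚ.m+[n∸m]≡n h)))
  (+-monoʳ-≤ (ℕtoℚ m) (0≤ℕtoℚ (n ∸ m)))

recip-unique : ∀ k {x} → x * ℕtoℚ (suc k) ≡ 1ℚ → x ≡ recipℕ (suc k)
recip-unique k {x} e =
  *-cancel-ℕ k (trans (*-comm (ℕtoℚ (suc k)) x)
  (trans e (trans (sym (recip*ℕ k)) (*-comm (recipℕ (suc k)) (ℕtoℚ (suc k))))))

recip-antimono : ∀ {m n} → suc m ℕ.≤ suc n → recipℕ (suc n) ≤ recipℕ (suc m)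
recip-antimono {m} {n} h = subst₂ _≤_ e₁ e₂ (*-monoˡ (*-nonNeg (0≤recip (suc m)) (0≤recip (suc n))) (ℕtoℚ-mono h))
  where
  a = recipℕ (suc m)
  b = recipℕ (suc n)
  e₁ : a * b * ℕtoℚ (suc m) ≡ b
  e₁ = trans (solve 3 (λ a b c → a :* b :* c := b :* (a :* c)) refl a b (ℕtoℚ (suc m))) (*-≡1 b (recip*ℕ m))
  e₂ : a * b * ℕtoℚ (suc n) ≡ a
  e₂ = trans (*-assoc a b _) (*-≡1 a (recip*ℕ n))

≤-fst : ∀ {n} i j → i ℕ.+ j ≡ n → i ℕ.≤ n
≤-fst i j refl = ℕₚ.m≤m+n i j

≤-snd : ∀ {n} i j → i ℕ.+ j ≡ n → j ℕ.≤ n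
≤-snd i j refl = ℕₚ.m≤n+m j i

-- Finite sums

∑ₗ : ∀ {A : Set} → List A → (A → ℚ) → ℚ
∑ₗ [] f = 0ℚ
∑ₗ (x ∷ xs) f = f x + ∑ₗ xs f

module _ {A : Set} where
  ∑ₗ-cong : ∀ {f g : A → ℚ} xs → (∀ x → f x ≡ g x) → ∑ₗ xs f ≡ ∑ₗ xs g
  ∑ₗ-cong [] h = refl
  ∑ₗ-cong (x ∷ xs) h = cong₂ _+_ (h x) (∑ₗ-cong xs h)

  ∑ₗ-zero : ∀ (xs : List A) {f} → (∀ x → f x ≡ 0ℚ) → ∑ₗ xs f ≡ 0ℚ
  ∑ₗ-zero [] h = refl
  ∑ₗ-zero (x ∷ xs) h = trans (cong₂ _+_ (h x) (∑ₗ-zero xs h)) refl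

  ∑ₗ-+ : ∀ (f g : A → ℚ) xs → ∑ₗ xs (λ x → f x + g x) ≡ ∑ₗ xs f + ∑ₗ xs g
  ∑ₗ-+ f g [] = refl
  ∑ₗ-+ f g (x ∷ xs) = trans (cong (f x + g x +_) (∑ₗ-+ f g xs))
    (solve 4 (λ a b c d → a :+ b :+ (c :+ d) := a :+ c :+ (b :+ d)) refl (f x) (g x) (∑ₗ xs f) (∑ₗ xs g))

  ∑ₗ-*ˡ : ∀ c (f : A → ℚ) xs → ∑ₗ xs (λ x → c * f x) ≡ c * ∑ₗ xs f
  ∑ₗ-*ˡ c f [] = sym (*-zeroʳ c)
  ∑ₗ-*ˡ c f (x ∷ xs) = trans (cong (c * f x +_) (∑ₗ-*ˡ c f xs)) (sym (*-distribˡ-+ c (f x) (∑ₗ xs f)))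

  ∑ₗ-*ʳ : ∀ c (f : A → ℚ) xs → ∑ₗ xs (λ x → f x * c) ≡ ∑ₗ xs f * c
  ∑ₗ-*ʳ c f xs = trans (∑ₗ-cong xs (λ x → *-comm (f x) c)) (trans (∑ₗ-*ˡ c f xs) (*-comm c (∑ₗ xs f)))

  ∑ₗ-++ : ∀ (f : A → ℚ) xs ys → ∑ₗ (xs ++ ys) f ≡ ∑ₗ xs f + ∑ₗ ys f
  ∑ₗ-++ f [] ys = sym (+-identityˡ _)
  ∑ₗ-++ f (x ∷ xs) ys = trans (cong (f x +_) (∑ₗ-++ f xs ys)) (sym (+-assoc (f x) _ _))

  ∑ₗ-nonNeg : ∀ (f : A → ℚ) xs → (∀ x → 0ℚ ≤ f x) → 0ℚ ≤ ∑ₗ xs f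
  ∑ₗ-nonNeg f [] h = ≤-refl
  ∑ₗ-nonNeg f (x ∷ xs) h = +-nonNeg (h x) (∑ₗ-nonNeg f xs h)

  ∑ₗ-map : ∀ {B : Set} (g : B → A) (f : A → ℚ) xs → ∑ₗ (map g xs) f ≡ ∑ₗ xs (f ∘ g)
  ∑ₗ-map g f [] = refl
  ∑ₗ-map g f (x ∷ xs) = cong (f (g x) +_) (∑ₗ-map g f xs)

  ∑ₗ-concatMap : ∀ {B : Set} (g : B → List A) (f : A → ℚ) xs → ∑ₗ (concatMap g xs) f ≡ ∑ₗ xs (λ x → ∑ₗ (g x) f)
  ∑ₗ-concatMap g f [] = refl
  ∑ₗ-concatMap g f (x ∷ xs) = trans (∑ₗ-++ f (g x) (concatMap g xs)) (cong (∑ₗ (g x) f +_) (∑ₗ-concatMap g f xs))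

∑ₗ-swap : ∀ {A B : Set} (f : A → B → ℚ) xs ys → ∑ₗ xs (λ x → ∑ₗ ys (f x)) ≡ ∑ₗ ys (λ y → ∑ₗ xs (λ x → f x y))
∑ₗ-swap f [] ys = sym (∑ₗ-zero ys (λ _ → refl))
∑ₗ-swap f (x ∷ xs) ys = trans (cong (∑ₗ ys (f x) +_) (∑ₗ-swap f xs ys))
  (sym (∑ₗ-+ (f x) (λ y → ∑ₗ xs (λ x → f x y)) ys))

-- Convolutions run over pairs with `i + j = n` instead of `i` and `n ∸ i`, which keeps truncated
-- subtraction out of the algebra; `anti-∑` translates where the definitions use `∸`.
antidiagonal : ℕ → List (ℕ × ℕ)
antidiagonal zero = (0 , 0) ∷ []
antidiagonal (suc n) = (0 , suc n) ∷ map (λ p → suc (proj₁ p) , proj₂ p) (antidiagonal n)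

-- Opacity keeps `∑` and `anti` from unfolding into list computations during type checking; outside
-- this block they are governed by the equations proved in it.
opaque
  ∑ : ℕ → (ℕ → ℚ) → ℚ
  ∑ n f = ∑ₗ (upTo n) f

  ∑ₗ-applyUpTo : ∀ {A : Set} (g : ℕ → A) (f : A → ℚ) n → ∑ₗ (applyUpTo g n) f ≡ ∑ n (f ∘ g)
  ∑ₗ-applyUpTo g f n = go g f n id
    where
    go : ∀ {A : Set} (g : ℕ → A) (f : A → ℚ) n (h : ℕ → ℕ) → ∑ₗ (applyUpTo (g ∘ h) n) f ≡ ∑ₗ (applyUpTo h n) (f ∘ g)
    go g f zero h = refl
    go g f (suc n) h = cong (f (g (h 0)) +_) (go g f n (h ∘ suc))

  ∑-suc : ∀ n f → ∑ (suc n) f ≡ f 0 + ∑ n (f ∘ suc)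
  ∑-suc n f = cong (f 0 +_) (∑ₗ-applyUpTo suc f n)

  anti : ℕ → (ℕ → ℕ → ℚ) → ℚ
  anti n f = ∑ₗ (antidiagonal n) (λ p → f (proj₁ p) (proj₂ p))

  anti-0 : ∀ f → anti 0 f ≡ f 0 0
  anti-0 f = +-identityʳ (f 0 0)

  anti-suc : ∀ n f → anti (suc n) f ≡ f 0 (suc n) + anti n (λ i j → f (suc i) j)
  anti-suc n f = cong (f 0 (suc n) +_) (∑ₗ-map _ _ (antidiagonal n))

  ∑-cong : ∀ n {f g : ℕ → ℚ} → (∀ i → f i ≡ g i) → ∑ n f ≡ ∑ n g
  ∑-cong n = ∑ₗ-cong (upTo n)

  ∑-+ : ∀ n (f g : ℕ → ℚ) → ∑ n (λ i → f i + g i) ≡ ∑ n f + ∑ n g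
  ∑-+ n f g = ∑ₗ-+ f g (upTo n)

  ∑-*ˡ : ∀ n c f → ∑ n (λ i → c * f i) ≡ c * ∑ n f
  ∑-*ˡ n c f = ∑ₗ-*ˡ c f (upTo n)

  ∑-nonNeg : ∀ n f → (∀ i → 0ℚ ≤ f i) → 0ℚ ≤ ∑ n f
  ∑-nonNeg n f = ∑ₗ-nonNeg f (upTo n)

  ∑-∑ₗ : ∀ {A : Set} n (xs : List A) (f : ℕ → A → ℚ) → ∑ n (λ i → ∑ₗ xs (f i)) ≡ ∑ₗ xs (λ x → ∑ n (λ i → f i x))
  ∑-∑ₗ n xs f = ∑ₗ-swap f (upTo n) xs

  ∑-swap : ∀ m n (f : ℕ → ℕ → ℚ) → ∑ m (λ i → ∑ n (f i)) ≡ ∑ n (λ j → ∑ m (λ i → f i j))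
  ∑-swap m n f = ∑ₗ-swap f (upTo m) (upTo n)

  ∑-anti : ∀ m n (f : ℕ → ℕ → ℕ → ℚ) → ∑ m (λ i → anti n (f i)) ≡ anti n (λ a b → ∑ m (λ i → f i a b))
  ∑-anti m n f = ∑ₗ-swap (λ i p → f i (proj₁ p) (proj₂ p)) (upTo m) (antidiagonal n)

  anti-∑ₗ : ∀ {A : Set} n (xs : List A) (f : ℕ → ℕ → A → ℚ) → anti n (λ a b → ∑ₗ xs (f a b)) ≡ ∑ₗ xs
    (λ x → anti n (λ a b → f a b x))
  anti-∑ₗ n xs f = ∑ₗ-swap (λ p x → f (proj₁ p) (proj₂ p) x) (antidiagonal n) xs

  anti-nonNeg : ∀ n f → (∀ i j → 0ℚ ≤ f i j) → 0ℚ ≤ anti n f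
  anti-nonNeg n f h = ∑ₗ-nonNeg _ (antidiagonal n) (λ p → h (proj₁ p) (proj₂ p))

  anti-cong : ∀ n {f g : ℕ → ℕ → ℚ} → (∀ i j → f i j ≡ g i j) → anti n f ≡ anti n g
  anti-cong n h = ∑ₗ-cong (antidiagonal n) (λ p → h (proj₁ p) (proj₂ p))

  anti-+ : ∀ n f g → anti n (λ i j → f i j + g i j) ≡ anti n f + anti n g
  anti-+ n f g = ∑ₗ-+ _ _ (antidiagonal n)

  anti-*ˡ : ∀ n c f → anti n (λ i j → c * f i j) ≡ c * anti n f
  anti-*ˡ n c f = ∑ₗ-*ˡ c _ (antidiagonal n)

  anti-*ʳ : ∀ n c f → anti n (λ i j → f i j * c) ≡ anti n f * c
  anti-*ʳ n c f = ∑ₗ-*ʳ c _ (antidiagonal n)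

  anti-null : ∀ n → anti n (λ _ _ → 0ℚ) ≡ 0ℚ
  anti-null n = ∑ₗ-zero (antidiagonal n) (λ _ → refl)

  ∑ₗ-upTo : ∀ n f → ∑ₗ (upTo n) f ≡ ∑ n f
  ∑ₗ-upTo n f = refl

  ∑-0 : ∀ f → ∑ 0 f ≡ 0ℚ
  ∑-0 f = refl

∑-last : ∀ n f → ∑ (suc n) f ≡ ∑ n f + f n
∑-last zero f = trans (∑-suc 0 f) (trans (+-comm (f 0) _) (cong (_+ f 0) (trans (∑-0 _) (sym (∑-0 f)))))
∑-last (suc n) f = begin
  ∑ (suc (suc n)) f ≡⟨ ∑-suc (suc n) f ⟩
  f 0 + ∑ (suc n) (f ∘ suc) ≡⟨ cong (f 0 +_) (∑-last n (f ∘ suc)) ⟩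
  f 0 + (∑ n (f ∘ suc) + f (suc n)) ≡⟨ sym (+-assoc (f 0) _ _) ⟩
  f 0 + ∑ n (f ∘ suc) + f (suc n) ≡⟨ cong (_+ f (suc n)) (sym (∑-suc n f)) ⟩
  ∑ (suc n) f + f (suc n) ∎

∑-cong< : ∀ n {f g} → (∀ i → i ℕ.< n → f i ≡ g i) → ∑ n f ≡ ∑ n g
∑-cong< zero {f} {g} h = trans (∑-0 f) (sym (∑-0 g))
∑-cong< (suc n) {f} {g} h =
  trans (∑-last n f) (trans (cong₂ _+_ (∑-cong< n (λ i l → h i (ℕₚ.m<n⇒m<1+n l))) (h n ℕₚ.≤-refl)) (sym (∑-last n g)))

∑-mono< : ∀ n {f g} → (∀ i → i ℕ.< n → f i ≤ g i) → ∑ n f ≤ ∑ n g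
∑-mono< zero {f} {g} h = ≤-reflexive (trans (∑-0 f) (sym (∑-0 g)))
∑-mono< (suc n) {f} {g} h = subst₂ _≤_ (sym (∑-last n f)) (sym (∑-last n g))
  (+-mono-≤ (∑-mono< n (λ i l → h i (ℕₚ.m<n⇒m<1+n l))) (h n ℕₚ.≤-refl))

anti-sucʳ : ∀ n f → anti (suc n) f ≡ anti n (λ i j → f i (suc j)) + f (suc n) 0
anti-sucʳ zero f = trans (anti-suc 0 f) (cong₂ _+_ (sym (anti-0 _)) (anti-0 _))
anti-sucʳ (suc n) f = begin
  anti (suc (suc n)) f ≡⟨ anti-suc (suc n) f ⟩
  f 0 (suc (suc n)) + anti (suc n) (λ i j → f (suc i) j)
    ≡⟨ cong (f 0 (suc (suc n)) +_) (anti-sucʳ n (λ i j → f (suc i) j)) ⟩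
  f 0 (suc (suc n)) + (anti n (λ i j → f (suc i) (suc j)) + f (suc (suc n)) 0)
    ≡⟨ sym (+-assoc (f 0 (suc (suc n))) _ _) ⟩
  f 0 (suc (suc n)) + anti n (λ i j → f (suc i) (suc j)) + f (suc (suc n)) 0
    ≡⟨ cong (_+ f (suc (suc n)) 0) (sym (anti-suc n (λ i j → f i (suc j)))) ⟩
  anti (suc n) (λ i j → f i (suc j)) + f (suc (suc n)) 0 ∎

anti-cong≡ : ∀ n {f g : ℕ → ℕ → ℚ} → (∀ i j → i ℕ.+ j ≡ n → f i j ≡ g i j) → anti n f ≡ anti n g
anti-cong≡ zero {f} {g} h = trans (anti-0 f) (trans (h 0 0 refl) (sym (anti-0 g)))
anti-cong≡ (suc n) {f} {g} h =
  trans (anti-suc n f) (trans (cong₂ _+_ (h 0 (suc n) refl) (anti-cong≡ n (λ i j e → h (suc i) j (cong suc e))))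
  (sym (anti-suc n g)))

anti-nonNeg≡ : ∀ n (f : ℕ → ℕ → ℚ) → (∀ i j → i ℕ.+ j ≡ n → 0ℚ ≤ f i j) → 0ℚ ≤ anti n f
anti-nonNeg≡ zero f h = subst (0ℚ ≤_) (sym (anti-0 f)) (h 0 0 refl)
anti-nonNeg≡ (suc n) f h = subst (0ℚ ≤_) (sym (anti-suc n f))
  (+-nonNeg (h 0 (suc n) refl) (anti-nonNeg≡ n _ (λ i j e → h (suc i) j (cong suc e))))

anti-zero : ∀ n {f : ℕ → ℕ → ℚ} → (∀ i j → i ℕ.+ j ≡ n → f i j ≡ 0ℚ) → anti n f ≡ 0ℚ
anti-zero n h = trans (anti-cong≡ n h) (anti-null n)

anti-comm : ∀ n f → anti n f ≡ anti n (λ i j → f j i)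
anti-comm zero f = trans (anti-0 f) (sym (anti-0 _))
anti-comm (suc n) f = begin
  anti (suc n) f ≡⟨ anti-suc n f ⟩
  f 0 (suc n) + anti n (λ i j → f (suc i) j) ≡⟨ cong (f 0 (suc n) +_) (anti-comm n _) ⟩
  f 0 (suc n) + anti n (λ i j → f (suc j) i) ≡⟨ +-comm (f 0 (suc n)) _ ⟩
  anti n (λ i j → f (suc j) i) + f 0 (suc n) ≡⟨ sym (anti-sucʳ n (λ i j → f j i)) ⟩
  anti (suc n) (λ i j → f j i) ∎

-- Both sides sum over all triples with `a + b + c = n`. The induction splits off `a = 0`, whose
-- terms form the antidiagonal sum of `f 0`.
anti-assoc : ∀ n (f : ℕ → ℕ → ℕ → ℚ) → anti n (λ i c → anti i (λ a b → f a b c)) ≡ anti n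
  (λ a i → anti i (λ b c → f a b c))
anti-assoc zero f = trans (anti-0 _) (trans (anti-0 _) (sym (trans (anti-0 _) (anti-0 _))))
anti-assoc (suc n) f = begin
  anti (suc n) (λ i c → anti i (λ a b → f a b c)) ≡⟨ anti-suc n _ ⟩
  anti 0 (λ a b → f a b (suc n)) + anti n (λ i c → anti (suc i) (λ a b → f a b c))
    ≡⟨ cong₂ _+_ (anti-0 (λ a b → f a b (suc n)))
      (trans (anti-cong n (λ i c → anti-suc i (λ a b → f a b c))) (anti-+ n _ _)) ⟩
  f 0 0 (suc n) + (anti n (λ i c → f 0 (suc i) c) + anti n (λ i c → anti i (λ a b → f (suc a) b c)))
    ≡⟨ sym (+-assoc (f 0 0 (suc n)) _ _) ⟩
  f 0 0 (suc n) + anti n (λ i c → f 0 (suc i) c) + anti n (λ i c → anti i (λ a b → f (suc a) b c))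
    ≡⟨ cong₂ _+_ (sym (anti-suc n (f 0))) (anti-assoc n (λ a → f (suc a))) ⟩
  anti (suc n) (f 0) + anti n (λ a i → anti i (λ b c → f (suc a) b c))
    ≡⟨ sym (anti-suc n (λ a i → anti i (λ b c → f a b c))) ⟩
  anti (suc n) (λ a i → anti i (λ b c → f a b c)) ∎

anti-∑ : ∀ n (f : ℕ → ℕ → ℚ) → ∑ (suc n) (λ k → f k (n ∸ k)) ≡ anti n f
anti-∑ zero f = trans (∑-suc 0 _) (trans (cong (f 0 0 +_) (∑-0 _)) (trans (+-identityʳ _) (sym (anti-0 f))))
anti-∑ (suc n) f = begin
  ∑ (suc (suc n)) (λ k → f k (suc n ∸ k)) ≡⟨ ∑-suc (suc n) _ ⟩
  f 0 (suc n) + ∑ (suc n) (λ k → f (suc k) (n ∸ k)) ≡⟨ cong (f 0 (suc n) +_) (anti-∑ n (λ i j → f (suc i) j)) ⟩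
  f 0 (suc n) + anti n (λ i j → f (suc i) j) ≡⟨ sym (anti-suc n f) ⟩
  anti (suc n) f ∎

-- Formal power series over ℚ

Series : Set
Series = ℕ → ℚ

infix 4 _≈_
_≈_ : Series → Series → Set
A ≈ B = ∀ n → A n ≡ B n

infixl 6 _⊕_ _⊖_
infixl 7 _⊛_
_⊕_ _⊛_ _⊖_ : Series → Series → Series
(A ⊕ B) n = A n + B n
(A ⊛ B) n = anti n (λ i j → A i * B j)

⊝_ : Series → Series
(⊝ A) n = - A n
A ⊖ B = A ⊕ (⊝ B)

const : ℚ → Series
const q zero = q
const q (suc n) = 0ℚ

t : Series
t 1 = 1ℚ
t _ = 0ℚ

-- The Euler operator t d/dt.
θ : Series → Series
θ A n = ℕtoℚ n * A n

⊛-cong : ∀ {A B C D} → A ≈ B → C ≈ D → A ⊛ C ≈ B ⊛ D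
⊛-cong h k n = anti-cong n (λ i j → cong₂ _*_ (h i) (k j))

⊛-comm : ∀ A B → A ⊛ B ≈ B ⊛ A
⊛-comm A B n = trans (anti-comm n _) (anti-cong n (λ i j → *-comm (A j) (B i)))

⊛-assoc : ∀ A B C → (A ⊛ B) ⊛ C ≈ A ⊛ (B ⊛ C)
⊛-assoc A B C n = begin
  anti n (λ i c → anti i (λ a b → A a * B b) * C c)
    ≡⟨ anti-cong n (λ i c → trans (sym (anti-*ʳ i (C c) _)) (anti-cong i (λ a b → *-assoc (A a) (B b) (C c)))) ⟩
  anti n (λ i c → anti i (λ a b → A a * (B b * C c))) ≡⟨ anti-assoc n (λ a b c → A a * (B b * C c)) ⟩
  anti n (λ a i → anti i (λ b c → A a * (B b * C c))) ≡⟨ anti-cong n (λ a i → anti-*ˡ i (A a) _) ⟩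
  anti n (λ a i → A a * anti i (λ b c → B b * C c)) ∎

⊛-distribˡ : ∀ A B C → A ⊛ (B ⊕ C) ≈ A ⊛ B ⊕ A ⊛ C
⊛-distribˡ A B C n = trans (anti-cong n (λ i j → *-distribˡ-+ (A i) (B j) (C j))) (anti-+ n _ _)

⊛-suc : ∀ A B n → (A ⊛ B) (suc n) ≡ A 0 * B (suc n) + ((A ∘ suc) ⊛ B) n
⊛-suc A B n = anti-suc n _

⊛-0 : ∀ A B → (A ⊛ B) 0 ≡ A 0 * B 0
⊛-0 A B = anti-0 _

zero⊛ : ∀ {A} B → A ≈ (λ _ → 0ℚ) → A ⊛ B ≈ (λ _ → 0ℚ)
zero⊛ B h n = anti-zero n (λ i j _ → ≡0-* (B j) (h i))

const-⊛ : ∀ q A n → (const q ⊛ A) n ≡ q * A n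
const-⊛ q A zero = ⊛-0 (const q) A
const-⊛ q A (suc n) = trans (⊛-suc (const q) A n) (+-≡0 (q * A (suc n)) (zero⊛ A (λ _ → refl) n))

t-⊛-suc : ∀ A n → (t ⊛ A) (suc n) ≡ A n
t-⊛-suc A n = trans (⊛-suc t A n)
  (trans (cong₂ _+_ (*-zeroˡ (A (suc n))) (trans (⊛-cong {C = A} h (λ _ → refl) n) (const-⊛ 1ℚ A n)))
  (trans (+-identityˡ _) (*-identityˡ _)))
  where
  h : t ∘ suc ≈ const 1ℚ
  h zero = refl
  h (suc n) = refl

t-⊛-0 : ∀ A → (t ⊛ A) 0 ≡ 0ℚ
t-⊛-0 A = trans (⊛-0 t A) (*-zeroˡ (A 0))

isCommutativeRing : IsCommutativeRing _≈_ _⊕_ _⊛_ ⊝_ (const 0ℚ) (const 1ℚ)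
isCommutativeRing = record
  { isRing = record
    { +-isAbelianGroup = record
      { isGroup = record
        { isMonoid = record
          { isSemigroup = record
            { isMagma = record { isEquivalence =
              record { refl = λ _ → refl ; sym = λ h n → sym (h n) ; trans = λ h k n → trans (h n) (k n) } ; ∙-cong =
              λ h k n → cong₂ _+_ (h n) (k n) }
            ; assoc = λ A B C n → +-assoc (A n) (B n) (C n) }
          ; identity = (λ A n → ≡0-+ (A n) (c0 n)) , (λ A n → +-≡0 (A n) (c0 n)) }
        ; inverse = (λ A n → trans (+-inverseˡ (A n)) (sym (c0 n))) , (λ A n → trans (+-inverseʳ (A n)) (sym (c0 n)))
        ; ⁻¹-cong = λ h n → cong (-_) (h n) }
      ; comm = λ A B n → +-comm (A n) (B n) }
    ; *-cong = ⊛-cong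
    ; *-assoc = ⊛-assoc
    ; *-identity = idˡ , (λ A n → trans (⊛-comm A (const 1ℚ) n) (idˡ A n))
    ; distrib = ⊛-distribˡ ,
      (λ A B C n → trans (⊛-comm (B ⊕ C) A n) (trans (⊛-distribˡ A B C n) (cong₂ _+_ (⊛-comm A B n) (⊛-comm A C n))))
      }
  ; *-comm = ⊛-comm }
  where
  c0 : ∀ n → const 0ℚ n ≡ 0ℚ
  c0 zero = refl
  c0 (suc n) = refl
  idˡ : ∀ A → const 1ℚ ⊛ A ≈ A
  idˡ A n = trans (const-⊛ 1ℚ A n) (*-identityˡ (A n))

seriesRing : CommutativeRing 0ℓ 0ℓ
seriesRing = record { isCommutativeRing = isCommutativeRing }

-- Rational numbers serve as the coefficients of the ring solver for series, so that constants such
-- as `½` are evaluated and not treated as atoms.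
const-hom : CommutativeRing.rawRing +-*-commutativeRing -Raw-AlmostCommutative⟶ fromCommutativeRing seriesRing
const-hom = record
  { ⟦_⟧ = const
  ; +-homo = λ { x y zero → refl ; x y (suc n) → refl }
  ; *-homo = λ { x y zero → sym (const-⊛ x (const y) zero) ; x y (suc n) →
    sym (trans (const-⊛ x (const y) (suc n)) (*-zeroʳ x)) }
  ; -‿homo = λ { x zero → refl ; x (suc n) → refl }
  ; 0-homo = λ _ → refl
  ; 1-homo = λ _ → refl }

const≟ : ∀ x y → Maybe (Induced-equivalence const-hom x y)
const≟ x y with x ≟ y
... | yes refl = just (λ _ → refl)
... | no _ = nothing

module ⊛-Solver = RingSolver (CommutativeRing.rawRing +-*-commutativeRing) (fromCommutativeRing seriesRing) const-hom
  const≟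
open ⊛-Solver using ()
  renaming (solve to solveₛ; _:+_ to _+ₛ_; _:*_ to _*ₛ_; _:-_ to _-ₛ_; :-_ to -ₛ_; con to conₛ; _:=_ to _=ₛ_)

θ-⊛ : ∀ A B → θ (A ⊛ B) ≈ θ A ⊛ B ⊕ A ⊛ θ B
θ-⊛ A B n = begin
  ℕtoℚ n * anti n (λ i j → A i * B j) ≡⟨ sym (anti-*ˡ n (ℕtoℚ n) (λ i j → A i * B j)) ⟩
  anti n (λ i j → ℕtoℚ n * (A i * B j))
    ≡⟨ anti-cong≡ n (λ i j e → trans (cong (λ m → ℕtoℚ m * (A i * B j)) (sym e))
    (trans (cong (_* (A i * B j)) (ℕtoℚ-+ i j))
     (solve 4 (λ i j a b → (i :+ j) :* (a :* b) := i :* a :* b :+ a :* (j :* b)) refl (ℕtoℚ i) (ℕtoℚ j) (A i)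
       (B j)))) ⟩
  anti n (λ i j → ℕtoℚ i * A i * B j + A i * (ℕtoℚ j * B j)) ≡⟨ anti-+ n _ _ ⟩
  (θ A ⊛ B ⊕ A ⊛ θ B) n ∎

-- `P` is the logarithmic derivative t A′/A, stated without division.
LogDer : Series → Series → Set
LogDer A P = θ A ≈ P ⊛ A

LogDer-⊛ : ∀ {A B P Q} → LogDer A P → LogDer B Q → LogDer (A ⊛ B) (P ⊕ Q)
LogDer-⊛ {A} {B} {P} {Q} a b n = begin
  θ (A ⊛ B) n ≡⟨ θ-⊛ A B n ⟩
  (θ A ⊛ B ⊕ A ⊛ θ B) n ≡⟨ cong₂ _+_ (⊛-cong {C = B} a (λ _ → refl) n) (⊛-cong {A} (λ _ → refl) b n) ⟩
  (P ⊛ A ⊛ B ⊕ A ⊛ (Q ⊛ B)) n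
    ≡⟨ solveₛ 4 (λ p a b q → p *ₛ a *ₛ b +ₛ a *ₛ (q *ₛ b) =ₛ (p +ₛ q) *ₛ (a *ₛ b)) (λ _ → refl) P A B Q n ⟩
  ((P ⊕ Q) ⊛ (A ⊛ B)) n ∎

⊛-cong-below : ∀ P A B n → (∀ j → j ℕ.≤ n → A j ≡ B j) → (P ⊛ A) n ≡ (P ⊛ B) n
⊛-cong-below P A B n h = anti-cong≡ n (λ i j e → cong (P i *_) (h j (≤-snd i j e)))

-- Because `P 0` vanishes, `A (suc n)` drops out of the right-hand side, and the differential
-- equation becomes a recursion that determines `A` from `A 0`.
LogDer-step : ∀ A P → P 0 ≡ 0ℚ → LogDer A P → ∀ n → ℕtoℚ (suc n) * A (suc n) ≡ ((P ∘ suc) ⊛ A) n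
LogDer-step A P p a n = trans (a (suc n)) (trans (⊛-suc P A n) (≡0-+ (((P ∘ suc) ⊛ A) n) (≡0-* (A (suc n)) p)))

LogDer-unique : ∀ A B P → P 0 ≡ 0ℚ → A 0 ≡ B 0 → LogDer A P → LogDer B P → A ≈ B
LogDer-unique A B P p z a b = <-rec _ step
  where
  step : ∀ n → (∀ {j} → j ℕ.< n → A j ≡ B j) → A n ≡ B n
  step zero ih = z
  step (suc n) ih = *-cancel-ℕ n
    (trans (LogDer-step A P p a n)
    (trans (⊛-cong-below (P ∘ suc) A B n (λ j l → ih (s≤s l))) (sym (LogDer-step B P p b n))))

-- In the lowest degree where `Y` could be nonzero, its coefficient meets only the invertible `A 0`.
⊛-cancel-unit : ∀ A Y r → r * A 0 ≡ 1ℚ → A ⊛ Y ≈ const 0ℚ → ∀ n → Y n ≡ 0ℚ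
⊛-cancel-unit A Y r ra e = <-rec _ step
  where
  e′ : ∀ n → A 0 * Y n ≡ 0ℚ → Y n ≡ 0ℚ
  e′ n h = trans (sym (trans (sym (*-assoc r (A 0) (Y n))) (≡1-* (Y n) ra))) (*-≡0 r h)
  step : ∀ n → (∀ {j} → j ℕ.< n → Y j ≡ 0ℚ) → Y n ≡ 0ℚ
  step zero ih = e′ 0 (trans (sym (⊛-0 A Y)) (e 0))
  step (suc n) ih = e′ (suc n) (begin
    A 0 * Y (suc n) ≡⟨ sym (+-identityʳ _) ⟩
    A 0 * Y (suc n) + 0ℚ ≡⟨ cong (A 0 * Y (suc n) +_)
      (sym (anti-zero n (λ i j f → *-≡0 (A (suc i)) (ih (s≤s (≤-snd i j f)))))) ⟩
    A 0 * Y (suc n) + ((A ∘ suc) ⊛ Y) n ≡⟨ sym (⊛-suc A Y n) ⟩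
    (A ⊛ Y) (suc n) ≡⟨ e (suc n) ⟩
    0ℚ ∎)

-- Fixed-point iteration for θ A = P ⊛ A, A 0 = 1: after n rounds the coefficients up to n are stable.
private
  iterate : (P : Series) → ℕ → Series
  iterate P f zero = 1ℚ
  iterate P zero (suc m) = 0ℚ
  iterate P (suc f) (suc m) = recipℕ (suc m) * ((P ∘ suc) ⊛ iterate P f) m

  iterate-stable : ∀ P m f g → m ℕ.≤ f → m ℕ.≤ g → iterate P f m ≡ iterate P g m
  iterate-stable P zero zero zero _ _ = refl
  iterate-stable P zero zero (suc g) _ _ = refl
  iterate-stable P zero (suc f) zero _ _ = refl
  iterate-stable P zero (suc f) (suc g) _ _ = refl
  iterate-stable P (suc m) (suc f) (suc g) (s≤s l) (s≤s k) = cong (recipℕ (suc m) *_)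
    (⊛-cong-below (P ∘ suc) (iterate P f) (iterate P g) m
      (λ j h → iterate-stable P j f g (ℕₚ.≤-trans h l) (ℕₚ.≤-trans h k)))

integrate : Series → Series
integrate P m = iterate P m m

integrate-LogDer : ∀ P → P 0 ≡ 0ℚ → LogDer (integrate P) P
integrate-LogDer P p zero = trans (*-zeroˡ (integrate P 0))
  (sym (trans (⊛-0 P (integrate P)) (≡0-* (integrate P 0) p)))
integrate-LogDer P p (suc m) = begin
  ℕtoℚ (suc m) * (recipℕ (suc m) * X)
    ≡⟨ solve 3 (λ a b c → a :* (b :* c) := b :* a :* c) refl (ℕtoℚ (suc m)) (recipℕ (suc m)) X ⟩
  recipℕ (suc m) * ℕtoℚ (suc m) * X ≡⟨ ≡1-* X (recip*ℕ m) ⟩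
  X ≡⟨ ⊛-cong-below (P ∘ suc) (iterate P m) (integrate P) m (λ j l → iterate-stable P j m j l ℕₚ.≤-refl) ⟩
  ((P ∘ suc) ⊛ integrate P) m ≡⟨ sym (+-identityˡ _) ⟩
  0ℚ + ((P ∘ suc) ⊛ integrate P) m ≡⟨ cong (_+ ((P ∘ suc) ⊛ integrate P) m) (sym (≡0-* (integrate P (suc m)) p)) ⟩
  P 0 * integrate P (suc m) + ((P ∘ suc) ⊛ integrate P) m ≡⟨ sym (⊛-suc P (integrate P) m) ⟩
  (P ⊛ integrate P) (suc m) ∎
  where X = ((P ∘ suc) ⊛ iterate P m) m

-- Bernoulli numbers and the series of tanh

recip*ℕ′ : ∀ k .{{_ : ℕ.NonZero k}} → recipℕ k * ℕtoℚ k ≡ 1ℚ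
recip*ℕ′ (suc k) = recip*ℕ k

recip-* : ∀ a b → recipℕ (a ℕ.* b) ≡ recipℕ a * recipℕ b
recip-* zero b = sym (*-zeroˡ (recipℕ b))
recip-* (suc a) zero = trans (cong recipℕ (ℕₚ.*-zeroʳ a)) (sym (*-zeroʳ (recipℕ (suc a))))
recip-* (suc a) (suc b) = sym (recip-unique (b ℕ.+ a ℕ.* suc b) (begin
  p * q * ℕtoℚ (suc a ℕ.* suc b) ≡⟨ cong (p * q *_) (ℕtoℚ-* (suc a) (suc b)) ⟩
  p * q * (x * y) ≡⟨ solve 4 (λ p q x y → p :* q :* (x :* y) := (p :* x) :* (q :* y)) refl p q x y ⟩
  (p * x) * (q * y) ≡⟨ cong₂ _*_ (recip*ℕ a) (recip*ℕ b) ⟩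
  1ℚ * 1ℚ ≡⟨⟩
  1ℚ ∎))
  where
  p = recipℕ (suc a)
  q = recipℕ (suc b)
  x = ℕtoℚ (suc a)
  y = ℕtoℚ (suc b)

invfac : ℕ → ℚ
invfac n = recipℕ (n !)

invfac*! : ∀ n → invfac n * ℕtoℚ (n !) ≡ 1ℚ
invfac*! n = recip*ℕ′ (n !) {{n !≢0}}

invfac-suc : ∀ n → ℕtoℚ (suc n) * invfac (suc n) ≡ invfac n
invfac-suc n = begin
  ℕtoℚ (suc n) * recipℕ (suc n ℕ.* n !) ≡⟨ cong (ℕtoℚ (suc n) *_) (recip-* (suc n) (n !)) ⟩
  ℕtoℚ (suc n) * (recipℕ (suc n) * invfac n)
    ≡⟨ solve 3 (λ a b c → a :* (b :* c) := b :* a :* c) refl (ℕtoℚ (suc n)) (recipℕ (suc n)) (invfac n) ⟩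
  recipℕ (suc n) * ℕtoℚ (suc n) * invfac n ≡⟨ cong (_* invfac n) (recip*ℕ n) ⟩
  1ℚ * invfac n ≡⟨ *-identityˡ (invfac n) ⟩
  invfac n ∎

binomial : ∀ {n k} → k ℕ.≤ n → ℕtoℚ (n choose k) ≡ ℕtoℚ (n !) * (invfac k * invfac (n ∸ k))
binomial {n} {k} l = begin
  c ≡⟨ solve 1 (λ c → c := c :* con 1ℚ :* con 1ℚ) refl c ⟩
  c * 1ℚ * 1ℚ ≡⟨ cong₂ (λ u v → c * u * v) (sym (invfac*! k)) (sym (invfac*! (n ∸ k))) ⟩
  c * (invfac k * ℕtoℚ (k !)) * (invfac (n ∸ k) * ℕtoℚ ((n ∸ k) !))
    ≡⟨ solve 5 (λ c a b d e → c :* (a :* b) :* (d :* e) := c :* (b :* e) :* (a :* d)) refl c (invfac k) (ℕtoℚ (k !))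
      (invfac (n ∸ k)) (ℕtoℚ ((n ∸ k) !)) ⟩
  c * (ℕtoℚ (k !) * ℕtoℚ ((n ∸ k) !)) * (invfac k * invfac (n ∸ k)) ≡⟨ cong (_* (invfac k * invfac (n ∸ k))) e ⟩
  ℕtoℚ (n !) * (invfac k * invfac (n ∸ k)) ∎
  where
  c = ℕtoℚ (n choose k)
  e : c * (ℕtoℚ (k !) * ℕtoℚ ((n ∸ k) !)) ≡ ℕtoℚ (n !)
  e = trans (cong (c *_) (sym (ℕtoℚ-* (k !) ((n ∸ k) !)))) (trans (sym (ℕtoℚ-* (n choose k) (k ! ℕ.* (n ∸ k) !)))
    (cong ℕtoℚ (trans (cong (ℕ._* (k ! ℕ.* (n ∸ k) !)) (nCk≡n!/k![n-k]! l))
      (m/n*n≡m {{k !* (n ∸ k) !≢0}} (k![n∸k]!∣n! l)))))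

lookupOr0 : List ℚ → ℕ → ℚ
lookupOr0 []       _       = 0ℚ
lookupOr0 (x ∷ xs) zero    = x
lookupOr0 (x ∷ xs) (suc k) = lookupOr0 xs k

-- The lookup function of Defs is private: the metavariable in the type of index≡lookupOr0 is solved by its
-- use in bernoulli≡lookupOr0.
mutual
  bernoulli≡lookupOr0 : ∀ m → bernoulli m ≡ lookupOr0 (bernList m) m
  bernoulli≡lookupOr0 m with bernList m
  ... | xs = index≡lookupOr0 xs m

  index≡lookupOr0 : (xs : List ℚ) (k : ℕ) → _ ≡ lookupOr0 xs k
  index≡lookupOr0 [] k = refl
  index≡lookupOr0 (x ∷ xs) zero = refl
  index≡lookupOr0 (x ∷ xs) (suc k) = index≡lookupOr0 xs k

bernNext : ℕ → ℚ
bernNext m = - (recipℕ (suc (suc m)) * sumℚ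
  (map (λ j → ℕtoℚ (suc (suc m) choose j) * lookupOr0 (bernList m) j) (upTo (suc m))))

bernList-suc : ∀ m → bernList (suc m) ≡ bernList m ++ bernNext m ∷ []
bernList-suc m = cong (λ z → bernList m ++ (- (recipℕ (suc (suc m)) * sumℚ z)) ∷ [])
  (map-cong (λ j → cong (ℕtoℚ (suc (suc m) choose j) *_) (index≡lookupOr0 (bernList m) j)) (upTo (suc m)))

lookupOr0-++ˡ : ∀ xs ys {k} → k ℕ.< length xs → lookupOr0 (xs ++ ys) k ≡ lookupOr0 xs k
lookupOr0-++ˡ (x ∷ xs) ys {zero} _ = refl
lookupOr0-++ˡ (x ∷ xs) ys {suc k} (s≤s l) = lookupOr0-++ˡ xs ys l

lookupOr0-last : ∀ xs y → lookupOr0 (xs ++ y ∷ []) (length xs) ≡ y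
lookupOr0-last [] y = refl
lookupOr0-last (x ∷ xs) y = lookupOr0-last xs y

length-bernList : ∀ m → length (bernList m) ≡ suc m
length-bernList zero = refl
length-bernList (suc m) = trans (length-++ (bernList m))
  (trans (cong (ℕ._+ 1) (length-bernList m)) (ℕₚ.+-comm (suc m) 1))

lookupOr0-bernList : ∀ m j → j ℕ.≤ m → lookupOr0 (bernList m) j ≡ bernoulli j
lookupOr0-bernList m j l with ℕₚ.m≤n⇒m<n∨m≡n l
... | inj₂ refl = sym (bernoulli≡lookupOr0 j)
lookupOr0-bernList (suc m) j l | inj₁ (s≤s l′) = trans (cong (λ z → lookupOr0 z j) (bernList-suc m))
  (trans (lookupOr0-++ˡ (bernList m) _ (subst (j ℕ.<_) (sym (length-bernList m)) (s≤s l′)))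
    (lookupOr0-bernList m j l′))

sumℚ-map : ∀ {A : Set} (f : A → ℚ) xs → sumℚ (map f xs) ≡ ∑ₗ xs f
sumℚ-map f [] = refl
sumℚ-map f (x ∷ xs) = cong (f x +_) (sumℚ-map f xs)

bernoulli-suc : ∀ m →
  bernoulli (suc m) ≡ - (recipℕ (suc (suc m)) * ∑ (suc m) (λ j → ℕtoℚ (suc (suc m) choose j) * bernoulli j))
bernoulli-suc m = begin
  bernoulli (suc m) ≡⟨ bernoulli≡lookupOr0 (suc m) ⟩
  lookupOr0 (bernList (suc m)) (suc m) ≡⟨ cong₂ lookupOr0 (bernList-suc m) (sym (length-bernList m)) ⟩
  lookupOr0 (bernList m ++ bernNext m ∷ []) (length (bernList m)) ≡⟨ lookupOr0-last (bernList m) _ ⟩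
  bernNext m ≡⟨ cong (λ z → - (recipℕ (suc (suc m)) * z))
    (trans (sumℚ-map (λ j → ℕtoℚ (suc (suc m) choose j) * lookupOr0 (bernList m) j) (upTo (suc m)))
     (trans (∑ₗ-upTo (suc m) _)
       (∑-cong< (suc m) (λ j l → cong (ℕtoℚ (suc (suc m) choose j) *_) (lookupOr0-bernList m j (ℕₚ.≤-pred l)))))) ⟩
  - (recipℕ (suc (suc m)) * ∑ (suc m) (λ j → ℕtoℚ (suc (suc m) choose j) * bernoulli j)) ∎

β : Series
β m = bernoulli m * invfac m

ex : Series
ex = invfac

-- Divided by (m+2)!, the defining recursion ∑_{j ≤ m+1} C(m+2, j) Bⱼ = 0 is the vanishing of the
-- coefficient of degree m + 2. So `β` is the series of t/(eᵗ - 1).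
bernoulli-egf : (ex ⊖ const 1ℚ) ⊛ β ≈ t
bernoulli-egf zero = ⊛-0 (ex ⊖ const 1ℚ) β
bernoulli-egf (suc zero) = trans (⊛-suc (ex ⊖ const 1ℚ) β 0) (cong (0ℚ * β 1 +_) (⊛-0 ((ex ⊖ const 1ℚ) ∘ suc) β))
bernoulli-egf (suc (suc m)) = begin
  ((ex ⊖ const 1ℚ) ⊛ β) (suc (suc m)) ≡⟨ ⊛-comm (ex ⊖ const 1ℚ) β (suc (suc m)) ⟩
  anti (suc (suc m)) (λ j i → β j * (ex ⊖ const 1ℚ) i) ≡⟨ anti-sucʳ (suc m) _ ⟩
  anti (suc m) (λ j i → β j * (invfac (suc i) + 0ℚ)) + β (suc (suc m)) * 0ℚ
    ≡⟨ cong₂ _+_ (anti-cong (suc m) (λ j i → cong (β j *_) (+-identityʳ (invfac (suc i)))))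
    (*-zeroʳ (β (suc (suc m)))) ⟩
  anti (suc m) (λ j i → β j * invfac (suc i)) + 0ℚ ≡⟨ +-identityʳ _ ⟩
  anti (suc m) (λ j i → β j * invfac (suc i)) ≡⟨ anti-sucʳ m _ ⟩
  anti m (λ j i → β j * invfac (suc (suc i))) + β (suc m) * 1ℚ ≡⟨ cong₂ _+_ e₁ e₂ ⟩
  F * Z + - (F * Z) ≡⟨ +-inverseʳ (F * Z) ⟩
  0ℚ ∎
  where
  F = invfac (suc (suc m))
  Z = ∑ (suc m) (λ j → ℕtoℚ (suc (suc m) choose j) * bernoulli j)
  e₁ : anti m (λ j i → β j * invfac (suc (suc i))) ≡ F * Z
  e₁ = trans (sym (anti-∑ m _)) (trans (∑-cong< (suc m) (λ j l → begin
      bernoulli j * invfac j * invfac (suc (suc (m ∸ j)))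
        ≡⟨ cong (λ z → bernoulli j * invfac j * invfac z) (sym (ℕₚ.+-∸-assoc 2 (ℕₚ.≤-pred l))) ⟩
      bernoulli j * invfac j * invfac (suc (suc m) ∸ j)
        ≡⟨ solve 3 (λ b i k → b :* i :* k := con 1ℚ :* (i :* k) :* b) refl (bernoulli j) (invfac j)
          (invfac (suc (suc m) ∸ j)) ⟩
      1ℚ * (invfac j * invfac (suc (suc m) ∸ j)) * bernoulli j
        ≡⟨ cong (λ z → z * (invfac j * invfac (suc (suc m) ∸ j)) * bernoulli j) (sym (invfac*! (suc (suc m)))) ⟩
      F * ℕtoℚ (suc (suc m) !) * (invfac j * invfac (suc (suc m) ∸ j)) * bernoulli j
        ≡⟨ solve 4 (λ f n k b → f :* n :* k :* b := f :* (n :* k :* b)) refl F (ℕtoℚ (suc (suc m) !))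
          (invfac j * invfac (suc (suc m) ∸ j)) (bernoulli j) ⟩
      F * (ℕtoℚ (suc (suc m) !) * (invfac j * invfac (suc (suc m) ∸ j)) * bernoulli j)
        ≡⟨ cong (λ z → F * (z * bernoulli j)) (sym (binomial (ℕₚ.≤-trans (ℕₚ.<⇒≤ l) (ℕₚ.n≤1+n (suc m))))) ⟩
      F * (ℕtoℚ (suc (suc m) choose j) * bernoulli j) ∎)) (∑-*ˡ (suc m) F _))
  e₂ : β (suc m) * 1ℚ ≡ - (F * Z)
  e₂ = begin
    bernoulli (suc m) * invfac (suc m) * 1ℚ
      ≡⟨ cong₂ (λ u v → u * v * 1ℚ) (bernoulli-suc m) (sym (invfac-suc (suc m))) ⟩
    - (r * Z) * (n * F) * 1ℚ
      ≡⟨ solve 4 (λ r z n f → :- (r :* z) :* (n :* f) :* con 1ℚ := :- (r :* n :* (f :* z))) refl r Z n F ⟩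
    - (r * n * (F * Z)) ≡⟨ cong (λ z → - (z * (F * Z))) (recip*ℕ (suc m)) ⟩
    - (1ℚ * (F * Z)) ≡⟨ cong -_ (*-identityˡ (F * Z)) ⟩
    - (F * Z) ∎
    where
    r = recipℕ (suc (suc m))
    n = ℕtoℚ (suc (suc m))

refl≈ : ∀ {A : Series} → A ≈ A
refl≈ n = refl

infixr 2 step≈ step≈˘
infix 3 _∎≈
step≈ : ∀ (A : Series) {B C} → B ≈ C → A ≈ B → A ≈ C
step≈ A h k n = trans (k n) (h n)
step≈˘ : ∀ (A : Series) {B C} → B ≈ C → B ≈ A → A ≈ C
step≈˘ A h k n = trans (sym (k n)) (h n)
syntax step≈ A h k = A ≈⟨ k ⟩ h
syntax step≈˘ A h k = A ≈˘⟨ k ⟩ h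
_∎≈ : ∀ (A : Series) → A ≈ A
A ∎≈ = refl≈

⊕-cong : ∀ {A B C D} → A ≈ B → C ≈ D → A ⊕ C ≈ B ⊕ D
⊕-cong h k n = cong₂ _+_ (h n) (k n)

⊝-cong : ∀ {A B} → A ≈ B → ⊝ A ≈ ⊝ B
⊝-cong h n = cong -_ (h n)

⊖-cong : ∀ {A B C D} → A ≈ B → C ≈ D → A ⊖ C ≈ B ⊖ D
⊖-cong h k = ⊕-cong h (⊝-cong k)

⊛-congˡ : ∀ C {A B} → A ≈ B → C ⊛ A ≈ C ⊛ B
⊛-congˡ C h = ⊛-cong {A = C} refl≈ h

⊛-congʳ : ∀ C {A B} → A ≈ B → A ⊛ C ≈ B ⊛ C
⊛-congʳ C h = ⊛-cong {C = C} h refl≈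

-- The substitution t ↦ 2t.
dilate : Series → Series
dilate A n = ℕtoℚ (2 ℕ.^ n) * A n

dilate-⊛ : ∀ A B → dilate (A ⊛ B) ≈ dilate A ⊛ dilate B
dilate-⊛ A B n = trans (sym (anti-*ˡ n (ℕtoℚ (2 ℕ.^ n)) (λ i j → A i * B j))) (anti-cong≡ n (λ i j e → begin
  ℕtoℚ (2 ℕ.^ n) * (A i * B j) ≡⟨ cong (λ z → ℕtoℚ (2 ℕ.^ z) * (A i * B j)) (sym e) ⟩
  ℕtoℚ (2 ℕ.^ (i ℕ.+ j)) * (A i * B j) ≡⟨ cong (λ z → ℕtoℚ z * (A i * B j)) (ℕₚ.^-distribˡ-+-* 2 i j) ⟩
  ℕtoℚ (2 ℕ.^ i ℕ.* 2 ℕ.^ j) * (A i * B j) ≡⟨ cong (_* (A i * B j)) (ℕtoℚ-* (2 ℕ.^ i) (2 ℕ.^ j)) ⟩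
  ℕtoℚ (2 ℕ.^ i) * ℕtoℚ (2 ℕ.^ j) * (A i * B j)
    ≡⟨ solve 4 (λ x y a b → x :* y :* (a :* b) := x :* a :* (y :* b)) refl (ℕtoℚ (2 ℕ.^ i)) (ℕtoℚ (2 ℕ.^ j)) (A i)
    (B j) ⟩
  ℕtoℚ (2 ℕ.^ i) * A i * (ℕtoℚ (2 ℕ.^ j) * B j) ∎))

2^suc : ∀ n → ℕtoℚ (2 ℕ.^ suc n) ≡ ℕtoℚ (2 ℕ.^ n) + ℕtoℚ (2 ℕ.^ n)
2^suc n = trans (cong ℕtoℚ (cong (2 ℕ.^ n ℕ.+_) (ℕₚ.+-identityʳ (2 ℕ.^ n)))) (ℕtoℚ-+ (2 ℕ.^ n) (2 ℕ.^ n))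

ex-LogDer : LogDer ex t
ex-LogDer zero = trans (*-zeroˡ (ex 0)) (sym (t-⊛-0 ex))
ex-LogDer (suc n) = trans (invfac-suc n) (sym (t-⊛-suc ex n))

dilate-ex-LogDer : LogDer (dilate ex) (t ⊕ t)
dilate-ex-LogDer zero = sym (⊛-0 (t ⊕ t) (dilate ex))
dilate-ex-LogDer (suc n) = begin
  ℕtoℚ (suc n) * (ℕtoℚ (2 ℕ.^ suc n) * invfac (suc n))
    ≡⟨ solve 3 (λ a b c → a :* (b :* c) := b :* (a :* c)) refl (ℕtoℚ (suc n)) (ℕtoℚ (2 ℕ.^ suc n)) (invfac (suc n)) ⟩
  ℕtoℚ (2 ℕ.^ suc n) * (ℕtoℚ (suc n) * invfac (suc n)) ≡⟨ cong₂ _*_ (2^suc n) (invfac-suc n) ⟩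
  (ℕtoℚ (2 ℕ.^ n) + ℕtoℚ (2 ℕ.^ n)) * invfac n ≡⟨ *-distribʳ-+ (invfac n) (ℕtoℚ (2 ℕ.^ n)) (ℕtoℚ (2 ℕ.^ n)) ⟩
  dilate ex n + dilate ex n ≡⟨ sym (cong₂ _+_ (t-⊛-suc (dilate ex) n) (t-⊛-suc (dilate ex) n)) ⟩
  (t ⊛ dilate ex ⊕ t ⊛ dilate ex) (suc n)
    ≡⟨ solveₛ 2 (λ t e → t *ₛ e +ₛ t *ₛ e =ₛ (t +ₛ t) *ₛ e) refl≈ t (dilate ex) (suc n) ⟩
  ((t ⊕ t) ⊛ dilate ex) (suc n) ∎

-- e²ᵗ = (eᵗ)²: both sides have constant term 1 and logarithmic derivative 2t.
dilate-ex : dilate ex ≈ ex ⊛ ex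
dilate-ex = LogDer-unique (dilate ex) (ex ⊛ ex) (t ⊕ t) refl (sym (⊛-0 ex ex)) dilate-ex-LogDer
  (LogDer-⊛ {ex} {ex} {t} {t} ex-LogDer ex-LogDer)

t-cancel : ∀ Y → t ⊛ Y ≈ const 0ℚ → ∀ n → Y n ≡ 0ℚ
t-cancel Y h n = trans (sym (t-⊛-suc Y n)) (h (suc n))

t-⊛-suc-shift : ∀ {A B} → A 0 ≡ 0ℚ → (∀ n → A (suc n) ≡ B n) → A ≈ t ⊛ B
t-⊛-suc-shift {B = B} z s zero = trans z (sym (t-⊛-0 B))
t-⊛-suc-shift {B = B} z s (suc n) = trans (s n) (sym (t-⊛-suc B n))

const-0 : ∀ n → const 0ℚ n ≡ 0ℚ
const-0 zero = refl
const-0 (suc n) = refl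

-≡0⇒≡ : ∀ {x y} → x - y ≡ 0ℚ → x ≡ y
-≡0⇒≡ {x} {y} h = trans (solve 2 (λ x y → x := (x :- y) :+ y) refl x y) (≡0-+ y h)

private
  ι : Series
  ι = const 1ℚ
  e₁ : Series
  e₁ = ex ∘ suc
  -- This defect vanishes since e²ᵗ - 1 = (eᵗ - 1)(eᵗ + 1). The resulting duplication formula for
  -- `β` is the source of the factor `4 ^ k ∸ 1` in `coeffA`.
  Y : Series
  Y = (ex ⊕ ι) ⊛ dilate β ⊖ (β ⊕ β)

  ex-1 : ex ⊖ ι ≈ t ⊛ e₁
  ex-1 = t-⊛-suc-shift refl (λ n → +-identityʳ (ex (suc n)))

  dilate-egf : (ex ⊖ ι) ⊛ ((ex ⊕ ι) ⊛ dilate β) ≈ t ⊕ t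
  dilate-egf =
    (ex ⊖ ι) ⊛ ((ex ⊕ ι) ⊛ dilate β)
      ≈⟨ solveₛ 2 (λ e b → (e -ₛ conₛ 1ℚ) *ₛ ((e +ₛ conₛ 1ℚ) *ₛ b) =ₛ (e *ₛ e -ₛ conₛ 1ℚ) *ₛ b) refl≈ ex (dilate β) ⟩
    (ex ⊛ ex ⊖ ι) ⊛ dilate β ≈⟨ ⊛-congʳ (dilate β) dilate-ex-1 ⟩
    dilate (ex ⊖ ι) ⊛ dilate β ≈˘⟨ dilate-⊛ (ex ⊖ ι) β ⟩
    dilate ((ex ⊖ ι) ⊛ β) ≈⟨ (λ n → cong (ℕtoℚ (2 ℕ.^ n) *_) (bernoulli-egf n)) ⟩
    dilate t ≈⟨ dilate-t ⟩
    t ⊕ t ∎≈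
    where
    dilate-ex-1 : ex ⊛ ex ⊖ ι ≈ dilate (ex ⊖ ι)
    dilate-ex-1 zero = cong (_+ - 1ℚ) (sym (dilate-ex 0))
    dilate-ex-1 (suc n) = trans (cong (_+ 0ℚ) (sym (dilate-ex (suc n))))
      (trans (+-identityʳ (dilate ex (suc n))) (cong (ℕtoℚ (2 ℕ.^ suc n) *_) (sym (+-identityʳ (ex (suc n))))))
    dilate-t : dilate t ≈ t ⊕ t
    dilate-t zero = refl
    dilate-t (suc zero) = refl
    dilate-t (suc (suc n)) = *-zeroʳ (ℕtoℚ (2 ℕ.^ suc (suc n)))

  Y≈0 : ∀ n → Y n ≡ 0ℚ
  -- eᵗ - 1 has no constant term, so it is cancelled in two stages: first the factor t, then the
  -- unit `e₁` = (eᵗ - 1)/t.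
  Y≈0 = ⊛-cancel-unit e₁ Y 1ℚ refl (λ n → trans (t-cancel (e₁ ⊛ Y) h n) (sym (const-0 n)))
    where
    h : t ⊛ (e₁ ⊛ Y) ≈ const 0ℚ
    h =
      t ⊛ (e₁ ⊛ Y) ≈˘⟨ ⊛-assoc t e₁ Y ⟩
      t ⊛ e₁ ⊛ Y ≈˘⟨ ⊛-congʳ Y ex-1 ⟩
      (ex ⊖ ι) ⊛ Y ≈⟨ solveₛ 3 (λ x b a → x *ₛ (b -ₛ (a +ₛ a)) =ₛ x *ₛ b -ₛ (x *ₛ a +ₛ x *ₛ a)) refl≈ (ex ⊖ ι)
        ((ex ⊕ ι) ⊛ dilate β) β ⟩
      (ex ⊖ ι) ⊛ ((ex ⊕ ι) ⊛ dilate β) ⊖ ((ex ⊖ ι) ⊛ β ⊕ (ex ⊖ ι) ⊛ β)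
        ≈⟨ ⊖-cong dilate-egf (⊕-cong bernoulli-egf bernoulli-egf) ⟩
      (t ⊕ t) ⊖ (t ⊕ t) ≈⟨ solveₛ 1 (λ t → (t +ₛ t) -ₛ (t +ₛ t) =ₛ conₛ 0ℚ) refl≈ t ⟩
      const 0ℚ ∎≈

-- U is the Taylor series of 1 / (eˣ + 1), so that V = - tanh (x/2) / 2.
U V : Series
U n = - ((ℕtoℚ (2 ℕ.^ suc n) - 1ℚ) * β (suc n))
V = U ⊖ const ½

-- The identity 1/(eᵗ + 1) = 1/(eᵗ - 1) - 2/(e²ᵗ - 1), multiplied by t, says that t U = `β` -
-- `dilate β`; this is `D≈`.
U-reciprocal : (ex ⊕ const 1ℚ) ⊛ U ≈ const 1ℚ
U-reciprocal n = -≡0⇒≡ (t-cancel (W ⊖ ι) tW n)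
  where
  W = (ex ⊕ ι) ⊛ U
  D = dilate β ⊖ β
  D≈ : D ≈ t ⊛ (⊝ U)
  D≈ = t-⊛-suc-shift refl (λ n → solve 2 (λ a b → a :* b :- b := :- :- ((a :- con 1ℚ) :* b)) refl (ℕtoℚ (2 ℕ.^ suc n))
    (β (suc n)))
  tW : t ⊛ (W ⊖ ι) ≈ const 0ℚ
  tW =
    t ⊛ ((ex ⊕ ι) ⊛ U ⊖ ι)
      ≈⟨ solveₛ 3 (λ t e u → t *ₛ ((e +ₛ conₛ 1ℚ) *ₛ u -ₛ conₛ 1ℚ) =ₛ -ₛ (t +ₛ (e +ₛ conₛ 1ℚ) *ₛ (t *ₛ -ₛ u))) refl≈ t
      ex U ⟩
    ⊝ (t ⊕ (ex ⊕ ι) ⊛ (t ⊛ (⊝ U))) ≈˘⟨ ⊝-cong (⊕-cong bernoulli-egf (⊛-congˡ (ex ⊕ ι) D≈)) ⟩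
    ⊝ ((ex ⊖ ι) ⊛ β ⊕ (ex ⊕ ι) ⊛ (dilate β ⊖ β))
      ≈⟨ solveₛ 3 (λ e b s → -ₛ ((e -ₛ conₛ 1ℚ) *ₛ b +ₛ (e +ₛ conₛ 1ℚ) *ₛ (s -ₛ b)) =ₛ -ₛ
      ((e +ₛ conₛ 1ℚ) *ₛ s -ₛ (b +ₛ b))) refl≈ ex β (dilate β) ⟩
    ⊝ Y ≈⟨ ⊝-cong Y≈0 ⟩
    (λ _ → 0ℚ) ≈˘⟨ const-0 ⟩
    const 0ℚ ∎≈

V-0 : V 0 ≡ 0ℚ
V-0 = trans (cong (_- ½) U-0) refl
  where
  U-0 : U 0 ≡ ½
  U-0 = trans (solve 1 (λ u → u := con ½ :* (con (1ℚ + 1ℚ) :* u)) refl (U 0))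
    (cong (½ *_) (trans (sym (⊛-0 (ex ⊕ ι) U)) (U-reciprocal 0)))

-- Differentiating (eᵗ + 1) U = 1 and cancelling the unit eᵗ + 1 gives U′ = U² - U. Completing the
-- square yields V′ = V² - 1/4.
V-Riccati : θ V ≈ t ⊛ (V ⊛ V ⊖ const (½ * ½))
V-Riccati =
  θ V ≈⟨ (λ { zero → solve 1 (λ u → con 0ℚ :* (u :- con ½) := con 0ℚ :* u) refl (U 0) ; (suc n) →
    cong (ℕtoℚ (suc n) *_) (+-identityʳ (U (suc n))) }) ⟩
  θ U ≈⟨ (λ n → -≡0⇒≡ (Z≈0 n)) ⟩
  t ⊛ (U ⊛ U ⊖ U) ≈⟨ solveₛ 2 (λ t u → t *ₛ (u *ₛ u -ₛ u) =ₛ t *ₛ ((u -ₛ conₛ ½) *ₛ (u -ₛ conₛ ½) -ₛ conₛ (½ * ½)))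
    refl≈ t U ⟩
  t ⊛ (V ⊛ V ⊖ const (½ * ½)) ∎≈
  where
  Z = θ U ⊖ t ⊛ (U ⊛ U ⊖ U)
  E+1 = ex ⊕ ι
  θ1 : θ (E+1 ⊛ U) ≈ const 0ℚ
  θ1 zero = *-zeroˡ ((E+1 ⊛ U) 0)
  θ1 (suc n) = *-≡0 (ℕtoℚ (suc n)) (U-reciprocal (suc n))
  θex : θ E+1 ≈ t ⊛ ex
  θex zero = trans (*-zeroˡ (E+1 0)) (sym (t-⊛-0 ex))
  θex (suc n) = trans (cong (ℕtoℚ (suc n) *_) (+-identityʳ (ex (suc n)))) (ex-LogDer (suc n))
  EZ : E+1 ⊛ Z ≈ const 0ℚ
  EZ =
    E+1 ⊛ (θ U ⊖ t ⊛ (U ⊛ U ⊖ U))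
      ≈⟨ solveₛ 4 (λ e d t u → (e +ₛ conₛ 1ℚ) *ₛ (d -ₛ t *ₛ (u *ₛ u -ₛ u)) =ₛ (t *ₛ e) *ₛ u +ₛ (e +ₛ conₛ 1ℚ) *ₛ d +ₛ
        (t -ₛ t *ₛ u) *ₛ ((e +ₛ conₛ 1ℚ) *ₛ u) -ₛ t *ₛ e *ₛ u) refl≈ ex (θ U) t U ⟩
    (t ⊛ ex) ⊛ U ⊕ E+1 ⊛ θ U ⊕ (t ⊖ t ⊛ U) ⊛ (E+1 ⊛ U) ⊖ t ⊛ ex ⊛ U
      ≈⟨ ⊖-cong (⊕-cong (λ n → trans (cong (_+ (E+1 ⊛ θ U) n) (sym (⊛-congʳ U θex n))) (sym (θ-⊛ E+1 U n)))
        (⊛-congˡ (t ⊖ t ⊛ U) U-reciprocal)) refl≈ ⟩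
    θ (E+1 ⊛ U) ⊕ (t ⊖ t ⊛ U) ⊛ ι ⊖ t ⊛ ex ⊛ U ≈⟨ ⊖-cong (⊕-cong θ1 refl≈) refl≈ ⟩
    const 0ℚ ⊕ (t ⊖ t ⊛ U) ⊛ ι ⊖ t ⊛ ex ⊛ U
      ≈⟨ solveₛ 3 (λ e t u → conₛ 0ℚ +ₛ (t -ₛ t *ₛ u) *ₛ conₛ 1ℚ -ₛ t *ₛ e *ₛ u =ₛ t *ₛ
      (conₛ 1ℚ -ₛ (e +ₛ conₛ 1ℚ) *ₛ u)) refl≈ ex t U ⟩
    t ⊛ (ι ⊖ E+1 ⊛ U) ≈⟨ ⊛-congˡ t (⊖-cong (refl≈ {ι}) U-reciprocal) ⟩
    t ⊛ (ι ⊖ ι) ≈⟨ solveₛ 1 (λ t → t *ₛ (conₛ 1ℚ -ₛ conₛ 1ℚ) =ₛ conₛ 0ℚ) refl≈ t ⟩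
    const 0ℚ ∎≈
  Z≈0 : ∀ n → Z n ≡ 0ℚ
  Z≈0 = ⊛-cancel-unit E+1 Z ½ refl EZ

parity : ∀ i → ∃ λ a → i ≡ a ℕ.+ a ⊎ i ≡ suc (a ℕ.+ a)
parity zero = 0 , inj₁ refl
parity (suc i) with parity i
... | a , inj₁ refl = a , inj₂ refl
... | a , inj₂ refl = suc a , inj₁ (cong suc (sym (ℕₚ.+-suc a a)))

V-suc : ∀ m → ℕtoℚ (suc m) * V (suc m) ≡ (V ⊛ V) m - const (½ * ½) m
V-suc m = trans (V-Riccati (suc m)) (t-⊛-suc _ m)

sum-odd⇒even-summand : ∀ i j n → i ℕ.+ j ≡ suc (n ℕ.+ n) → (∃ λ a → i ≡ a ℕ.+ a) ⊎ (∃ λ b → j ≡ b ℕ.+ b)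
sum-odd⇒even-summand i j n e = by-cases (parity i) (parity j)
  where
  ℕ-lemma : ∀ a b → 2 ℕ.* suc (a ℕ.+ b) ≡ suc (a ℕ.+ a) ℕ.+ suc (b ℕ.+ b)
  ℕ-lemma = solveₙ 2 (λ a b → conₙ 2 *ₙ (conₙ 1 +ₙ (a +ₙ b)) =ₙ (conₙ 1 +ₙ (a +ₙ a)) +ₙ (conₙ 1 +ₙ (b +ₙ b))) refl
  by-cases : (∃ λ a → i ≡ a ℕ.+ a ⊎ i ≡ suc (a ℕ.+ a)) → (∃ λ b → j ≡ b ℕ.+ b ⊎ j ≡ suc (b ℕ.+ b)) →
    (∃ λ a → i ≡ a ℕ.+ a) ⊎ (∃ λ b → j ≡ b ℕ.+ b)
  by-cases (a , inj₁ f) _ = inj₁ (a , f)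
  by-cases _ (b , inj₁ g) = inj₂ (b , g)
  by-cases (a , inj₂ f) (b , inj₂ g) = ⊥-elim (ℕₚ.even≢odd (suc (a ℕ.+ b)) n (begin
    2 ℕ.* suc (a ℕ.+ b) ≡⟨ ℕ-lemma a b ⟩
    suc (a ℕ.+ a) ℕ.+ suc (b ℕ.+ b) ≡⟨ trans (sym (cong₂ ℕ._+_ f g)) e ⟩
    suc (n ℕ.+ n) ≡⟨ cong (λ z → suc (n ℕ.+ z)) (sym (ℕₚ.+-identityʳ n)) ⟩
    suc (2 ℕ.* n) ∎))

-- That tanh is odd is read off from the Riccati equation: for odd m every product `V i * V j` with
-- `i + j = m` contains a factor of smaller even index, and the constant 1/4 contributes only in
-- degree 0.
V-even : ∀ n → V (n ℕ.+ n) ≡ 0ℚ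
V-even n = <-rec (λ m → ∀ n → m ≡ n ℕ.+ n → V m ≡ 0ℚ) step (n ℕ.+ n) n refl
  where
  const-odd : ∀ {m} n → m ≡ suc (n ℕ.+ n) → const (½ * ½) m ≡ 0ℚ
  const-odd n refl = refl
  step : ∀ m → (∀ {j} → j ℕ.< m → ∀ n → j ≡ n ℕ.+ n → V j ≡ 0ℚ) → ∀ n → m ≡ n ℕ.+ n → V m ≡ 0ℚ
  step zero ih n e = V-0
  step (suc m) ih (suc n) e =
    *-cancel-ℕ m (trans (V-suc m)
    (trans (cong₂ _-_ (anti-zero m vanish) (const-odd n odd)) (sym (*-zeroʳ (ℕtoℚ (suc m))))))
    where
    odd : m ≡ suc (n ℕ.+ n)
    odd = trans (ℕₚ.suc-injective e) (ℕₚ.+-suc n n)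
    vanish : ∀ i j → i ℕ.+ j ≡ m → V i * V j ≡ 0ℚ
    vanish i j f = by-cases (sum-odd⇒even-summand i j n (trans f odd))
      where
      by-cases : (∃ λ a → i ≡ a ℕ.+ a) ⊎ (∃ λ b → j ≡ b ℕ.+ b) → V i * V j ≡ 0ℚ
      by-cases (inj₁ (a , g)) = ≡0-* (V j) (ih (s≤s (≤-fst i j f)) a g)
      by-cases (inj₂ (b , g)) = *-≡0 (V i) (ih (s≤s (≤-snd i j f)) b g)

anti-even : ∀ n F → (∀ i j → F (suc (i ℕ.+ i)) j ≡ 0ℚ) → anti (n ℕ.+ n) F ≡ anti n (λ i j → F (i ℕ.+ i) (j ℕ.+ j))
anti-even zero F h = trans (anti-0 F) (sym (anti-0 _))
anti-even (suc n) F h = begin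
  anti (suc n ℕ.+ suc n) F ≡⟨ cong (λ z → anti (suc z) F) (ℕₚ.+-suc n n) ⟩
  anti (suc (suc (n ℕ.+ n))) F ≡⟨ anti-suc (suc (n ℕ.+ n)) F ⟩
  F 0 (suc (suc (n ℕ.+ n))) + anti (suc (n ℕ.+ n)) (λ i j → F (suc i) j)
    ≡⟨ cong₂ _+_ (cong (F 0) (cong suc (sym (ℕₚ.+-suc n n)))) (anti-suc (n ℕ.+ n) _) ⟩
  F 0 (suc n ℕ.+ suc n) + (F 1 (suc (n ℕ.+ n)) + anti (n ℕ.+ n) F₂)
    ≡⟨ cong (F 0 (suc n ℕ.+ suc n) +_) (≡0-+ (anti (n ℕ.+ n) F₂) (h 0 _)) ⟩
  F 0 (suc n ℕ.+ suc n) + anti (n ℕ.+ n) F₂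
    ≡⟨ cong (F 0 (suc n ℕ.+ suc n) +_)
    (anti-even n F₂ (λ i j → trans (cong (λ z → F (suc z) j) (cong suc (sym (ℕₚ.+-suc i i)))) (h (suc i) j))) ⟩
  F 0 (suc n ℕ.+ suc n) + anti n (λ i j → F₂ (i ℕ.+ i) (j ℕ.+ j))
    ≡⟨ cong (F 0 (suc n ℕ.+ suc n) +_) (anti-cong n (λ i j → cong (λ z → F (suc z) (j ℕ.+ j)) (sym (ℕₚ.+-suc i i)))) ⟩
  F 0 (suc n ℕ.+ suc n) + anti n (λ i j → F (suc i ℕ.+ suc i) (j ℕ.+ j))
    ≡⟨ sym (anti-suc n (λ i j → F (i ℕ.+ i) (j ℕ.+ j))) ⟩
  anti (suc n) (λ i j → F (i ℕ.+ i) (j ℕ.+ j)) ∎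
  where
  F₂ : ℕ → ℕ → ℚ
  F₂ i j = F (suc (suc i)) j

2*suc : ∀ k → 2 ℕ.* suc k ≡ suc (suc (k ℕ.+ k))
2*suc k = cong suc (trans (cong (k ℕ.+_) (cong suc (ℕₚ.+-identityʳ k))) (ℕₚ.+-suc k k))

4^ : ℕ → ℚ
4^ k = ℕtoℚ (4 ℕ.^ k)

4^≡2^ : ∀ k → 4^ (suc k) ≡ ℕtoℚ (2 ℕ.^ (suc (suc (k ℕ.+ k))))
4^≡2^ k = cong ℕtoℚ (trans (ℕₚ.^-*-assoc 2 2 (suc k)) (cong (2 ℕ.^_) (2*suc k)))

-- Q is the expansion of (x/2) tanh x in t = x².
Q : Series
Q k = ℕtoℚ k * coeffA k

q : Series
q = Q ∘ suc

-- Coefficientwise this is (x/2) tanh x = -x V(2x); the argument 2x accounts for the factor 2²ᵏ⁺¹ =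
-- ½ · 4ᵏ⁺¹.
q≡V : ∀ k → q k ≡ - (½ * 4^ (suc k) * V (suc (k ℕ.+ k)))
q≡V k = begin
  ℕtoℚ K * (ℕtoℚ (4 ℕ.^ K ℕ.* (4 ℕ.^ K ∸ 1)) * bernoulli m * recipℕ (m ℕ.* m !))
    ≡⟨ cong₂ (λ u v → ℕtoℚ K * (u * bernoulli m * v)) (trans (ℕtoℚ-* (4 ℕ.^ K) (4 ℕ.^ K ∸ 1)) (cong (4^ K *_) pred4))
      (trans (recip-* m (m !)) (cong (_* invfac m) (recip-* 2 K))) ⟩
  ℕtoℚ K * (4^ K * (4^ K - 1ℚ) * bernoulli m * (½ * recipℕ K * invfac m))
    ≡⟨ solve 5 (λ k f b q⁺ i → k :* (f :* (f :- con 1ℚ) :* b :* (con ½ :* q⁺ :* i)) :=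
      (q⁺ :* k) :* (con ½ :* f :* ((f :- con 1ℚ) :* (b :* i)))) refl (ℕtoℚ K) (4^ K) (bernoulli m) (recipℕ K)
      (invfac m) ⟩
  recipℕ K * ℕtoℚ K * (½ * 4^ K * ((4^ K - 1ℚ) * β m))
    ≡⟨ cong₂ (λ u v → u * (½ * 4^ K * v)) (recip*ℕ k) (cong₂ (λ u v → (u - 1ℚ) * β v) (4^≡2^ k) (2*suc k)) ⟩
  1ℚ * (½ * 4^ K * w) ≡⟨ solve 2 (λ f w → con 1ℚ :* (con ½ :* f :* w) := :- (con ½ :* f :* (:- w :+ con 0ℚ))) refl
    (4^ K) w ⟩
  - (½ * 4^ K * V (suc (k ℕ.+ k))) ∎
  where
  K = suc k
  m = 2 ℕ.* K
  w = (ℕtoℚ (2 ℕ.^ suc (suc (k ℕ.+ k))) - 1ℚ) * β (suc (suc (k ℕ.+ k)))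
  pred4 : ℕtoℚ (4 ℕ.^ K ∸ 1) ≡ 4^ K - 1ℚ
  pred4 = begin
    ℕtoℚ (4 ℕ.^ K ∸ 1) ≡⟨ solve 1 (λ x → x := con 1ℚ :+ x :- con 1ℚ) refl (ℕtoℚ (4 ℕ.^ K ∸ 1)) ⟩
    1ℚ + ℕtoℚ (4 ℕ.^ K ∸ 1) - 1ℚ ≡⟨ cong (_- 1ℚ) (sym (ℕtoℚ-+ 1 (4 ℕ.^ K ∸ 1))) ⟩
    ℕtoℚ (1 ℕ.+ (4 ℕ.^ K ∸ 1)) - 1ℚ ≡⟨ cong (λ z → ℕtoℚ z - 1ℚ) (ℕₚ.m+[n∸m]≡n (ℕₚ.m^n>0 4 K)) ⟩
    4^ K - 1ℚ ∎

3/2 : ℚ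
3/2 = 1ℚ + ½

-- The Riccati equation of `V` in degree 2n + 2. Only products of two odd-indexed coefficients
-- survive, and the derivative contributes 2n + 3, which becomes n + 3/2 after scaling.
q-Riccati : ∀ n → anti n (λ i j → q i * q j) ≡ - ((ℕtoℚ n + 3/2) * q (suc n))
q-Riccati n = begin
  anti n (λ i j → q i * q j) ≡⟨ anti-cong≡ n term ⟩
  anti n (λ i j → c * (V (suc (i ℕ.+ i)) * V (suc (j ℕ.+ j)))) ≡⟨ anti-*ˡ n c _ ⟩
  c * anti n (λ i j → V (suc (i ℕ.+ i)) * V (suc (j ℕ.+ j)))
    ≡⟨ cong (c *_) (sym (anti-even n (λ i j → V (suc i) * V (suc j)) odd)) ⟩
  c * anti (n ℕ.+ n) (λ i j → V (suc i) * V (suc j)) ≡⟨ cong (c *_) (sym ends) ⟩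
  c * (V ⊛ V) (suc (suc (n ℕ.+ n))) ≡⟨ cong (c *_) (sym (trans (V-suc (suc (suc (n ℕ.+ n)))) (+-identityʳ _))) ⟩
  c * (ℕtoℚ (3 ℕ.+ (n ℕ.+ n)) * V′)
    ≡⟨ cong (λ z → c * (z * V′)) (trans (ℕtoℚ-+ 3 (n ℕ.+ n)) (cong (ℕtoℚ 3 +_) (ℕtoℚ-+ n n))) ⟩
  c * ((ℕtoℚ 3 + (ℕtoℚ n + ℕtoℚ n)) * V′)
    ≡⟨ solve 3 (λ f n v → con (½ * ½) :* f :* ((con (ℕtoℚ 3) :+ (n :+ n)) :* v) :=
    :- ((n :+ con 3/2) :* :- (con ½ :* f :* v))) refl (4^ (suc (suc n))) (ℕtoℚ n) V′ ⟩
  - ((ℕtoℚ n + 3/2) * - (½ * 4^ (suc (suc n)) * V′))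
    ≡⟨ cong (λ z → - ((ℕtoℚ n + 3/2) * z))
    (trans (cong (λ z → - (½ * 4^ (suc (suc n)) * V (suc (suc z)))) (sym (ℕₚ.+-suc n n))) (sym (q≡V (suc n)))) ⟩
  - ((ℕtoℚ n + 3/2) * q (suc n)) ∎
  where
  c = ½ * ½ * 4^ (suc (suc n))
  V′ = V (3 ℕ.+ (n ℕ.+ n))
  4^-+ : ∀ i j → i ℕ.+ j ≡ n → 4^ (suc i) * 4^ (suc j) ≡ 4^ (suc (suc n))
  4^-+ i j e = trans (sym (ℕtoℚ-* (4 ℕ.^ suc i) (4 ℕ.^ suc j)))
    (cong ℕtoℚ (trans (sym (ℕₚ.^-distribˡ-+-* 4 (suc i) (suc j)))
    (cong (4 ℕ.^_) (cong suc (trans (ℕₚ.+-suc i j) (cong suc e))))))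
  term : ∀ i j → i ℕ.+ j ≡ n → q i * q j ≡ c * (V (suc (i ℕ.+ i)) * V (suc (j ℕ.+ j)))
  term i j e = begin
    q i * q j ≡⟨ cong₂ _*_ (q≡V i) (q≡V j) ⟩
    - (½ * 4^ (suc i) * v) * - (½ * 4^ (suc j) * w)
      ≡⟨ solve 4 (λ a v b w → :- (con ½ :* a :* v) :* :- (con ½ :* b :* w) := con (½ * ½) :* (a :* b) :* (v :* w))
      refl (4^ (suc i)) v (4^ (suc j)) w ⟩
    ½ * ½ * (4^ (suc i) * 4^ (suc j)) * (v * w) ≡⟨ cong (λ z → ½ * ½ * z * (v * w)) (4^-+ i j e) ⟩
    c * (v * w) ∎
    where
    v = V (suc (i ℕ.+ i))
    w = V (suc (j ℕ.+ j))
  odd : ∀ i j → V (suc (suc (i ℕ.+ i))) * V (suc j) ≡ 0ℚ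
  odd i j = ≡0-* (V (suc j)) (trans (cong (V ∘ suc) (sym (ℕₚ.+-suc i i))) (V-even (suc i)))
  ends : (V ⊛ V) (suc (suc (n ℕ.+ n))) ≡ anti (n ℕ.+ n) (λ i j → V (suc i) * V (suc j))
  ends = begin
    (V ⊛ V) (suc (suc (n ℕ.+ n))) ≡⟨ anti-suc (suc (n ℕ.+ n)) _ ⟩
    V 0 * V (suc (suc (n ℕ.+ n))) + anti (suc (n ℕ.+ n)) (λ i j → V (suc i) * V j)
      ≡⟨ cong₂ _+_ (≡0-* (V (suc (suc (n ℕ.+ n)))) V-0) (anti-sucʳ (n ℕ.+ n) _) ⟩
    0ℚ + (A + V (suc (suc (n ℕ.+ n))) * V 0) ≡⟨ cong (λ z → 0ℚ + (A + z)) (*-≡0 (V (suc (suc (n ℕ.+ n)))) V-0) ⟩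
    0ℚ + (A + 0ℚ) ≡⟨ trans (+-identityˡ (A + 0ℚ)) (+-identityʳ A) ⟩
    A ∎
    where A = anti (n ℕ.+ n) (λ i j → V (suc i) * V (suc j))

q-0 : q 0 ≡ ½
q-0 = trans (q≡V 0) (trans (cong (λ z → - (½ * 4^ 1 * z)) V-1) refl)
  where
  V-1 : V 1 ≡ - (½ * ½)
  V-1 = trans (sym (*-identityˡ (V 1))) (trans (V-suc 0) (cong (_- ½ * ½) (trans (⊛-0 V V) (cong₂ _*_ V-0 V-0))))

-- Signs of the coefficients.

-1ℚ : ℚ
-1ℚ = - 1ℚ

pow-+ : ∀ x i j → powℚ x (i ℕ.+ j) ≡ powℚ x i * powℚ x j
pow-+ x zero j = sym (*-identityˡ (powℚ x j))
pow-+ x (suc i) j = trans (cong (x *_) (pow-+ x i j)) (sym (*-assoc x (powℚ x i) (powℚ x j)))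

-- The coefficient of tᵏ⁺¹ in (x/2) tan x, where t = x².
q⁺ : Series
q⁺ k = powℚ -1ℚ k * q k

q⁺-Riccati : ∀ n → anti n (λ i j → q⁺ i * q⁺ j) ≡ (ℕtoℚ n + 3/2) * q⁺ (suc n)
q⁺-Riccati n = begin
  anti n (λ i j → q⁺ i * q⁺ j)
    ≡⟨ anti-cong≡ n (λ i j e →
    trans (solve 4 (λ a b c d → a :* b :* (c :* d) := a :* c :* (b :* d)) refl (powℚ -1ℚ i) (q i) (powℚ -1ℚ j) (q j))
    (cong (_* (q i * q j)) (trans (sym (pow-+ -1ℚ i j)) (cong (powℚ -1ℚ) e)))) ⟩
  anti n (λ i j → powℚ -1ℚ n * (q i * q j)) ≡⟨ anti-*ˡ n (powℚ -1ℚ n) _ ⟩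
  powℚ -1ℚ n * anti n (λ i j → q i * q j) ≡⟨ cong (powℚ -1ℚ n *_) (q-Riccati n) ⟩
  powℚ -1ℚ n * - ((ℕtoℚ n + 3/2) * q (suc n))
    ≡⟨ solve 3 (λ p n q → p :* :- (n :* q) := n :* (con -1ℚ :* p :* q)) refl (powℚ -1ℚ n) (ℕtoℚ n + 3/2) (q (suc n)) ⟩
  (ℕtoℚ n + 3/2) * q⁺ (suc n) ∎

n+3/2>0 : ∀ n → 0ℚ < ℕtoℚ n + 3/2
n+3/2>0 n = +-mono-≤-< (0≤ℕtoℚ n) (positive⁻¹ 3/2)

-- `q⁺-Riccati` writes each coefficient as a positive multiple of a sum of products of earlier ones,
-- starting from ½. In effect this is the alternation of the signs of B₂ₖ.
q⁺-nonNeg : ∀ k → 0ℚ ≤ q⁺ k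
q⁺-nonNeg = <-rec _ step
  where
  step : ∀ n → (∀ {j} → j ℕ.< n → 0ℚ ≤ q⁺ j) → 0ℚ ≤ q⁺ n
  step zero ih = subst (0ℚ ≤_) (sym (trans (*-identityˡ (q 0)) q-0)) (nonNegative⁻¹ ½)
  step (suc n) ih = *-cancelˡ-≤-pos (ℕtoℚ n + 3/2) {{positive (n+3/2>0 n)}}
    (subst₂ _≤_ (sym (*-zeroʳ (ℕtoℚ n + 3/2))) (q⁺-Riccati n)
    (anti-nonNeg≡ n (λ i j → q⁺ i * q⁺ j) (λ i j e → *-nonNeg (ih (s≤s (≤-fst i j e))) (ih (s≤s (≤-snd i j e))))))

∣pow-1∣ : ∀ k → ∣ powℚ -1ℚ k ∣ ≡ 1ℚ
∣pow-1∣ zero = refl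
∣pow-1∣ (suc k) = trans (∣p*q∣≡∣p∣*∣q∣ -1ℚ (powℚ -1ℚ k)) (cong (1ℚ *_) (∣pow-1∣ k))

-- The logarithmic derivative of sec √t, since `∣ coeffA k ∣` is the coefficient of tᵏ in log sec
-- √t. It is the target of the power sums of the nodes.
pstar : Series
pstar k = ℕtoℚ k * ∣ coeffA k ∣

pstar-suc : ∀ k → pstar (suc k) ≡ q⁺ k
pstar-suc k = begin
  ℕtoℚ (suc k) * ∣ coeffA (suc k) ∣ ≡⟨ cong (_* ∣ coeffA (suc k) ∣) (sym (0≤p⇒∣p∣≡p (0≤ℕtoℚ (suc k)))) ⟩
  ∣ ℕtoℚ (suc k) ∣ * ∣ coeffA (suc k) ∣ ≡⟨ sym (∣p*q∣≡∣p∣*∣q∣ (ℕtoℚ (suc k)) (coeffA (suc k))) ⟩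
  ∣ q k ∣ ≡⟨ sym (*-identityˡ ∣ q k ∣) ⟩
  1ℚ * ∣ q k ∣ ≡⟨ cong (_* ∣ q k ∣) (sym (∣pow-1∣ k)) ⟩
  ∣ powℚ -1ℚ k ∣ * ∣ q k ∣ ≡⟨ sym (∣p*q∣≡∣p∣*∣q∣ (powℚ -1ℚ k) (q k)) ⟩
  ∣ q⁺ k ∣ ≡⟨ 0≤p⇒∣p∣≡p (q⁺-nonNeg k) ⟩
  q⁺ k ∎

-- Brings the logarithmic derivative of cosh √t into the form that ∏ⱼ (1 + yⱼ t) has at every finite
-- stage, so that the two can be compared termwise.
Q≡signed-pstar : ∀ k → Q k ≡ - (powℚ -1ℚ k * pstar k)
Q≡signed-pstar zero = trans (*-zeroˡ (coeffA 0)) (cong (λ z → - (1ℚ * z)) (sym (*-zeroˡ ∣ coeffA 0 ∣)))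
Q≡signed-pstar (suc k) = begin
  q k ≡⟨ sym (*-identityˡ (q k)) ⟩
  1ℚ * q k ≡⟨ cong (_* q k) (sym (sq k)) ⟩
  s * s * q k ≡⟨ solve 2 (λ s q → s :* s :* q := :- (con -1ℚ :* s :* (s :* q))) refl s (q k) ⟩
  - (powℚ -1ℚ (suc k) * q⁺ k) ≡⟨ cong (λ z → - (powℚ -1ℚ (suc k) * z)) (sym (pstar-suc k)) ⟩
  - (powℚ -1ℚ (suc k) * pstar (suc k)) ∎
  where
  s = powℚ -1ℚ k
  sq : ∀ k → powℚ -1ℚ k * powℚ -1ℚ k ≡ 1ℚ
  sq zero = refl
  sq (suc k) = trans (solve 1 (λ x → con -1ℚ :* x :* (con -1ℚ :* x) := x :* x) refl (powℚ -1ℚ k)) (sq k)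

-- The series cosh √t and its logarithmic derivative.

Q-0 : Q 0 ≡ 0ℚ
Q-0 = *-zeroˡ (coeffA 0)

-- With θ = (x/2) d/dx and Q = (x/2) tanh x, the derivative of tanh gives θQ = Q/2 + x²/4 - Q².
-- Degrees 0 and 1 lie outside `q-Riccati` and are computed directly.
Q-Riccati : Q ⊛ Q ≈ const ½ ⊛ Q ⊕ const (½ * ½) ⊛ t ⊖ θ Q
Q-Riccati n = trans (h n) (sym (cong₂ (λ u v → u + v - θ Q n) (const-⊛ ½ Q n) (const-⊛ (½ * ½) t n)))
  where
  h : ∀ n → (Q ⊛ Q) n ≡ ½ * Q n + ½ * ½ * t n - θ Q n
  h zero = trans (⊛-0 Q Q) (trans (cong (λ z → z * z) Q-0) (sym (cong (λ z → ½ * z + ½ * ½ * 0ℚ - 0ℚ * z) Q-0)))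
  h (suc zero) = trans (⊛-suc Q Q 0)
    (trans (cong₂ _+_ (cong (_* Q 1) Q-0) (trans (⊛-0 (Q ∘ suc) Q) (cong (Q 1 *_) Q-0)))
    (trans (cong₂ (λ u v → 0ℚ * u + v * 0ℚ) q-0 q-0) (sym (cong (λ z → ½ * z + ½ * ½ * 1ℚ - 1ℚ * z) q-0))))
  h (suc (suc n)) = begin
    (Q ⊛ Q) (suc (suc n)) ≡⟨ anti-suc (suc n) _ ⟩
    Q 0 * Q (suc (suc n)) + anti (suc n) (λ i j → q i * Q j)
      ≡⟨ cong₂ _+_ (≡0-* (Q (suc (suc n))) Q-0) (anti-sucʳ n _) ⟩
    0ℚ + (anti n (λ i j → q i * q j) + q (suc n) * Q 0)
      ≡⟨ cong₂ (λ u v → 0ℚ + (u + q (suc n) * v)) (q-Riccati n) Q-0 ⟩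
    0ℚ + (- ((ℕtoℚ n + 3/2) * q (suc n)) + q (suc n) * 0ℚ)
      ≡⟨ solve 2 (λ n q → con 0ℚ :+ (:- ((n :+ con 3/2) :* q) :+ q :* con 0ℚ) :=
        con ½ :* q :+ con (½ * ½) :* con 0ℚ :- (con (ℕtoℚ 2) :+ n) :* q) refl (ℕtoℚ n) (q (suc n)) ⟩
    ½ * q (suc n) + ½ * ½ * 0ℚ - (ℕtoℚ 2 + ℕtoℚ n) * q (suc n)
      ≡⟨ cong (λ z → ½ * q (suc n) + ½ * ½ * 0ℚ - z * q (suc n)) (sym (ℕtoℚ-+ 2 n)) ⟩
    ½ * q (suc n) + ½ * ½ * 0ℚ - ℕtoℚ (suc (suc n)) * q (suc n) ∎

cosh : Series
cosh k = invfac (2 ℕ.* k)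

-- The second-order equation of cosh √t and `Q-Riccati` together give the defect `X` a first-order
-- linear equation θX = (½ - Q) X. Its leading exponent would have to be ½, so it has no nonzero
-- power series solution.
cosh-LogDer : LogDer cosh Q
cosh-LogDer n = -≡0⇒≡ (X≈0 n)
  where
  X = θ cosh ⊖ Q ⊛ cosh
  cosh-ODE : θ (θ cosh) ≈ const ½ ⊛ θ cosh ⊕ const (½ * ½) ⊛ (t ⊛ cosh)
  cosh-ODE n = trans (h n) (sym (cong₂ _+_ (const-⊛ ½ (θ cosh) n) (const-⊛ (½ * ½) (t ⊛ cosh) n)))
    where
    h : ∀ n → θ (θ cosh) n ≡ ½ * θ cosh n + ½ * ½ * (t ⊛ cosh) n
    h zero = sym (cong (λ z → ½ * (0ℚ * 1ℚ) + ½ * ½ * z) (t-⊛-0 cosh))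
    h (suc n) = begin
      N * (N * c) ≡⟨ solve 2
        (λ n c → n :* (n :* c) := con ½ :* (n :* c) :+ con (½ * ½) :*
        ((con (ℕtoℚ 2) :* n :- con 1ℚ) :* (con (ℕtoℚ 2) :* n :* c))) refl N c ⟩
      ½ * (N * c) + ½ * ½ * ((ℕtoℚ 2 * N - 1ℚ) * (ℕtoℚ 2 * N * c)) ≡⟨ cong (λ z → ½ * (N * c) + ½ * ½ * z) (begin
        (ℕtoℚ 2 * N - 1ℚ) * (ℕtoℚ 2 * N * c) ≡⟨ cong₂ (λ u v → (u - 1ℚ) * (u * v)) 2N (cong invfac (2*suc n)) ⟩
        (ℕtoℚ (suc (suc (n ℕ.+ n))) - 1ℚ) * (ℕtoℚ (suc (suc (n ℕ.+ n))) * invfac (suc (suc (n ℕ.+ n))))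
          ≡⟨ cong₂ _*_ -1N (invfac-suc (suc (n ℕ.+ n))) ⟩
        ℕtoℚ (suc (n ℕ.+ n)) * invfac (suc (n ℕ.+ n)) ≡⟨ invfac-suc (n ℕ.+ n) ⟩
        invfac (n ℕ.+ n) ≡⟨ cong (λ z → invfac (n ℕ.+ z)) (sym (ℕₚ.+-identityʳ n)) ⟩
        cosh n ≡⟨ sym (t-⊛-suc cosh n) ⟩
        (t ⊛ cosh) (suc n) ∎) ⟩
      ½ * (N * c) + ½ * ½ * (t ⊛ cosh) (suc n) ∎
      where
      N = ℕtoℚ (suc n)
      c = cosh (suc n)
      2N : ℕtoℚ 2 * N ≡ ℕtoℚ (suc (suc (n ℕ.+ n)))
      2N = trans (sym (ℕtoℚ-* 2 (suc n))) (cong ℕtoℚ (2*suc n))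
      -1N : ℕtoℚ (suc (suc (n ℕ.+ n))) - 1ℚ ≡ ℕtoℚ (suc (n ℕ.+ n))
      -1N = trans (cong (_- 1ℚ) (ℕtoℚ-suc (suc (n ℕ.+ n))))
        (solve 1 (λ x → con 1ℚ :+ x :- con 1ℚ := x) refl (ℕtoℚ (suc (n ℕ.+ n))))
  θ-⊖ : ∀ A B → θ (A ⊖ B) ≈ θ A ⊖ θ B
  θ-⊖ A B n = solve 3 (λ n a b → n :* (a :- b) := n :* a :- n :* b) refl (ℕtoℚ n) (A n) (B n)
  θX : θ X ≈ (const ½ ⊖ Q) ⊛ X
  θX =
    θ (θ cosh ⊖ Q ⊛ cosh) ≈⟨ θ-⊖ (θ cosh) (Q ⊛ cosh) ⟩
    θ (θ cosh) ⊖ θ (Q ⊛ cosh) ≈⟨ ⊖-cong cosh-ODE (θ-⊛ Q cosh) ⟩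
    (const ½ ⊛ θ cosh ⊕ const (½ * ½) ⊛ (t ⊛ cosh)) ⊖ (θ Q ⊛ cosh ⊕ Q ⊛ θ cosh)
      ≈⟨ solveₛ 5 (λ dc t c dq q → (conₛ ½ *ₛ dc +ₛ conₛ (½ * ½) *ₛ (t *ₛ c)) -ₛ (dq *ₛ c +ₛ q *ₛ dc)
           =ₛ (conₛ ½ -ₛ q) *ₛ dc +ₛ (conₛ ½ *ₛ q +ₛ conₛ (½ * ½) *ₛ t -ₛ dq) *ₛ c -ₛ conₛ ½ *ₛ q *ₛ c) refl≈
             (θ cosh) t cosh (θ Q) Q ⟩
    (const ½ ⊖ Q) ⊛ θ cosh ⊕ (const ½ ⊛ Q ⊕ const (½ * ½) ⊛ t ⊖ θ Q) ⊛ cosh ⊖ const ½ ⊛ Q ⊛ cosh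
      ≈˘⟨ ⊖-cong {C = const ½ ⊛ Q ⊛ cosh} (⊕-cong {(const ½ ⊖ Q) ⊛ θ cosh} refl≈ (⊛-congʳ cosh Q-Riccati)) refl≈ ⟩
    (const ½ ⊖ Q) ⊛ θ cosh ⊕ Q ⊛ Q ⊛ cosh ⊖ const ½ ⊛ Q ⊛ cosh
      ≈⟨ solveₛ 3 (λ dc c q → (conₛ ½ -ₛ q) *ₛ dc +ₛ q *ₛ q *ₛ c -ₛ conₛ ½ *ₛ q *ₛ c =ₛ (conₛ ½ -ₛ q) *ₛ
        (dc -ₛ q *ₛ c)) refl≈ (θ cosh) cosh Q ⟩
    (const ½ ⊖ Q) ⊛ X ∎≈
  X≈0 : ∀ n → X n ≡ 0ℚ
  X≈0 = <-rec _ step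
    where
    step : ∀ n → (∀ {j} → j ℕ.< n → X j ≡ 0ℚ) → X n ≡ 0ℚ
    step zero ih = cong (0ℚ * 1ℚ +_) (cong -_ (trans (⊛-0 Q cosh) (trans (cong (_* cosh 0) Q-0) refl)))
    -- With lower coefficients zero, the equation reads (n + 1) x = ½ x; doubling it leaves (2n + 1)
    -- x = 0.
    step (suc n) ih = *-cancel-ℕ (n ℕ.+ n) (begin
      ℕtoℚ (suc (n ℕ.+ n)) * x ≡⟨ cong (_* x) (trans (ℕtoℚ-suc (n ℕ.+ n)) (cong (1ℚ +_) (ℕtoℚ-+ n n))) ⟩
      (1ℚ + (N + N)) * x ≡⟨ solve 2
        (λ n x → (con 1ℚ :+ (n :+ n)) :* x := con (ℕtoℚ 2) :* ((con 1ℚ :+ n) :* x :- con ½ :* x)) refl N x ⟩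
      ℕtoℚ 2 * ((1ℚ + N) * x - ½ * x)
        ≡⟨ cong (λ z → ℕtoℚ 2 * (z - ½ * x)) (trans (cong (_* x) (sym (ℕtoℚ-suc n))) (θX (suc n))) ⟩
      ℕtoℚ 2 * (((const ½ ⊖ Q) ⊛ X) (suc n) - ½ * x) ≡⟨ cong (λ z → ℕtoℚ 2 * (z - ½ * x)) (⊛-suc (const ½ ⊖ Q) X n) ⟩
      ℕtoℚ 2 * ((½ - Q 0) * x + anti n (λ i j → (0ℚ - q i) * X j) - ½ * x)
        ≡⟨ cong₂ (λ u v → ℕtoℚ 2 * ((½ - u) * x + v - ½ * x)) Q-0
        (anti-zero n (λ i j e → *-≡0 (0ℚ - q i) (ih (s≤s (≤-snd i j e))))) ⟩
      ℕtoℚ 2 * ((½ - 0ℚ) * x + 0ℚ - ½ * x)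
        ≡⟨ solve 2 (λ x k → con (ℕtoℚ 2) :* ((con ½ :- con 0ℚ) :* x :+ con 0ℚ :- con ½ :* x) := k :* con 0ℚ) refl x
        (ℕtoℚ (suc (n ℕ.+ n))) ⟩
      ℕtoℚ (suc (n ℕ.+ n)) * 0ℚ ∎)
      where
      N = ℕtoℚ n
      x = X (suc n)

-- Sums over partitions

∑ₗ-cong-All : ∀ {A : Set} {P : A → Set} {f g : A → ℚ} {xs} → All P xs → (∀ x → P x → f x ≡ g x) → ∑ₗ xs f ≡ ∑ₗ xs g
∑ₗ-cong-All [] h = refl
∑ₗ-cong-All (p ∷ ps) h = cong₂ _+_ (h _ p) (∑ₗ-cong-All ps h)

∑ₗ-zero-All : ∀ {A : Set} {P : A → Set} {f : A → ℚ} {xs} → All P xs → (∀ x → P x → f x ≡ 0ℚ) → ∑ₗ xs f ≡ 0ℚ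
∑ₗ-zero-All {xs = xs} ps h = trans (∑ₗ-cong-All ps h) (∑ₗ-zero xs (λ _ → refl))

shift : ℕ → Series → Series
shift zero A n = A n
shift (suc k) A zero = 0ℚ
shift (suc k) A (suc n) = shift k A n

shift-cong : ∀ k {A B} → A ≈ B → shift k A ≈ shift k B
shift-cong zero h n = h n
shift-cong (suc k) h zero = refl
shift-cong (suc k) h (suc n) = shift-cong k h n

shift-cong-≤ : ∀ k {A B} n → (∀ m → m ℕ.≤ n → A m ≡ B m) → shift k A n ≡ shift k B n
shift-cong-≤ zero n h = h n ℕₚ.≤-refl
shift-cong-≤ (suc k) zero h = refl
shift-cong-≤ (suc k) (suc n) h = shift-cong-≤ k n (λ m l → h m (ℕₚ.m≤n⇒m≤1+n l))

shift-cong-< : ∀ k {A B} n → (∀ m → m ℕ.< n → A m ≡ B m) → shift (suc k) A n ≡ shift (suc k) B n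
shift-cong-< k zero h = refl
shift-cong-< k (suc n) h = shift-cong-≤ k n (λ m l → h m (s≤s l))

shift-⊕ : ∀ k A B → shift k (A ⊕ B) ≈ shift k A ⊕ shift k B
shift-⊕ zero A B n = refl
shift-⊕ (suc k) A B zero = refl
shift-⊕ (suc k) A B (suc n) = shift-⊕ k A B n

shift-shift : ∀ j k A → shift j (shift k A) ≈ shift (j ℕ.+ k) A
shift-shift zero k A n = refl
shift-shift (suc j) k A zero = refl
shift-shift (suc j) k A (suc n) = shift-shift j k A n

shift-comm : ∀ j k A → shift j (shift k A) ≈ shift k (shift j A)
shift-comm j k A n = trans (shift-shift j k A n)
  (trans (cong (λ z → shift z A n) (ℕₚ.+-comm j k)) (sym (shift-shift k j A n)))

shift-null : ∀ k {A} → (∀ n → A n ≡ 0ℚ) → ∀ n → shift k A n ≡ 0ℚ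
shift-null zero h n = h n
shift-null (suc k) h zero = refl
shift-null (suc k) h (suc n) = shift-null k h n

δ : ℕ → ℕ → ℚ
δ zero zero = 1ℚ
δ zero (suc j) = 0ℚ
δ (suc i) zero = 0ℚ
δ (suc i) (suc j) = δ i j

lt : ℕ → ℕ → ℚ
lt i zero = 0ℚ
lt zero (suc b) = 1ℚ
lt (suc i) (suc b) = lt i b

lt-suc : ∀ i b → lt i (suc b) ≡ lt i b + δ i b
lt-suc zero zero = refl
lt-suc zero (suc b) = refl
lt-suc (suc i) zero = refl
lt-suc (suc i) (suc b) = lt-suc i b

lt-< : ∀ {i b} → i ℕ.< b → lt i b ≡ 1ℚ
lt-< {zero} (s≤s z≤n) = refl
lt-< {suc i} (s≤s l) = lt-< l

lt-≥ : ∀ {i b} → ¬ (i ℕ.< b) → lt i b ≡ 0ℚ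
lt-≥ {i} {zero} h = refl
lt-≥ {zero} {suc b} h = ⊥-elim (h (s≤s z≤n))
lt-≥ {suc i} {suc b} h = lt-≥ (h ∘ s≤s)

anti-δ : ∀ n k (A : ℕ → Series) → anti n (λ i j → δ i k * A i j) ≡ shift k (A k) n
anti-δ zero zero A = trans (anti-0 _) (*-identityˡ (A 0 0))
anti-δ zero (suc k) A = trans (anti-0 _) (*-zeroˡ (A 0 0))
anti-δ (suc n) zero A =
  trans (anti-suc n _) (trans (cong₂ _+_ (*-identityˡ (A 0 (suc n))) (anti-zero n (λ i j _ → *-zeroˡ (A (suc i) j))))
  (+-identityʳ (A 0 (suc n))))
anti-δ (suc n) (suc k) A =
  trans (anti-suc n _) (trans (cong₂ _+_ (*-zeroˡ (A 0 (suc n))) (anti-δ n k (A ∘ suc))) (+-identityˡ _))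

data Part : ℕ → ℕ → List ℕ → Set where
  [] : ∀ {b} → Part b 0 []
  cons : ∀ {b k m λ′} → k ℕ.< b → Part (suc k) m λ′ → Part b (suc k ℕ.+ m) (suc k ∷ λ′)

Part-mono : ∀ {b c n λ′} → b ℕ.≤ c → Part b n λ′ → Part c n λ′
Part-mono l [] = []
Part-mono l (cons h p) = cons (ℕₚ.≤-trans h l) p

All-Part : ∀ f b n → All (Part b n) (partsBounded f b n)
All-Part f b zero = [] ∷ []
All-Part zero b (suc n) = []
All-Part (suc f) b (suc n) = Allₚ.concat⁺ (Allₚ.map⁺ (Allₚ.applyUpTo⁺₁ id (suc n) step))
  where
  step : ∀ {i} → i ℕ.< suc n →
    All (Part b (suc n)) (if ⌊ suc i ≤? b ⌋ ∧ ⌊ suc i ≤? suc n ⌋ then map (suc i ∷_) (partsBounded f (suc i) (n ∸ i))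
    else [])
  step {i} (s≤s l) with suc i ≤? b | suc i ≤? suc n
  ... | yes h | yes _ =
      Allₚ.map⁺ (All.map (λ {λ′} p → subst (λ z → Part b z (suc i ∷ λ′)) (cong suc (ℕₚ.m+[n∸m]≡n l)) (cons h p))
      (All-Part f (suc i) (n ∸ i)))
  ... | yes h | no _ = []
  ... | no _ | _ = []

partitionSum : ℕ → (List ℕ → ℚ) → Series
partitionSum b F n = ∑ₗ (partsBounded n b n) F

partsBounded-step : ∀ f b n F → ∑ₗ (partsBounded (suc f) b (suc n)) F ≡ anti n
  (λ i j → lt i b * ∑ₗ (partsBounded f (suc i) j) (F ∘ (suc i ∷_)))
partsBounded-step f b n F = begin
  ∑ₗ (partsBounded (suc f) b (suc n)) F ≡⟨ ∑ₗ-concatMap body F (upTo (suc n)) ⟩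
  ∑ₗ (upTo (suc n)) (λ i → ∑ₗ (body i) F) ≡⟨ ∑ₗ-upTo (suc n) _ ⟩
  ∑ (suc n) (λ i → ∑ₗ (body i) F) ≡⟨ ∑-cong< (suc n) step ⟩
  ∑ (suc n) (λ i → lt i b * ∑ₗ (partsBounded f (suc i) (n ∸ i)) (F ∘ (suc i ∷_)))
    ≡⟨ anti-∑ n (λ i j → lt i b * ∑ₗ (partsBounded f (suc i) j) (F ∘ (suc i ∷_))) ⟩
  anti n (λ i j → lt i b * ∑ₗ (partsBounded f (suc i) j) (F ∘ (suc i ∷_))) ∎
  where
  body : ℕ → List (List ℕ)
  body i = if ⌊ suc i ≤? b ⌋ ∧ ⌊ suc i ≤? suc n ⌋ then map (suc i ∷_) (partsBounded f (suc i) (n ∸ i)) else []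
  step : ∀ i → i ℕ.< suc n → ∑ₗ (body i) F ≡ lt i b * ∑ₗ (partsBounded f (suc i) (n ∸ i)) (F ∘ (suc i ∷_))
  step i l with suc i ≤? b | suc i ≤? suc n
  ... | yes h | yes _ = trans (∑ₗ-map (suc i ∷_) F (partsBounded f (suc i) (n ∸ i))) (sym (≡1-* X (lt-< h)))
    where X = ∑ₗ (partsBounded f (suc i) (n ∸ i)) (F ∘ (suc i ∷_))
  ... | yes h | no ¬l = ⊥-elim (¬l l)
  ... | no ¬h | _ = sym (≡0-* X (lt-≥ ¬h))
    where X = ∑ₗ (partsBounded f (suc i) (n ∸ i)) (F ∘ (suc i ∷_))

fuel-irrelevant : ∀ f g b n F → n ℕ.≤ f → n ℕ.≤ g → ∑ₗ (partsBounded f b n) F ≡ ∑ₗ (partsBounded g b n) F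
fuel-irrelevant f g b zero F _ _ = refl
fuel-irrelevant (suc f) (suc g) b (suc n) F (s≤s l) (s≤s k) = trans (partsBounded-step f b n F) (trans
  (anti-cong≡ n (λ i j e →
    cong (lt i b *_) (fuel-irrelevant f g (suc i) j _ (ℕₚ.≤-trans (≤-snd i j e) l) (ℕₚ.≤-trans (≤-snd i j e) k))))
  (sym (partsBounded-step g b n F)))

partitionSum-suc : ∀ b F n → partitionSum b F (suc n) ≡ anti n
  (λ i j → lt i b * partitionSum (suc i) (F ∘ (suc i ∷_)) j)
partitionSum-suc b F n = trans (partsBounded-step n b n F)
  (anti-cong≡ n (λ i j e → cong (lt i b *_) (fuel-irrelevant n j (suc i) j _ (≤-snd i j e) ℕₚ.≤-refl)))

-- A partition with parts at most b + 1 either has no part b + 1 or begins with one.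
partitionSum-step : ∀ b F → partitionSum (suc b) F ≈ partitionSum b F ⊕ shift (suc b)
  (partitionSum (suc b) (F ∘ (suc b ∷_)))
partitionSum-step b F zero = sym (+-identityʳ (F [] + 0ℚ))
partitionSum-step b F (suc n) = begin
  partitionSum (suc b) F (suc n) ≡⟨ partitionSum-suc (suc b) F n ⟩
  anti n (λ i j → lt i (suc b) * A i j)
    ≡⟨ anti-cong n (λ i j → trans (cong (_* A i j) (lt-suc i b)) (*-distribʳ-+ (A i j) (lt i b) (δ i b))) ⟩
  anti n (λ i j → lt i b * A i j + δ i b * A i j) ≡⟨ anti-+ n _ _ ⟩
  anti n (λ i j → lt i b * A i j) + anti n (λ i j → δ i b * A i j)
    ≡⟨ cong₂ _+_ (sym (partitionSum-suc b F n)) (anti-δ n b A) ⟩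
  partitionSum b F (suc n) + shift b (A b) n ∎
  where
  A : ℕ → Series
  A i = partitionSum (suc i) (F ∘ (suc i ∷_))

partitionSum-cong : ∀ b {F G} n → (∀ λ′ → Part b n λ′ → F λ′ ≡ G λ′) → partitionSum b F n ≡ partitionSum b G n
partitionSum-cong b n h = ∑ₗ-cong-All (All-Part n b n) h

partitionSum-zero : ∀ b {F} n → (∀ λ′ → Part b n λ′ → F λ′ ≡ 0ℚ) → partitionSum b F n ≡ 0ℚ
partitionSum-zero b n h = ∑ₗ-zero-All (All-Part n b n) h

ins : ℕ → List ℕ → List ℕ
ins k [] = k ∷ []
ins k (x ∷ xs) with x ≤? k
... | yes _ = k ∷ x ∷ xs
... | no _ = x ∷ ins k xs

ins-≤ : ∀ {k x} xs → x ℕ.≤ k → ins k (x ∷ xs) ≡ k ∷ x ∷ xs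
ins-≤ {k} {x} xs l with x ≤? k
... | yes _ = refl
... | no ¬l = ⊥-elim (¬l l)

ins-> : ∀ {k x} xs → k ℕ.< x → ins k (x ∷ xs) ≡ x ∷ ins k xs
ins-> {k} {x} xs l with x ≤? k
... | yes h = ⊥-elim (ℕₚ.<⇒≱ l h)
... | no _ = refl

ins-Part : ∀ {k n λ′} → Part (suc k) n λ′ → ins (suc k) λ′ ≡ suc k ∷ λ′
ins-Part [] = refl
ins-Part (cons l p) = ins-≤ _ l

Vanishes : ℕ → (List ℕ → ℚ) → Set
Vanishes k F = ∀ λ′ → mult k λ′ ≡ 0 → F λ′ ≡ 0ℚ

length-filterᵇ-true : ∀ {A : Set} (p : A → Bool) {x} xs → p x ≡ true → length (filterᵇ p (x ∷ xs)) ≡ suc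
  (length (filterᵇ p xs))
length-filterᵇ-true p {x} xs e with p x
length-filterᵇ-true p {x} xs refl | true = refl

length-filterᵇ-false : ∀ {A : Set} (p : A → Bool) {x} xs → p x ≡ false → length (filterᵇ p (x ∷ xs)) ≡ length
  (filterᵇ p xs)
length-filterᵇ-false p {x} xs e with p x
length-filterᵇ-false p {x} xs refl | false = refl

⌊⌋-true : ∀ {P : Set} (d : Dec P) → P → ⌊ d ⌋ ≡ true
⌊⌋-true (yes _) p = refl
⌊⌋-true (no ¬p) p = ⊥-elim (¬p p)

⌊⌋-false : ∀ {P : Set} (d : Dec P) → ¬ P → ⌊ d ⌋ ≡ false
⌊⌋-false (yes p) ¬p = ⊥-elim (¬p p)
⌊⌋-false (no _) ¬p = refl

mult-≡ : ∀ k λ′ → mult k (k ∷ λ′) ≡ suc (mult k λ′)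
mult-≡ k λ′ = length-filterᵇ-true (λ x → ⌊ x ℕ.≟ k ⌋) λ′ (⌊⌋-true (k ℕ.≟ k) refl)

mult-≢ : ∀ {k x} λ′ → x ≢ k → mult k (x ∷ λ′) ≡ mult k λ′
mult-≢ {k} {x} λ′ h = length-filterᵇ-false (λ x → ⌊ x ℕ.≟ k ⌋) λ′ (⌊⌋-false (x ℕ.≟ k) h)

mult-Part : ∀ {k b n λ′} → b ℕ.< k → Part b n λ′ → mult k λ′ ≡ 0
mult-Part l [] = refl
mult-Part {k} l (cons {k = j} {λ′ = λ′} h p) = trans (mult-≢ λ′ (ℕₚ.<⇒≢ (ℕₚ.≤-<-trans h l)))
  (mult-Part (ℕₚ.≤-<-trans h l) p)

-- Removing one part k is a bijection from the partitions of n containing k onto the partitions of n - k.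
partitionSum-ins : ∀ b k F → k ℕ.< b → Vanishes (suc k) F → partitionSum b F ≈ shift (suc k)
  (partitionSum b (F ∘ ins (suc k)))
partitionSum-ins (suc b) k F (s≤s l) v n =
  <-rec (λ n → ∀ F → Vanishes (suc k) F → partitionSum (suc b) F n ≡ shift (suc k)
  (partitionSum (suc b) (F ∘ ins (suc k))) n) step n F v
  where
  K = suc k
  B = suc b
  step : ∀ n → (∀ {m} → m ℕ.< n → ∀ F → Vanishes K F → partitionSum B F m ≡ shift K (partitionSum B (F ∘ ins K)) m) →
    ∀ F → Vanishes K F → partitionSum B F n ≡ shift K (partitionSum B (F ∘ ins K)) n
  step n ih F v with ℕₚ.m≤n⇒m<n∨m≡n l
  ... | inj₂ refl = begin
    partitionSum B F n ≡⟨ partitionSum-step b F n ⟩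
    partitionSum b F n + shift B (partitionSum B (F ∘ (B ∷_))) n
      ≡⟨ cong (_+ shift B (partitionSum B (F ∘ (B ∷_))) n)
      (partitionSum-zero b n (λ λ′ p → v λ′ (mult-Part ℕₚ.≤-refl p))) ⟩
    0ℚ + shift B (partitionSum B (F ∘ (B ∷_))) n ≡⟨ +-identityˡ _ ⟩
    shift B (partitionSum B (F ∘ (B ∷_))) n
      ≡⟨ shift-cong B (λ m → partitionSum-cong B m (λ λ′ p → cong F (sym (ins-Part p)))) n ⟩
    shift B (partitionSum B (F ∘ ins B)) n ∎
  -- The partitions without the part `B` are handled by recursion on `b`, those that begin with `B`
  -- by the induction on `n`.
  ... | inj₁ k<b = begin
    partitionSum B F n ≡⟨ partitionSum-step b F n ⟩
    partitionSum b F n + shift B (partitionSum B G) n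
      ≡⟨ cong₂ _+_ (partitionSum-ins b k F k<b v n) (shift-cong-< b n (λ m m<n → ih m<n G Gv)) ⟩
    shift K (partitionSum b (F ∘ ins K)) n + shift B (shift K (partitionSum B (G ∘ ins K))) n
      ≡⟨ cong (shift K (partitionSum b (F ∘ ins K)) n +_) (shift-comm B K _ n) ⟩
    shift K (partitionSum b (F ∘ ins K)) n + shift K (shift B (partitionSum B (G ∘ ins K))) n
      ≡⟨ cong (shift K (partitionSum b (F ∘ ins K)) n +_)
        (shift-cong K (shift-cong B (λ m → ∑ₗ-cong (partsBounded m B m) (λ λ′ → cong F (sym (ins-> λ′ (s≤s k<b))))))
        n) ⟩
    shift K (partitionSum b (F ∘ ins K)) n + shift K (shift B (partitionSum B (F ∘ ins K ∘ (B ∷_)))) n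
      ≡⟨ sym (shift-⊕ K _ _ n) ⟩
    shift K (partitionSum b (F ∘ ins K) ⊕ shift B (partitionSum B (F ∘ ins K ∘ (B ∷_)))) n
      ≡⟨ shift-cong K (λ m → sym (partitionSum-step b (F ∘ ins K) m)) n ⟩
    shift K (partitionSum B (F ∘ ins K)) n ∎
    where
    G : List ℕ → ℚ
    G = F ∘ (B ∷_)
    Gv : Vanishes K G
    Gv λ′ e = v (B ∷ λ′) (trans (mult-≢ λ′ (≢-sym (ℕₚ.<⇒≢ (s≤s k<b)))) e)

[_≟ₗ_] : List ℕ → List ℕ → ℚ
[ x ≟ₗ y ] = if ⌊ ≡-dec ℕ._≟_ x y ⌋ then 1ℚ else 0ℚ

≟ₗ-≡ : ∀ x → [ x ≟ₗ x ] ≡ 1ℚ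
≟ₗ-≡ x = cong (if_then 1ℚ else 0ℚ) (⌊⌋-true (≡-dec ℕ._≟_ x x) refl)

≟ₗ-≢ : ∀ {x y} → x ≢ y → [ x ≟ₗ y ] ≡ 0ℚ
≟ₗ-≢ {x} {y} h = cong (if_then 1ℚ else 0ℚ) (⌊⌋-false (≡-dec ℕ._≟_ x y) h)

≟ₗ-∷ : ∀ k x y → [ k ∷ x ≟ₗ k ∷ y ] ≡ [ x ≟ₗ y ]
≟ₗ-∷ k x y = by-cases (≡-dec ℕ._≟_ x y)
  where
  by-cases : Dec (x ≡ y) → [ k ∷ x ≟ₗ k ∷ y ] ≡ [ x ≟ₗ y ]
  by-cases (yes refl) = trans (≟ₗ-≡ (k ∷ x)) (sym (≟ₗ-≡ x))
  by-cases (no h) = trans (≟ₗ-≢ (λ { refl → h refl })) (sym (≟ₗ-≢ h))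

≟ₗ-∷≢ : ∀ {j k} x y → j ≢ k → [ j ∷ x ≟ₗ k ∷ y ] ≡ 0ℚ
≟ₗ-∷≢ x y h = ≟ₗ-≢ (λ { refl → h refl })

δ-≡ : ∀ i → δ i i ≡ 1ℚ
δ-≡ zero = refl
δ-≡ (suc i) = δ-≡ i

δ-≢ : ∀ {i j} → i ≢ j → δ i j ≡ 0ℚ
δ-≢ {zero} {zero} h = ⊥-elim (h refl)
δ-≢ {zero} {suc j} h = refl
δ-≢ {suc i} {zero} h = refl
δ-≢ {suc i} {suc j} h = δ-≢ (h ∘ cong suc)

shift-+ : ∀ k A m → shift k A (k ℕ.+ m) ≡ A m
shift-+ zero A m = refl
shift-+ (suc k) A m = shift-+ k A m

-- Every partition occurs exactly once in the enumeration.
partitionSum-pick : ∀ {b n γ} (F : List ℕ → ℚ) → Part b n γ → partitionSum b (λ λ′ → [ γ ≟ₗ λ′ ] * F λ′) n ≡ F γ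
partitionSum-pick F [] = trans (+-identityʳ _) (*-identityˡ (F []))
partitionSum-pick {b} F (cons {k = k} {m} {γ} l p) = begin
  partitionSum b G (suc k ℕ.+ m) ≡⟨ partitionSum-suc b G (k ℕ.+ m) ⟩
  anti (k ℕ.+ m) (λ i j → lt i b * A i j) ≡⟨ anti-cong (k ℕ.+ m) only-k ⟩
  anti (k ℕ.+ m) (λ i j → δ i k * A i j) ≡⟨ anti-δ (k ℕ.+ m) k A ⟩
  shift k (A k) (k ℕ.+ m) ≡⟨ shift-+ k (A k) m ⟩
  A k m ≡⟨ ∑ₗ-cong (partsBounded m (suc k) m) (λ λ′ → cong (_* F (suc k ∷ λ′)) (≟ₗ-∷ (suc k) γ λ′)) ⟩
  partitionSum (suc k) (λ λ′ → [ γ ≟ₗ λ′ ] * F (suc k ∷ λ′)) m ≡⟨ partitionSum-pick (F ∘ (suc k ∷_)) p ⟩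
  F (suc k ∷ γ) ∎
  where
  G : List ℕ → ℚ
  G λ′ = [ suc k ∷ γ ≟ₗ λ′ ] * F λ′
  A : ℕ → Series
  A i = partitionSum (suc i) (G ∘ (suc i ∷_))
  only-k : ∀ i j → lt i b * A i j ≡ δ i k * A i j
  only-k i j with i ℕ.≟ k
  ... | yes refl = cong (_* A i j) (trans (lt-< l) (sym (δ-≡ i)))
  ... | no h = trans (cong (lt i b *_) z) (trans (*-zeroʳ (lt i b)) (sym (*-≡0 (δ i k) z)))
    where
    z : A i j ≡ 0ℚ
    z = ∑ₗ-zero (partsBounded j (suc i) j)
      (λ λ′ → ≡0-* (F (suc i ∷ λ′)) (≟ₗ-∷≢ γ λ′ (λ e → h (sym (ℕₚ.suc-injective e)))))

-- Monomial symmetric functions of a finite family of rationals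

infix 4 _~_
-- Reordering and deletion of zeros, the two changes of an exponent list that a symmetric function
-- does not see. Every list is related to its `canon`, so a function that respects `~` is determined
-- by its values on partitions.
data _~_ : List ℕ → List ℕ → Set where
  nil : [] ~ []
  cons~ : ∀ x {xs ys} → xs ~ ys → x ∷ xs ~ x ∷ ys
  swap~ : ∀ x y zs → x ∷ y ∷ zs ~ y ∷ x ∷ zs
  drop0 : ∀ xs → 0 ∷ xs ~ xs
  trans~ : ∀ {xs ys zs} → xs ~ ys → ys ~ zs → xs ~ zs

refl~ : ∀ xs → xs ~ xs
refl~ [] = nil
refl~ (x ∷ xs) = cons~ x (refl~ xs)

ins-~ : ∀ k xs → k ∷ xs ~ ins k xs
ins-~ k [] = refl~ _
ins-~ k (x ∷ xs) with x ≤? k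
... | yes _ = refl~ _
... | no _ = trans~ (swap~ k x xs) (cons~ x (ins-~ k xs))

canon : List ℕ → List ℕ
canon [] = []
canon (zero ∷ xs) = canon xs
canon (suc k ∷ xs) = ins (suc k) (canon xs)

canon-~ : ∀ xs → xs ~ canon xs
canon-~ [] = nil
canon-~ (zero ∷ xs) = trans~ (drop0 xs) (canon-~ xs)
canon-~ (suc k ∷ xs) = trans~ (cons~ (suc k) (canon-~ xs)) (ins-~ (suc k) (canon xs))

ins-comm-< : ∀ {a b} xs → a ℕ.< b → ins a (ins b xs) ≡ ins b (ins a xs)
ins-comm-< {a} {b} [] l = trans (ins-> [] l) (sym (ins-≤ [] (ℕₚ.<⇒≤ l)))
ins-comm-< {a} {b} (x ∷ xs) l with x ≤? a | x ≤? b
... | yes p | yes q = trans (ins-> (x ∷ xs) l) (trans (cong (b ∷_) (ins-≤ xs p)) (sym (ins-≤ (x ∷ xs) (ℕₚ.<⇒≤ l))))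
... | yes p | no ¬q = ⊥-elim (¬q (ℕₚ.≤-trans p (ℕₚ.<⇒≤ l)))
... | no ¬p | yes q = trans (ins-> (x ∷ xs) l) (trans (cong (b ∷_) (ins-> xs (ℕₚ.≰⇒> ¬p))) (sym (ins-≤ (ins a xs) q)))
... | no ¬p | no ¬q = trans (ins-> (ins b xs) (ℕₚ.≰⇒> ¬p))
    (trans (cong (x ∷_) (ins-comm-< xs l)) (sym (ins-> (ins a xs) (ℕₚ.≰⇒> ¬q))))

ins-comm : ∀ a b xs → ins a (ins b xs) ≡ ins b (ins a xs)
ins-comm a b xs with ℕₚ.<-cmp a b
... | tri< l _ _ = ins-comm-< xs l
... | tri≈ _ refl _ = refl
... | tri> _ _ l = sym (ins-comm-< xs l)

canon-resp : ∀ {xs ys} → xs ~ ys → canon xs ≡ canon ys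
canon-resp nil = refl
canon-resp (cons~ zero h) = canon-resp h
canon-resp (cons~ (suc k) h) = cong (ins (suc k)) (canon-resp h)
canon-resp (swap~ zero zero zs) = refl
canon-resp (swap~ zero (suc y) zs) = refl
canon-resp (swap~ (suc x) zero zs) = refl
canon-resp (swap~ (suc x) (suc y) zs) = ins-comm (suc x) (suc y) (canon zs)
canon-resp (drop0 xs) = refl
canon-resp (trans~ h k) = trans (canon-resp h) (canon-resp k)

Part-ins : ∀ {b k m λ′} → k ℕ.< b → Part b m λ′ → Part b (suc k ℕ.+ m) (ins (suc k) λ′)
Part-ins l [] = cons l []
Part-ins {b} {k} l (cons {k = j} {m} {λ′} h p) with suc j ≤? suc k
... | yes q = cons l (cons q p)
... | no ¬q = subst (λ z → Part b z (suc j ∷ ins (suc k) λ′)) (j+k j k m) (cons h (Part-ins (ℕₚ.<⇒≤ (ℕₚ.≰⇒> ¬q)) p))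
  where
  j+k : ∀ j k m → suc j ℕ.+ (suc k ℕ.+ m) ≡ suc k ℕ.+ (suc j ℕ.+ m)
  j+k j k m = trans (sym (ℕₚ.+-assoc (suc j) (suc k) m))
    (trans (cong (ℕ._+ m) (ℕₚ.+-comm (suc j) (suc k))) (ℕₚ.+-assoc (suc k) (suc j) m))

Part-canon : ∀ b β → sum β ℕ.≤ b → Part b (sum β) (canon β)
Part-canon b [] l = []
Part-canon b (zero ∷ β) l = Part-canon b β l
Part-canon b (suc k ∷ β) l = Part-ins (ℕₚ.≤-trans (s≤s (ℕₚ.m≤m+n k (sum β))) l)
  (Part-canon b β (ℕₚ.≤-trans (ℕₚ.m≤n+m (sum β) (suc k)) l))

Respects : (List ℕ → ℚ) → Set
Respects F = ∀ {xs ys} → xs ~ ys → F xs ≡ F ys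

-- Φ Y n F = ∑_β y^β F(β) over the exponent lists β with length Y entries and sum n.
Φ : List ℚ → ℕ → (List ℕ → ℚ) → ℚ
Φ [] n F = const (F []) n
Φ (y ∷ Y) n F = anti n (λ k m → powℚ y k * Φ Y m (F ∘ (k ∷_)))

Φ-cong≡ : ∀ Y n {F G} → (∀ β → sum β ≡ n → F β ≡ G β) → Φ Y n F ≡ Φ Y n G
Φ-cong≡ [] zero h = h [] refl
Φ-cong≡ [] (suc n) h = refl
Φ-cong≡ (y ∷ Y) n h =
  anti-cong≡ n (λ k m e → cong (powℚ y k *_) (Φ-cong≡ Y m (λ β f → h (k ∷ β) (trans (cong (k ℕ.+_) f) e))))

Φ-cong : ∀ Y n {F G} → (∀ β → F β ≡ G β) → Φ Y n F ≡ Φ Y n G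
Φ-cong Y n h = Φ-cong≡ Y n (λ β _ → h β)

Φ-∑ₗ : ∀ {A : Set} Y n (xs : List A) (F : A → List ℕ → ℚ) → Φ Y n (λ β → ∑ₗ xs (λ x → F x β)) ≡ ∑ₗ xs
  (λ x → Φ Y n (F x))
Φ-∑ₗ [] zero xs F = refl
Φ-∑ₗ [] (suc n) xs F = sym (∑ₗ-zero xs (λ _ → refl))
Φ-∑ₗ (y ∷ Y) n xs F =
  trans (anti-cong n (λ k m → trans (cong (powℚ y k *_) (Φ-∑ₗ Y m xs (λ x → F x ∘ (k ∷_))))
  (sym (∑ₗ-*ˡ (powℚ y k) _ xs)))) (anti-∑ₗ n xs _)

Φ-+ : ∀ Y n F G → Φ Y n (λ β → F β + G β) ≡ Φ Y n F + Φ Y n G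
Φ-+ [] zero F G = refl
Φ-+ [] (suc n) F G = refl
Φ-+ (y ∷ Y) n F G = trans
  (anti-cong n (λ k m → trans (cong (powℚ y k *_) (Φ-+ Y m (F ∘ (k ∷_)) (G ∘ (k ∷_)))) (*-distribˡ-+ (powℚ y k) _ _)))
  (anti-+ n _ _)

Φ-*ˡ : ∀ Y n c F → Φ Y n (λ β → c * F β) ≡ c * Φ Y n F
Φ-*ˡ [] zero c F = refl
Φ-*ˡ [] (suc n) c F = sym (*-zeroʳ c)
Φ-*ˡ (y ∷ Y) n c F = trans
  (anti-cong n (λ k m → trans (cong (powℚ y k *_) (Φ-*ˡ Y m c (F ∘ (k ∷_))))
  (solve 3 (λ p c f → p :* (c :* f) := c :* (p :* f)) refl (powℚ y k) c (Φ Y m (F ∘ (k ∷_)))))) (anti-*ˡ n c _)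

Φ-zero : ∀ Y n {F} → (∀ β → sum β ≡ n → F β ≡ 0ℚ) → Φ Y n F ≡ 0ℚ
Φ-zero Y n h = trans (Φ-cong≡ Y n (λ β e → h β e)) (null Y n)
  where
  null : ∀ Y n → Φ Y n (λ _ → 0ℚ) ≡ 0ℚ
  null [] zero = refl
  null [] (suc n) = refl
  null (y ∷ Y) n = anti-zero n (λ k m _ → *-≡0 (powℚ y k) (null Y m))

pow-nonNeg : ∀ {y} k → 0ℚ ≤ y → 0ℚ ≤ powℚ y k
pow-nonNeg zero h = 0≤ℕtoℚ 1
pow-nonNeg (suc k) h = *-nonNeg h (pow-nonNeg k h)

Φ-nonNeg : ∀ {Y} n F → All (0ℚ ≤_) Y → (∀ β → 0ℚ ≤ F β) → 0ℚ ≤ Φ Y n F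
Φ-nonNeg zero F [] h = h []
Φ-nonNeg (suc n) F [] h = ≤-refl
Φ-nonNeg n F (p ∷ ps) h = anti-nonNeg n _ (λ k m → *-nonNeg (pow-nonNeg k p) (Φ-nonNeg m _ ps (λ β → h (k ∷ β))))

-- The monomial symmetric polynomial m_λ′ evaluated at Y; it is 0 unless λ′ is a partition of n.
monomial : List ℚ → ℕ → List ℕ → ℚ
monomial Y n λ′ = Φ Y n (λ β → [ canon β ≟ₗ λ′ ])

≟ₗ-nonNeg : ∀ x y → 0ℚ ≤ [ x ≟ₗ y ]
≟ₗ-nonNeg x y with ≡-dec ℕ._≟_ x y
... | yes _ = 0≤ℕtoℚ 1
... | no _ = ≤-refl

monomial-nonNeg : ∀ {Y} n λ′ → All (0ℚ ≤_) Y → 0ℚ ≤ monomial Y n λ′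
monomial-nonNeg n λ′ h = Φ-nonNeg n _ h (λ β → ≟ₗ-nonNeg (canon β) λ′)

-- The exponent lists are grouped by `canon β`. On the group of `ν` the function `F` is constant,
-- and the monomials of the group add up to m_ν.
Φ-monomial : ∀ Y n {F} → Respects F → Φ Y n F ≡ partitionSum n (λ ν → F ν * monomial Y n ν) n
Φ-monomial Y n {F} r = begin
  Φ Y n F ≡⟨ Φ-cong≡ Y n (λ β e → trans (r (canon-~ β)) (sym (partitionSum-pick F (part β e)))) ⟩
  Φ Y n (λ β → ∑ₗ (partsBounded n n n) (λ ν → [ canon β ≟ₗ ν ] * F ν)) ≡⟨ Φ-∑ₗ Y n (partsBounded n n n) _ ⟩
  ∑ₗ (partsBounded n n n) (λ ν → Φ Y n (λ β → [ canon β ≟ₗ ν ] * F ν))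
    ≡⟨ ∑ₗ-cong (partsBounded n n n)
    (λ ν → trans (Φ-cong Y n (λ β → *-comm [ canon β ≟ₗ ν ] (F ν))) (Φ-*ˡ Y n (F ν) _)) ⟩
  ∑ₗ (partsBounded n n n) (λ ν → F ν * monomial Y n ν) ∎
  where
  part : ∀ β → sum β ≡ n → Part n n (canon β)
  part β refl = Part-canon n β ℕₚ.≤-refl

-- Δ ℓ F β sums F over the ways of lowering ℓ different positive entries of β by one.
Δ : ℕ → (List ℕ → ℚ) → List ℕ → ℚ
Δ zero F β = F β
Δ (suc ℓ) F [] = 0ℚ
Δ (suc ℓ) F (zero ∷ β) = Δ (suc ℓ) (F ∘ (0 ∷_)) β
Δ (suc ℓ) F (suc b ∷ β) = Δ (suc ℓ) (F ∘ (suc b ∷_)) β + Δ ℓ (F ∘ (b ∷_)) β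

Δ-cong : ∀ ℓ {F G} → (∀ β → F β ≡ G β) → ∀ β → Δ ℓ F β ≡ Δ ℓ G β
Δ-cong zero h β = h β
Δ-cong (suc ℓ) h [] = refl
Δ-cong (suc ℓ) h (zero ∷ β) = Δ-cong (suc ℓ) (λ β → h (0 ∷ β)) β
Δ-cong (suc ℓ) h (suc b ∷ β) = cong₂ _+_ (Δ-cong (suc ℓ) (λ β → h (suc b ∷ β)) β) (Δ-cong ℓ (λ β → h (b ∷ β)) β)

Δ-0∷ : ∀ ℓ F β → Δ ℓ F (0 ∷ β) ≡ Δ ℓ (F ∘ (0 ∷_)) β
Δ-0∷ zero F β = refl
Δ-0∷ (suc ℓ) F β = refl

-- Swapping two positive entries permutes the ways of lowering them: neither, the one, the other,
-- both. For `ℓ = 1` lowering both is impossible, hence the separate clause.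
Δ-resp : ∀ ℓ {F} → Respects F → Respects (Δ ℓ F)
Δ-resp zero r h = r h
Δ-resp (suc ℓ) r nil = refl
Δ-resp (suc ℓ) r (cons~ zero h) = Δ-resp (suc ℓ) (λ k → r (cons~ 0 k)) h
Δ-resp (suc ℓ) r (cons~ (suc x) h) = cong₂ _+_ (Δ-resp (suc ℓ) (λ k → r (cons~ (suc x) k)) h)
  (Δ-resp ℓ (λ k → r (cons~ x k)) h)
Δ-resp (suc ℓ) r (swap~ zero zero zs) = refl
Δ-resp (suc ℓ) {F} r (swap~ zero (suc y) zs) = cong₂ _+_ (Δ-cong (suc ℓ) (λ β → r (swap~ 0 (suc y) β)) zs)
  (trans (Δ-cong ℓ (λ β → r (swap~ 0 y β)) zs) (sym (Δ-0∷ ℓ (F ∘ (y ∷_)) zs)))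
Δ-resp (suc ℓ) {F} r (swap~ (suc x) zero zs) = cong₂ _+_ (Δ-cong (suc ℓ) (λ β → r (swap~ (suc x) 0 β)) zs)
  (trans (Δ-0∷ ℓ (F ∘ (x ∷_)) zs) (Δ-cong ℓ (λ β → r (swap~ x 0 β)) zs))
Δ-resp (suc zero) {F} r (swap~ (suc x) (suc y) zs) = begin
  Δ 1 (F ∘ (suc x ∷_) ∘ (suc y ∷_)) zs + F (suc x ∷ y ∷ zs) + F (x ∷ suc y ∷ zs)
    ≡⟨ solve 3 (λ a b c → a :+ b :+ c := a :+ c :+ b) refl (Δ 1 (F ∘ (suc x ∷_) ∘ (suc y ∷_)) zs) (F (suc x ∷ y ∷ zs))
      (F (x ∷ suc y ∷ zs)) ⟩
  Δ 1 (F ∘ (suc x ∷_) ∘ (suc y ∷_)) zs + F (x ∷ suc y ∷ zs) + F (suc x ∷ y ∷ zs)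
    ≡⟨ cong₂ _+_ (cong₂ _+_ (Δ-cong 1 (λ β → r (swap~ (suc x) (suc y) β)) zs) (r (swap~ x (suc y) zs)))
      (r (swap~ (suc x) y zs)) ⟩
  Δ 1 (F ∘ (suc y ∷_) ∘ (suc x ∷_)) zs + F (suc y ∷ x ∷ zs) + F (y ∷ suc x ∷ zs) ∎
Δ-resp (suc (suc ℓ)) {F} r (swap~ (suc x) (suc y) zs) = begin
  D (suc (suc ℓ)) (suc x) (suc y) + D (suc ℓ) (suc x) y + (D (suc ℓ) x (suc y) + D ℓ x y)
    ≡⟨ solve 4 (λ a b c d → a :+ b :+ (c :+ d) := a :+ c :+ (b :+ d)) refl (D (suc (suc ℓ)) (suc x) (suc y))
      (D (suc ℓ) (suc x) y) (D (suc ℓ) x (suc y)) (D ℓ x y) ⟩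
  D (suc (suc ℓ)) (suc x) (suc y) + D (suc ℓ) x (suc y) + (D (suc ℓ) (suc x) y + D ℓ x y)
    ≡⟨ cong₂ _+_ (cong₂ _+_ (D-comm (suc (suc ℓ)) (suc x) (suc y)) (D-comm (suc ℓ) x (suc y)))
      (cong₂ _+_ (D-comm (suc ℓ) (suc x) y) (D-comm ℓ x y)) ⟩
  D (suc (suc ℓ)) (suc y) (suc x) + D (suc ℓ) (suc y) x + (D (suc ℓ) y (suc x) + D ℓ y x) ∎
  where
  D : ℕ → ℕ → ℕ → ℚ
  D ℓ x y = Δ ℓ (F ∘ (x ∷_) ∘ (y ∷_)) zs
  D-comm : ∀ ℓ x y → D ℓ x y ≡ D ℓ y x
  D-comm ℓ x y = Δ-cong ℓ (λ β → r (swap~ x y β)) zs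
Δ-resp (suc ℓ) {F} r (drop0 xs) = Δ-cong (suc ℓ) (λ β → r (drop0 β)) xs
Δ-resp (suc ℓ) r (trans~ h k) = trans (Δ-resp (suc ℓ) r h) (Δ-resp (suc ℓ) r k)

Δ-sum< : ∀ ℓ F β → sum β ℕ.< ℓ → Δ ℓ F β ≡ 0ℚ
Δ-sum< (suc ℓ) F [] l = refl
Δ-sum< (suc ℓ) F (zero ∷ β) l = Δ-sum< (suc ℓ) (F ∘ (0 ∷_)) β l
Δ-sum< (suc ℓ) F (suc b ∷ β) (s≤s l) =
  cong₂ _+_ (Δ-sum< (suc ℓ) (F ∘ (suc b ∷_)) β (s≤s (ℕₚ.≤-trans (ℕₚ.m≤n+m (sum β) (suc b)) l)))
  (Δ-sum< ℓ (F ∘ (b ∷_)) β (ℕₚ.≤-trans (s≤s (ℕₚ.m≤n+m (sum β) b)) l))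

Δ-length< : ∀ ℓ F β → length β ℕ.< ℓ → Δ ℓ F β ≡ 0ℚ
Δ-length< (suc ℓ) F [] l = refl
Δ-length< (suc ℓ) F (zero ∷ β) (s≤s l) = Δ-length< (suc ℓ) (F ∘ (0 ∷_)) β (ℕₚ.m<n⇒m<1+n l)
Δ-length< (suc ℓ) F (suc b ∷ β) (s≤s l) = cong₂ _+_ (Δ-length< (suc ℓ) (F ∘ (suc b ∷_)) β (ℕₚ.m<n⇒m<1+n l))
  (Δ-length< ℓ (F ∘ (b ∷_)) β l)

-- With as many entries to lower as there are parts, all of them are lowered. This produces the
-- leading coefficient 1 in the product of e_ℓ with a monomial function.
Δ-length : ∀ {b n ν} F → Part b n ν → Δ (length ν) F ν ≡ F (map ℕ.pred ν)
Δ-length F [] = refl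
Δ-length F (cons {k = k} {λ′ = ν} l p) =
  trans (cong₂ _+_ (Δ-length< (suc (length ν)) (F ∘ (suc k ∷_)) ν ℕₚ.≤-refl) (Δ-length (F ∘ (k ∷_)) p))
  (+-identityˡ (F (k ∷ map ℕ.pred ν)))

-- Generating functions of elementary, complete and power sum symmetric functions.

linear : ℚ → Series
linear y = const 1ℚ ⊕ const y ⊛ t

elementary : List ℚ → Series
elementary [] = const 1ℚ
elementary (y ∷ Y) = linear y ⊛ elementary Y

linear-⊛ : ∀ y A n → (linear y ⊛ A) n ≡ A n + y * (t ⊛ A) n
linear-⊛ y A n = trans (solveₛ 3 (λ y t a → (conₛ 1ℚ +ₛ y *ₛ t) *ₛ a =ₛ a +ₛ y *ₛ (t *ₛ a)) refl≈ (const y) t A n)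
  (cong (A n +_) (const-⊛ y (t ⊛ A) n))

elementary-0 : ∀ Y → elementary Y 0 ≡ 1ℚ
elementary-0 [] = refl
elementary-0 (y ∷ Y) = trans (linear-⊛ y (elementary Y) 0)
  (trans (cong₂ (λ u v → u + y * v) (elementary-0 Y) (t-⊛-0 (elementary Y))) (cong (1ℚ +_) (*-zeroʳ y)))

elementary-suc : ∀ y Y n → elementary (y ∷ Y) (suc n) ≡ elementary Y (suc n) + y * elementary Y n
elementary-suc y Y n = trans (linear-⊛ y (elementary Y) (suc n))
  (cong (λ z → elementary Y (suc n) + y * z) (t-⊛-suc (elementary Y) n))

anti-drop : ∀ n ℓ (A : ℕ → ℕ → ℚ) → (∀ k m → m ℕ.< ℓ → A k m ≡ 0ℚ) → anti (n ℕ.+ ℓ) A ≡ anti n (λ k m → A k (m ℕ.+ ℓ))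
anti-drop n zero A h = trans (cong (λ z → anti z A) (ℕₚ.+-identityʳ n))
  (anti-cong n (λ k m → cong (A k) (sym (ℕₚ.+-identityʳ m))))
anti-drop n (suc ℓ) A h = begin
  anti (n ℕ.+ suc ℓ) A ≡⟨ cong (λ z → anti z A) (ℕₚ.+-suc n ℓ) ⟩
  anti (suc (n ℕ.+ ℓ)) A ≡⟨ anti-sucʳ (n ℕ.+ ℓ) A ⟩
  anti (n ℕ.+ ℓ) (λ k m → A k (suc m)) + A (suc (n ℕ.+ ℓ)) 0
    ≡⟨ cong₂ _+_ (anti-drop n ℓ (λ k m → A k (suc m)) (λ k m l → h k (suc m) (s≤s l))) (h _ 0 (s≤s z≤n)) ⟩
  anti n (λ k m → A k (suc (m ℕ.+ ℓ))) + 0ℚ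
    ≡⟨ trans (+-identityʳ _) (anti-cong n (λ k m → cong (A k) (sym (ℕₚ.+-suc m ℓ)))) ⟩
  anti n (λ k m → A k (m ℕ.+ suc ℓ)) ∎

-- Multiplying y^β by a squarefree monomial of degree ℓ raises ℓ entries of β by one. Summed over
-- the raised list instead, `F` is evaluated after lowering ℓ entries. The induction on `Y` follows
-- e_{ℓ+1}(y, Y) = e_{ℓ+1}(Y) + y e_ℓ(Y): the first entry is either left alone or raised.
elementary-Φ : ∀ Y ℓ n F → elementary Y ℓ * Φ Y n F ≡ Φ Y (n ℕ.+ ℓ) (Δ ℓ F)
elementary-Φ [] zero n F = trans (*-identityˡ (Φ [] n F)) (cong (const (F [])) (sym (ℕₚ.+-identityʳ n)))
elementary-Φ [] (suc ℓ) n F = trans (*-zeroˡ (Φ [] n F)) (sym (const-0 (n ℕ.+ suc ℓ)))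
elementary-Φ (y ∷ Y) zero n F = trans (cong (_* Φ (y ∷ Y) n F) (elementary-0 (y ∷ Y)))
  (trans (*-identityˡ (Φ (y ∷ Y) n F)) (cong (λ z → Φ (y ∷ Y) z F) (sym (ℕₚ.+-identityʳ n))))
elementary-Φ (y ∷ Y) (suc ℓ) n F = begin
  elementary (y ∷ Y) (suc ℓ) * anti n (λ k m → powℚ y k * Φ Y m (F ∘ (k ∷_)))
    ≡⟨ cong (_* anti n (λ k m → powℚ y k * Φ Y m (F ∘ (k ∷_)))) (elementary-suc y Y ℓ) ⟩
  (elementary Y (suc ℓ) + y * elementary Y ℓ) * anti n (λ k m → powℚ y k * Φ Y m (F ∘ (k ∷_)))
    ≡⟨ sym (anti-*ˡ n (elementary Y (suc ℓ) + y * elementary Y ℓ) _) ⟩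
  anti n (λ k m → (elementary Y (suc ℓ) + y * elementary Y ℓ) * (powℚ y k * Φ Y m (F ∘ (k ∷_))))
    ≡⟨ anti-cong n expand ⟩
  anti n (λ k m → A k (m ℕ.+ suc ℓ) + B k (m ℕ.+ ℓ)) ≡⟨ anti-+ n _ _ ⟩
  anti n (λ k m → A k (m ℕ.+ suc ℓ)) + anti n (λ k m → B k (m ℕ.+ ℓ))
    ≡⟨ cong₂ _+_ (sym (anti-drop n (suc ℓ) A (λ k m l → vanish (powℚ y k) (suc ℓ) _ m l)))
      (sym (anti-drop n ℓ B (λ k m l → vanish (powℚ y (suc k)) ℓ _ m l))) ⟩
  anti (n ℕ.+ suc ℓ) A + anti N B ≡⟨ cong (λ z → anti z A + anti N B) (ℕₚ.+-suc n ℓ) ⟩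
  anti (suc N) A + anti N B ≡⟨ cong (_+ anti N B) (anti-suc N A) ⟩
  A 0 (suc N) + anti N (λ k m → A (suc k) m) + anti N B ≡⟨ +-assoc (A 0 (suc N)) _ _ ⟩
  A 0 (suc N) + (anti N (λ k m → A (suc k) m) + anti N B)
    ≡⟨ cong (A 0 (suc N) +_) (trans (sym (anti-+ N _ _)) (anti-cong N collect)) ⟩
  C 0 (suc N) + anti N (λ k m → C (suc k) m) ≡⟨ sym (anti-suc N C) ⟩
  anti (suc N) C ≡⟨ cong (λ z → anti z C) (sym (ℕₚ.+-suc n ℓ)) ⟩
  anti (n ℕ.+ suc ℓ) C ∎
  where
  N = n ℕ.+ ℓ
  A B C : ℕ → ℕ → ℚ
  A k m = powℚ y k * Φ Y m (Δ (suc ℓ) (F ∘ (k ∷_)))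
  B k m = powℚ y (suc k) * Φ Y m (Δ ℓ (F ∘ (k ∷_)))
  C k m = powℚ y k * Φ Y m (Δ (suc ℓ) F ∘ (k ∷_))
  vanish : ∀ c ℓ G m → m ℕ.< ℓ → c * Φ Y m (Δ ℓ G) ≡ 0ℚ
  vanish c ℓ G m l = *-≡0 c (Φ-zero Y m (λ β e → Δ-sum< ℓ G β (subst (ℕ._< ℓ) (sym e) l)))
  expand : ∀ k m → (elementary Y (suc ℓ) + y * elementary Y ℓ) * (powℚ y k * Φ Y m (F ∘ (k ∷_))) ≡ A k
    (m ℕ.+ suc ℓ) + B k (m ℕ.+ ℓ)
  expand k m = trans (solve 5 (λ a y b p f → (a :+ y :* b) :* (p :* f) := p :* (a :* f) :+ y :* p :* (b :* f)) refl
    (elementary Y (suc ℓ)) y (elementary Y ℓ) (powℚ y k) (Φ Y m (F ∘ (k ∷_))))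
    (cong₂ (λ u v → powℚ y k * u + y * powℚ y k * v) (elementary-Φ Y (suc ℓ) m _) (elementary-Φ Y ℓ m _))
  collect : ∀ k m → A (suc k) m + B k m ≡ C (suc k) m
  collect k m = trans (sym (*-distribˡ-+ (powℚ y (suc k)) _ _)) (cong (powℚ y (suc k) *_) (sym (Φ-+ Y m _ _)))

-- The value 0 in degree 0 makes this y t/(1 - y t), the logarithmic derivative of 1/(1 - y t).
powers : ℚ → Series
powers y zero = 0ℚ
powers y (suc k) = powℚ y (suc k)

powerSums : List ℚ → Series
powerSums [] = const 0ℚ
powerSums (y ∷ Y) = powers y ⊕ powerSums Y

powerSums-0 : ∀ Y → powerSums Y 0 ≡ 0ℚ
powerSums-0 [] = refl
powerSums-0 (y ∷ Y) = trans (+-identityˡ (powerSums Y 0)) (powerSums-0 Y)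

-- -P(-t): passes from the logarithmic derivative of ∏ⱼ 1/(1 - yⱼ t) to that of ∏ⱼ (1 + yⱼ t).
signed : Series → Series
signed P k = - (powℚ -1ℚ k * P k)

-- `powℚ y`, read as a series, is 1/(1 - y t).
complete : List ℚ → Series
complete [] = const 1ℚ
complete (y ∷ Y) = powℚ y ⊛ complete Y

complete-0 : ∀ Y → complete Y 0 ≡ 1ℚ
complete-0 [] = refl
complete-0 (y ∷ Y) = trans (⊛-0 (powℚ y) (complete Y)) (trans (*-identityˡ (complete Y 0)) (complete-0 Y))

anti-const : ∀ n c → anti n (λ _ _ → c) ≡ ℕtoℚ (suc n) * c
anti-const zero c = trans (anti-0 _) (sym (*-identityˡ c))
anti-const (suc n) c =
  trans (anti-suc n _) (trans (cong (c +_) (anti-const n c))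
  (trans (solve 2 (λ c n → c :+ n :* c := (con 1ℚ :+ n) :* c) refl c (ℕtoℚ (suc n)))
  (cong (_* c) (sym (ℕtoℚ-suc (suc n))))))

powers-LogDer : ∀ y → LogDer (powℚ y) (powers y)
powers-LogDer y zero = sym (⊛-0 (powers y) (powℚ y))
powers-LogDer y (suc n) = sym (begin
  (powers y ⊛ powℚ y) (suc n) ≡⟨ ⊛-suc (powers y) (powℚ y) n ⟩
  0ℚ * powℚ y (suc n) + anti n (λ i j → powℚ y (suc i) * powℚ y j)
    ≡⟨ cong₂ _+_ (*-zeroˡ (powℚ y (suc n)))
    (anti-cong≡ n (λ i j e → trans (sym (pow-+ y (suc i) j)) (cong (λ z → powℚ y (suc z)) e))) ⟩
  0ℚ + anti n (λ _ _ → powℚ y (suc n)) ≡⟨ trans (+-identityˡ _) (anti-const n _) ⟩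
  ℕtoℚ (suc n) * powℚ y (suc n) ∎)

const-LogDer : LogDer (const 1ℚ) (const 0ℚ)
const-LogDer n = trans (h n) (sym (const-⊛ 0ℚ (const 1ℚ) n))
  where
  h : ∀ n → θ (const 1ℚ) n ≡ 0ℚ * const 1ℚ n
  h zero = refl
  h (suc n) = trans (*-zeroʳ (ℕtoℚ (suc n))) (sym (*-zeroˡ 0ℚ))

complete-LogDer : ∀ Y → LogDer (complete Y) (powerSums Y)
complete-LogDer [] = const-LogDer
complete-LogDer (y ∷ Y) = LogDer-⊛ {powℚ y} {complete Y} {powers y} {powerSums Y} (powers-LogDer y)
  (complete-LogDer Y)

linear-LogDer : ∀ y → LogDer (linear y) (signed (powers y))
linear-LogDer y n = trans (h n) (sym (trans (⊛-comm P (linear y) n) (linear-⊛ y P n)))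
  where
  P = signed (powers y)
  lin : ∀ n → linear y n ≡ const 1ℚ n + y * t n
  lin n = cong (const 1ℚ n +_) (const-⊛ y t n)
  h : ∀ n → θ (linear y) n ≡ P n + y * (t ⊛ P) n
  h zero = trans (*-zeroˡ (linear y 0))
    (sym (trans (cong (λ z → 0ℚ + y * z) (t-⊛-0 P)) (trans (+-identityˡ (y * 0ℚ)) (*-zeroʳ y))))
  h (suc zero) = trans (cong (1ℚ *_) (lin 1))
    (trans (solve 1 (λ y → con 1ℚ :* (con 0ℚ :+ y :* con 1ℚ) := :- (con -1ℚ :* con 1ℚ :* (y :* con 1ℚ)) :+ y :* con
    0ℚ) refl y) (cong (λ z → P 1 + y * z) (sym (t-⊛-suc P 0))))
  h (suc (suc n)) = begin
    ℕtoℚ (suc (suc n)) * linear y (suc (suc n))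
      ≡⟨ cong (ℕtoℚ (suc (suc n)) *_) (trans (lin (suc (suc n))) (trans (+-identityˡ (y * 0ℚ)) (*-zeroʳ y))) ⟩
    ℕtoℚ (suc (suc n)) * 0ℚ
      ≡⟨ solve 4 (λ k y s p → k :* con 0ℚ := :- (con -1ℚ :* (con -1ℚ :* s) :* (y :* (y :* p))) :+ y :* :-
      (con -1ℚ :* s :* (y :* p))) refl (ℕtoℚ (suc (suc n))) y (powℚ -1ℚ n) (powℚ y n) ⟩
    P (suc (suc n)) + y * P (suc n) ≡⟨ cong (λ z → P (suc (suc n)) + y * z) (sym (t-⊛-suc P (suc n))) ⟩
    P (suc (suc n)) + y * (t ⊛ P) (suc (suc n)) ∎

elementary-LogDer : ∀ Y → LogDer (elementary Y) (signed (powerSums Y))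
elementary-LogDer [] n = trans (const-LogDer n) (⊛-congʳ (const 1ℚ) h n)
  where
  h : const 0ℚ ≈ signed (const 0ℚ)
  h zero = refl
  h (suc n) = sym (cong -_ (*-zeroʳ (powℚ -1ℚ (suc n))))
elementary-LogDer (y ∷ Y) n =
  trans (LogDer-⊛ {linear y} {elementary Y} {signed (powers y)} {signed (powerSums Y)} (linear-LogDer y)
  (elementary-LogDer Y) n)
  (⊛-congʳ (elementary (y ∷ Y)) (λ k → solve 3 (λ s p q → :- (s :* p) :+ :- (s :* q) := :- (s :* (p :+ q))) refl
    (powℚ -1ℚ k) (powers y k) (powerSums Y k)) n)

-- Coefficients of polynomials, Cauchy’s identity

shift-∑ₗ : ∀ {A : Set} k (xs : List A) (f : A → Series) n → shift k (λ n → ∑ₗ xs (λ x → f x n)) n ≡ ∑ₗ xs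
  (λ x → shift k (f x) n)
shift-∑ₗ zero xs f n = refl
shift-∑ₗ (suc k) xs f zero = sym (∑ₗ-zero xs (λ _ → refl))
shift-∑ₗ (suc k) xs f (suc n) = shift-∑ₗ k xs f n

shift-*ˡ : ∀ k c A n → shift k (λ n → c * A n) n ≡ c * shift k A n
shift-*ˡ zero c A n = refl
shift-*ˡ (suc k) c A zero = sym (*-zeroʳ c)
shift-*ˡ (suc k) c A (suc n) = shift-*ˡ k c A n

-- translate δ u α = u (α - δ), extended by 0 where α - δ is not defined.
translate : ∀ {N} → Vec ℕ N → (Vec ℕ N → ℚ) → Vec ℕ N → ℚ
translate [] u [] = u []
translate (d ∷ ds) u (a ∷ α) = shift d (λ a′ → translate ds (λ α′ → u (a′ ∷ α′)) α) a

translate-cong : ∀ {N} (ds : Vec ℕ N) {u v} α → (∀ α → u α ≡ v α) → translate ds u α ≡ translate ds v α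
translate-cong [] [] h = h []
translate-cong (d ∷ ds) (a ∷ α) h = shift-cong d (λ a′ → translate-cong ds α (λ α′ → h (a′ ∷ α′))) a

translate-∑ₗ : ∀ {N} {A : Set} (ds : Vec ℕ N) (xs : List A) (f : A → Vec ℕ N → ℚ) α →
  translate ds (λ α → ∑ₗ xs (λ x → f x α)) α ≡ ∑ₗ xs (λ x → translate ds (f x) α)
translate-∑ₗ [] xs f [] = refl
translate-∑ₗ (d ∷ ds) xs f (a ∷ α) = trans (shift-cong d (λ a′ → translate-∑ₗ ds xs (λ x α′ → f x (a′ ∷ α′)) α) a)
  (shift-∑ₗ d xs _ a)

translate-*ˡ : ∀ {N} (ds : Vec ℕ N) c u α → translate ds (λ α → c * u α) α ≡ c * translate ds u α
translate-*ˡ [] c u [] = refl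
translate-*ˡ (d ∷ ds) c u (a ∷ α) = trans (shift-cong d (λ a′ → translate-*ˡ ds c _ α) a) (shift-*ˡ d c _ a)

translate-null : ∀ {N} (ds : Vec ℕ N) α → translate ds (λ _ → 0ℚ) α ≡ 0ℚ
translate-null [] [] = refl
translate-null (d ∷ ds) (a ∷ α) = shift-null d (λ _ → translate-null ds α) a

translate-shift : ∀ {N} (ds : Vec ℕ N) e (f : ℕ → Vec ℕ N → ℚ) n α → translate ds (λ α → shift e (λ m → f m α) n) α ≡
  shift e (λ m → translate ds (f m) α) n
translate-shift ds zero f n α = refl
translate-shift ds (suc e) f zero α = translate-null ds α
translate-shift ds (suc e) f (suc n) α = translate-shift ds e f n α

translate-comm : ∀ {N} (ds es : Vec ℕ N) u α → translate ds (translate es u) α ≡ translate es (translate ds u) α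
translate-comm [] [] u [] = refl
translate-comm (d ∷ ds) (e ∷ es) u (a ∷ α) = begin
  shift d (λ a′ → translate ds (λ α′ → shift e (λ b → translate es (λ γ → u (b ∷ γ)) α′) a′) α) a
    ≡⟨ shift-cong d (λ a′ → trans (translate-shift ds e _ a′ α) (shift-cong e (λ b → translate-comm ds es _ α) a′))
      a ⟩
  shift d (shift e (λ b → translate es (translate ds (λ γ → u (b ∷ γ))) α)) a ≡⟨ shift-comm d e _ a ⟩
  shift e (shift d (λ b → translate es (translate ds (λ γ → u (b ∷ γ))) α)) a
    ≡⟨ shift-cong e (λ a′ → sym (translate-shift es d _ a′ α)) a ⟩
  shift e (λ a′ → translate es (λ α′ → shift d (λ b → translate ds (λ γ → u (b ∷ γ)) α′) a′) α) a ∎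

translate-0 : ∀ {N} (u : Vec ℕ N → ℚ) α → translate (replicate N 0) u α ≡ u α
translate-0 u [] = refl
translate-0 u (a ∷ α) = translate-0 (λ α′ → u (a ∷ α′)) α

[_≟ᵥ_] : ∀ {N} → Vec ℕ N → Vec ℕ N → ℚ
[ x ≟ᵥ y ] = if ⌊ Vecₚ.≡-dec ℕ._≟_ x y ⌋ then 1ℚ else 0ℚ

≟ᵥ-≡ : ∀ {N} (x : Vec ℕ N) → [ x ≟ᵥ x ] ≡ 1ℚ
≟ᵥ-≡ x = cong (if_then 1ℚ else 0ℚ) (⌊⌋-true (Vecₚ.≡-dec ℕ._≟_ x x) refl)

≟ᵥ-≢ : ∀ {N} {x y : Vec ℕ N} → x ≢ y → [ x ≟ᵥ y ] ≡ 0ℚ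
≟ᵥ-≢ {x = x} {y} h = cong (if_then 1ℚ else 0ℚ) (⌊⌋-false (Vecₚ.≡-dec ℕ._≟_ x y) h)

≟ᵥ-∷ : ∀ {N} x y (xs ys : Vec ℕ N) → [ x ∷ xs ≟ᵥ y ∷ ys ] ≡ δ x y * [ xs ≟ᵥ ys ]
≟ᵥ-∷ x y xs ys = by-cases (x ℕ.≟ y) (Vecₚ.≡-dec ℕ._≟_ xs ys)
  where
  by-cases : Dec (x ≡ y) → Dec (xs ≡ ys) → [ x ∷ xs ≟ᵥ y ∷ ys ] ≡ δ x y * [ xs ≟ᵥ ys ]
  by-cases (yes refl) (yes refl) = trans (≟ᵥ-≡ (x ∷ xs)) (sym (cong₂ _*_ (δ-≡ x) (≟ᵥ-≡ xs)))
  by-cases (yes refl) (no h) = trans (≟ᵥ-≢ (λ { refl → h refl })) (sym (cong₂ _*_ (δ-≡ x) (≟ᵥ-≢ h)))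
  by-cases (no h) _ = trans (≟ᵥ-≢ (λ { refl → h refl })) (sym (≡0-* ([ xs ≟ᵥ ys ]) (δ-≢ h)))

δ-shift : ∀ d e a → δ (d ℕ.+ e) a ≡ shift d (δ e) a
δ-shift zero e a = refl
δ-shift (suc d) e zero = refl
δ-shift (suc d) e (suc a) = δ-shift d e a

≟ᵥ-translate : ∀ {N} (ds es α : Vec ℕ N) → [ zipWith ℕ._+_ ds es ≟ᵥ α ] ≡ translate ds ([ es ≟ᵥ_]) α
≟ᵥ-translate [] [] [] = refl
≟ᵥ-translate (d ∷ ds) (e ∷ es) (a ∷ α) = begin
  [ d ℕ.+ e ∷ zipWith ℕ._+_ ds es ≟ᵥ a ∷ α ] ≡⟨ ≟ᵥ-∷ (d ℕ.+ e) a _ α ⟩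
  δ (d ℕ.+ e) a * [ zipWith ℕ._+_ ds es ≟ᵥ α ] ≡⟨ cong₂ _*_ (δ-shift d e a) (≟ᵥ-translate ds es α) ⟩
  shift d (δ e) a * X ≡⟨ *-comm (shift d (δ e) a) X ⟩
  X * shift d (δ e) a ≡⟨ sym (shift-*ˡ d X (δ e) a) ⟩
  shift d (λ a′ → X * δ e a′) a
    ≡⟨ shift-cong d (λ a′ → trans (*-comm X (δ e a′))
    (trans (sym (translate-*ˡ ds (δ e a′) _ α)) (translate-cong ds α (λ α′ → sym (≟ᵥ-∷ e a′ es α′))))) a ⟩
  shift d (λ a′ → translate ds (λ α′ → [ e ∷ es ≟ᵥ a′ ∷ α′ ]) α) a ∎
  where X = translate ds ([ es ≟ᵥ_]) α

coeff≡∑ₗ : ∀ {N} (P : Poly N) α → coeff P α ≡ ∑ₗ P (λ s → proj₁ s * [ proj₂ s ≟ᵥ α ])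
coeff≡∑ₗ [] α = refl
coeff≡∑ₗ ((c , x) ∷ P) α with Vecₚ.≡-dec ℕ._≟_ x α
... | yes _ = cong₂ _+_ (sym (*-identityʳ c)) (coeff≡∑ₗ P α)
... | no _ = trans (coeff≡∑ₗ P α) (sym (≡0-+ (∑ₗ P (λ s → proj₁ s * [ proj₂ s ≟ᵥ α ])) (*-zeroʳ c)))

coeff-++ : ∀ {N} (P Q : Poly N) α → coeff (P ++ Q) α ≡ coeff P α + coeff Q α
coeff-++ P Q α = trans (coeff≡∑ₗ (P ++ Q) α) (trans (∑ₗ-++ _ P Q) (sym (cong₂ _+_ (coeff≡∑ₗ P α) (coeff≡∑ₗ Q α))))

coeff-scale : ∀ {N} c (P : Poly N) α → coeff (scaleP c P) α ≡ c * coeff P α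
coeff-scale c P α = begin
  coeff (scaleP c P) α ≡⟨ trans (coeff≡∑ₗ (scaleP c P) α) (∑ₗ-map _ _ P) ⟩
  ∑ₗ P (λ s → c * proj₁ s * [ proj₂ s ≟ᵥ α ]) ≡⟨ ∑ₗ-cong P (λ s → *-assoc c (proj₁ s) [ proj₂ s ≟ᵥ α ]) ⟩
  ∑ₗ P (λ s → c * (proj₁ s * [ proj₂ s ≟ᵥ α ])) ≡⟨ ∑ₗ-*ˡ c _ P ⟩
  c * ∑ₗ P (λ s → proj₁ s * [ proj₂ s ≟ᵥ α ]) ≡⟨ cong (c *_) (sym (coeff≡∑ₗ P α)) ⟩
  c * coeff P α ∎

coeff-sumP : ∀ {N} {A : Set} (f : A → Poly N) xs α → coeff (sumP (map f xs)) α ≡ ∑ₗ xs (λ x → coeff (f x) α)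
coeff-sumP f [] α = refl
coeff-sumP f (x ∷ xs) α = trans (coeff-++ (f x) _ α) (cong (coeff (f x) α +_) (coeff-sumP f xs α))

-- Multiplication by `P` on coefficient functions. In this form the second factor may be given by a
-- formula, as `coefficients` is, and not only by a list of terms.
act : ∀ {N} → Poly N → (Vec ℕ N → ℚ) → Vec ℕ N → ℚ
act P u α = ∑ₗ P (λ s → proj₁ s * translate (proj₂ s) u α)

coeff-* : ∀ {N} (P Q : Poly N) α → coeff (P *P Q) α ≡ act P (coeff Q) α
coeff-* P Q α = begin
  coeff (P *P Q) α ≡⟨ trans (coeff≡∑ₗ (P *P Q) α) (∑ₗ-concatMap _ _ P) ⟩
  ∑ₗ P (λ s → ∑ₗ (map (λ t → proj₁ s * proj₁ t , zipWith ℕ._+_ (proj₂ s) (proj₂ t)) Q)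
    (λ s → proj₁ s * [ proj₂ s ≟ᵥ α ]))
    ≡⟨ ∑ₗ-cong P (λ s → trans (∑ₗ-map _ _ Q)
      (trans (∑ₗ-cong Q (λ t → trans (*-assoc (proj₁ s) (proj₁ t) _)
      (cong (λ z → proj₁ s * (proj₁ t * z)) (≟ᵥ-translate (proj₂ s) (proj₂ t) α))))
      (trans (∑ₗ-*ˡ (proj₁ s) _ Q) (cong (proj₁ s *_) (inner s))))) ⟩
  act P (coeff Q) α ∎
  where
  inner : ∀ s → ∑ₗ Q (λ t → proj₁ t * translate (proj₂ s) ([ proj₂ t ≟ᵥ_]) α) ≡ translate (proj₂ s) (coeff Q) α
  inner s = trans (∑ₗ-cong Q (λ t → sym (translate-*ˡ (proj₂ s) (proj₁ t) _ α)))
    (trans (sym (translate-∑ₗ (proj₂ s) Q _ α)) (translate-cong (proj₂ s) α (λ α′ → sym (coeff≡∑ₗ Q α′))))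

act-cong : ∀ {N} (P : Poly N) {u v} α → (∀ α → u α ≡ v α) → act P u α ≡ act P v α
act-cong P α h = ∑ₗ-cong P (λ s → cong (proj₁ s *_) (translate-cong (proj₂ s) α h))

act-*ˡ : ∀ {N} (P : Poly N) c u α → act P (λ α → c * u α) α ≡ c * act P u α
act-*ˡ P c u α = trans
  (∑ₗ-cong P (λ s → trans (cong (proj₁ s *_) (translate-*ˡ (proj₂ s) c u α))
  (solve 3 (λ a c x → a :* (c :* x) := c :* (a :* x)) refl (proj₁ s) c (translate (proj₂ s) u α)))) (∑ₗ-*ˡ c _ P)

act-∑ₗ : ∀ {N} {A : Set} (P : Poly N) (xs : List A) (f : A → Vec ℕ N → ℚ) α →
  act P (λ α → ∑ₗ xs (λ x → f x α)) α ≡ ∑ₗ xs (λ x → act P (f x) α)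
act-∑ₗ P xs f α = trans
  (∑ₗ-cong P (λ s → trans (cong (proj₁ s *_) (translate-∑ₗ (proj₂ s) xs f α)) (sym (∑ₗ-*ˡ (proj₁ s) _ xs))))
  (∑ₗ-swap _ P xs)

act-shift : ∀ {N} (P : Poly N) k (f : ℕ → Vec ℕ N → ℚ) n α → act P (λ α → shift k (λ m → f m α) n) α ≡ shift k
  (λ m → act P (f m) α) n
act-shift P k f n α =
  trans (∑ₗ-cong P (λ s → trans (cong (proj₁ s *_) (translate-shift (proj₂ s) k f n α))
  (sym (shift-*ˡ k (proj₁ s) _ n)))) (sym (shift-∑ₗ k P _ n))

act-comm : ∀ {N} (P Q : Poly N) u α → act P (act Q u) α ≡ act Q (act P u) α
act-comm P Q u α = begin
  act P (act Q u) α ≡⟨ act-∑ₗ P Q _ α ⟩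
  ∑ₗ Q (λ t → act P (λ α → proj₁ t * translate (proj₂ t) u α) α)
    ≡⟨ ∑ₗ-cong Q (λ t → act-*ˡ P (proj₁ t) (translate (proj₂ t) u) α) ⟩
  ∑ₗ Q (λ t → proj₁ t * act P (translate (proj₂ t) u) α)
    ≡⟨ ∑ₗ-cong Q (λ t → cong (proj₁ t *_)
    (∑ₗ-cong P (λ s → cong (proj₁ s *_) (translate-comm (proj₂ s) (proj₂ t) u α)))) ⟩
  ∑ₗ Q (λ t → proj₁ t * ∑ₗ P (λ s → proj₁ s * translate (proj₂ t) (translate (proj₂ s) u) α))
    ≡⟨ ∑ₗ-cong Q (λ t → cong (proj₁ t *_)
      (trans (∑ₗ-cong P (λ s → sym (translate-*ˡ (proj₂ t) (proj₁ s) _ α))) (sym (translate-∑ₗ (proj₂ t) P _ α)))) ⟩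
  act Q (act P u) α ∎

∑ₗ-expVecs-suc : ∀ N k (f : Vec ℕ (suc N) → ℚ) → ∑ₗ (expVecs (suc N) k) f ≡ anti k
  (λ a j → ∑ₗ (expVecs N j) (f ∘ (a ∷_)))
∑ₗ-expVecs-suc N k f = begin
  ∑ₗ (expVecs (suc N) k) f ≡⟨ ∑ₗ-concatMap (λ a → map (a ∷_) (expVecs N (k ∸ a))) f (upTo (suc k)) ⟩
  ∑ₗ (upTo (suc k)) (λ a → ∑ₗ (map (a ∷_) (expVecs N (k ∸ a))) f) ≡⟨ ∑ₗ-upTo (suc k) _ ⟩
  ∑ (suc k) (λ a → ∑ₗ (map (a ∷_) (expVecs N (k ∸ a))) f)
    ≡⟨ ∑-cong (suc k) (λ a → ∑ₗ-map (a ∷_) f (expVecs N (k ∸ a))) ⟩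
  ∑ (suc k) (λ a → ∑ₗ (expVecs N (k ∸ a)) (f ∘ (a ∷_))) ≡⟨ anti-∑ k (λ a j → ∑ₗ (expVecs N j) (f ∘ (a ∷_))) ⟩
  anti k (λ a j → ∑ₗ (expVecs N j) (f ∘ (a ∷_))) ∎

act-completeH : ∀ {N} k (u : Vec ℕ N → ℚ) α → act (completeH N k) u α ≡ ∑ₗ (expVecs N k) (λ ds → translate ds u α)
act-completeH {N} k u α = trans (∑ₗ-map _ _ (expVecs N k))
  (∑ₗ-cong (expVecs N k) (λ ds → *-identityˡ (translate ds u α)))

act-completeH-0 : ∀ {N} (u : Vec ℕ N → ℚ) α → act (completeH N 0) u α ≡ u α
act-completeH-0 {N} u α = trans (act-completeH 0 u α) (go N u α)
  where
  go : ∀ N (u : Vec ℕ N → ℚ) α → ∑ₗ (expVecs N 0) (λ ds → translate ds u α) ≡ u α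
  go zero u [] = +-identityʳ (u [])
  go (suc N) u (a ∷ α) = trans (∑ₗ-expVecs-suc N 0 _) (trans (anti-0 _) (go N (λ α′ → u (a ∷ α′)) α))

-- hCoeff α β is the number of nonnegative integer matrices with row sums β and column sums α.
hCoeff : ∀ {N} → Vec ℕ N → List ℕ → ℚ
hCoeff α β = coeff h[ β ] α

hCoeff-∷ : ∀ {N} (α : Vec ℕ N) k β → hCoeff α (k ∷ β) ≡ act (completeH N k) (λ α → hCoeff α β) α
hCoeff-∷ {N} α k β = coeff-* (completeH N k) h[ β ] α

-- Multiplication is commutative and h₀ = 1. This is the symmetry that `Φ-monomial` requires when
-- Cauchy's sum over exponent lists is regrouped by partitions.
hCoeff-resp : ∀ {N} (α : Vec ℕ N) → Respects (hCoeff α)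
hCoeff-resp α nil = refl
hCoeff-resp {N} α (cons~ x {xs} {ys} h) = trans (hCoeff-∷ α x xs)
  (trans (act-cong (completeH N x) α (λ α → hCoeff-resp α h)) (sym (hCoeff-∷ α x ys)))
hCoeff-resp {N} α (swap~ x y zs) = begin
  hCoeff α (x ∷ y ∷ zs) ≡⟨ trans (hCoeff-∷ α x (y ∷ zs)) (act-cong (completeH N x) α (λ α → hCoeff-∷ α y zs)) ⟩
  act (completeH N x) (act (completeH N y) (λ α → hCoeff α zs)) α ≡⟨ act-comm (completeH N x) (completeH N y) _ α ⟩
  act (completeH N y) (act (completeH N x) (λ α → hCoeff α zs)) α
    ≡⟨ sym (trans (hCoeff-∷ α y (x ∷ zs)) (act-cong (completeH N y) α (λ α → hCoeff-∷ α x zs))) ⟩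
  hCoeff α (y ∷ x ∷ zs) ∎
hCoeff-resp α (drop0 xs) = trans (hCoeff-∷ α 0 xs) (act-completeH-0 _ α)
hCoeff-resp α (trans~ h k) = trans (hCoeff-resp α h) (hCoeff-resp α k)

-- coefficients H n α is the coefficient of x^α in the part of degree n of ∏ᵢ H(xᵢ).
coefficients : ∀ {N} → Series → ℕ → Vec ℕ N → ℚ
coefficients H n [] = const 1ℚ n
coefficients H n (a ∷ α) = H a * shift a (λ m → coefficients H m α) n

anti-shift : ∀ n k (f : ℕ → Series) → anti n (λ i j → shift k (f i) j) ≡ shift k (λ m → anti m f) n
anti-shift n zero f = refl
anti-shift zero (suc k) f = anti-0 _
anti-shift (suc n) (suc k) f = trans (anti-sucʳ n _) (trans (+-identityʳ _) (anti-shift n k f))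

-- Both sides sum `f b a′ r` subject to `b + a′ = a` and `b + r = n`.
shift-anti-swap : ∀ n a (f : ℕ → ℕ → ℕ → ℚ) → anti n (λ b r → shift b (λ a′ → f b a′ r) a) ≡ anti a
  (λ b a′ → shift b (f b a′) n)
shift-anti-swap zero zero f = trans (anti-0 _) (sym (anti-0 _))
shift-anti-swap zero (suc a) f =
  trans (anti-0 _) (sym (trans (anti-suc a _) (+-≡0 (f 0 (suc a) 0) (anti-zero a (λ _ _ _ → refl)))))
shift-anti-swap (suc n) zero f =
  trans (anti-suc n _) (trans (+-≡0 (f 0 0 (suc n)) (anti-zero n (λ _ _ _ → refl))) (sym (anti-0 _)))
shift-anti-swap (suc n) (suc a) f =
  trans (anti-suc n _) (trans (cong (f 0 (suc a) (suc n) +_) (shift-anti-swap n a (f ∘ suc))) (sym (anti-suc a _)))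

-- The exponent `a` of one variable is split as `b + a′` between a new factor `P` and `H`; either
-- way degree n - a is left for the remaining variables.
coefficients-fold : ∀ P H Z n a → anti n (λ b r → P b * shift b (λ a′ → H a′ * shift a′ Z r) a) ≡
  (P ⊛ H) a * shift a Z n
coefficients-fold P H Z n a = begin
  anti n (λ b r → P b * shift b (λ a′ → H a′ * shift a′ Z r) a) ≡⟨ anti-cong n (λ b r → sym (shift-*ˡ b (P b) _ a)) ⟩
  anti n (λ b r → shift b (λ a′ → P b * (H a′ * shift a′ Z r)) a)
    ≡⟨ shift-anti-swap n a (λ b a′ r → P b * (H a′ * shift a′ Z r)) ⟩
  anti a (λ b a′ → shift b (λ r → P b * (H a′ * shift a′ Z r)) n) ≡⟨ anti-cong≡ a fold ⟩
  anti a (λ b a′ → P b * H a′ * shift a Z n) ≡⟨ anti-*ʳ a (shift a Z n) _ ⟩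
  (P ⊛ H) a * shift a Z n ∎
  where
  fold : ∀ b a′ → b ℕ.+ a′ ≡ a → shift b (λ r → P b * (H a′ * shift a′ Z r)) n ≡ P b * H a′ * shift a Z n
  fold b a′ e = begin
    shift b (λ r → P b * (H a′ * shift a′ Z r)) n
      ≡⟨ trans (shift-*ˡ b (P b) _ n) (cong (P b *_) (shift-*ˡ b (H a′) _ n)) ⟩
    P b * (H a′ * shift b (shift a′ Z) n)
      ≡⟨ cong (λ z → P b * (H a′ * z)) (trans (shift-shift b a′ Z n) (cong (λ k → shift k Z n) e)) ⟩
    P b * (H a′ * shift a Z n) ≡⟨ sym (*-assoc (P b) (H a′) _) ⟩
    P b * H a′ * shift a Z n ∎

-- Since ∑ₖ yᵏ hₖ(x) = ∏ᵢ 1/(1 - xᵢ y), multiplication by it multiplies each factor H(xᵢ) by a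
-- geometric series. The induction on the variables splits k = b + j between the first variable and
-- the others.
coefficients-⊛ : ∀ {N} y H n (α : Vec ℕ N) →
  anti n (λ k m → powℚ y k * ∑ₗ (expVecs N k) (λ ds → translate ds (coefficients H m) α)) ≡ coefficients
  (powℚ y ⊛ H) n α
coefficients-⊛ y H zero [] = trans (anti-0 _) refl
coefficients-⊛ y H (suc n) [] =
  trans (anti-suc n _) (cong₂ _+_ refl (anti-zero n (λ k m _ → *-zeroʳ (powℚ y (suc k)))))
coefficients-⊛ {suc N} y H n (a ∷ α) = begin
  anti n (λ k m → powℚ y k * ∑ₗ (expVecs (suc N) k) (λ ds → translate ds (coefficients H m) (a ∷ α)))
    ≡⟨ anti-cong n (λ k m → trans (cong (powℚ y k *_) (∑ₗ-expVecs-suc N k _)) (sym (anti-*ˡ k (powℚ y k) _))) ⟩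
  anti n (λ k m → anti k (λ b j → powℚ y k * X b j m))
    ≡⟨ anti-cong n (λ k m →
    anti-cong≡ k (λ b j e → trans (cong (λ z → powℚ y z * X b j m) (sym e))
    (trans (cong (_* X b j m) (pow-+ y b j)) (*-assoc (powℚ y b) (powℚ y j) _)))) ⟩
  anti n (λ k m → anti k (λ b j → powℚ y b * (powℚ y j * X b j m)))
    ≡⟨ anti-assoc n (λ b j m → powℚ y b * (powℚ y j * X b j m)) ⟩
  anti n (λ b r → anti r (λ j m → powℚ y b * (powℚ y j * X b j m)))
    ≡⟨ anti-cong n (λ b r → trans (anti-*ˡ r (powℚ y b) _) (cong (powℚ y b *_) (inner b r))) ⟩
  anti n (λ b r → powℚ y b * shift b (λ a′ → H a′ * shift a′ Z r) a) ≡⟨ coefficients-fold (powℚ y) H Z n a ⟩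
  (powℚ y ⊛ H) a * shift a Z n ∎
  where
  Z : Series
  Z r = coefficients (powℚ y ⊛ H) r α
  T : ℕ → ℕ → ℚ
  T j i = ∑ₗ (expVecs N j) (λ ds → translate ds (coefficients H i) α)
  X : ℕ → ℕ → ℕ → ℚ
  X b j m = ∑ₗ (expVecs N j) (λ ds → translate (b ∷ ds) (coefficients H m) (a ∷ α))
  X≡ : ∀ b j m → X b j m ≡ shift b (λ a′ → H a′ * shift a′ (T j) m) a
  X≡ b j m = trans (sym (shift-∑ₗ b (expVecs N j) _ a))
    (shift-cong b (λ a′ →
    trans (∑ₗ-cong (expVecs N j)
    (λ ds → trans (translate-*ˡ ds (H a′) _ α) (cong (H a′ *_) (translate-shift ds a′ (λ i → coefficients H i) m α))))
    (trans (∑ₗ-*ˡ (H a′) _ (expVecs N j)) (cong (H a′ *_) (sym (shift-∑ₗ a′ (expVecs N j) _ m))))) a)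
  inner : ∀ b r → anti r (λ j m → powℚ y j * X b j m) ≡ shift b (λ a′ → H a′ * shift a′ Z r) a
  inner b r = begin
    anti r (λ j m → powℚ y j * X b j m)
      ≡⟨ anti-cong r (λ j m → trans (cong (powℚ y j *_) (X≡ b j m)) (sym (shift-*ˡ b (powℚ y j) _ a))) ⟩
    anti r (λ j m → shift b (λ a′ → powℚ y j * (H a′ * shift a′ (T j) m)) a) ≡⟨ shift-anti b r _ a ⟩
    shift b (λ a′ → anti r (λ j m → powℚ y j * (H a′ * shift a′ (T j) m))) a ≡⟨ shift-cong b (λ a′ → begin
      anti r (λ j m → powℚ y j * (H a′ * shift a′ (T j) m))
        ≡⟨ anti-cong r (λ j m →
        trans (solve 3 (λ p h s → p :* (h :* s) := h :* (p :* s)) refl (powℚ y j) (H a′) (shift a′ (T j) m))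
        (cong (H a′ *_) (sym (shift-*ˡ a′ (powℚ y j) (T j) m)))) ⟩
      anti r (λ j m → H a′ * shift a′ (λ i → powℚ y j * T j i) m) ≡⟨ anti-*ˡ r (H a′) _ ⟩
      H a′ * anti r (λ j m → shift a′ (λ i → powℚ y j * T j i) m) ≡⟨ cong (H a′ *_) (anti-shift r a′ _) ⟩
      H a′ * shift a′ (λ r′ → anti r′ (λ j i → powℚ y j * T j i)) r
        ≡⟨ cong (H a′ *_) (shift-cong a′ (λ r′ → coefficients-⊛ y H r′ α) r) ⟩
      H a′ * shift a′ Z r ∎) a ⟩
    shift b (λ a′ → H a′ * shift a′ Z r) a ∎
    where
    shift-anti : ∀ k n (f : ℕ → ℕ → Series) x → anti n (λ i j → shift k (f i j) x) ≡ shift k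
      (λ x → anti n (λ i j → f i j x)) x
    shift-anti zero n f x = refl
    shift-anti (suc k) n f zero = anti-null n
    shift-anti (suc k) n f (suc x) = shift-anti k n f x

Φ-shift : ∀ Y m k (g : List ℕ → Series) n → Φ Y m (λ β → shift k (g β) n) ≡ shift k (λ n → Φ Y m (λ β → g β n)) n
Φ-shift Y m zero g n = refl
Φ-shift Y m (suc k) g zero = Φ-zero Y m (λ _ _ → refl)
Φ-shift Y m (suc k) g (suc n) = Φ-shift Y m k g n

Φ-translate : ∀ {N} Y m (ds : Vec ℕ N) (w : List ℕ → Vec ℕ N → ℚ) α →
  Φ Y m (λ β → translate ds (w β) α) ≡ translate ds (λ α → Φ Y m (λ β → w β α)) α
Φ-translate Y m [] w [] = refl
Φ-translate Y m (d ∷ ds) w (a ∷ α) = trans (Φ-shift Y m d _ a) (shift-cong d (λ a′ → Φ-translate Y m ds _ α) a)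

one-coefficients : ∀ {N} H → H 0 ≡ 1ℚ → (α : Vec ℕ N) → coeff oneP α ≡ coefficients H 0 α
one-coefficients {N} H h α = trans (coeff≡∑ₗ oneP α) (trans (+-identityʳ _) (trans (*-identityˡ _) (go α)))
  where
  go : ∀ {N} (α : Vec ℕ N) → [ replicate N 0 ≟ᵥ α ] ≡ coefficients H 0 α
  go [] = refl
  go {suc N} (zero ∷ α) = trans (≟ᵥ-∷ 0 0 (replicate N 0) α) (cong₂ _*_ (sym h) (go α))
  go {suc N} (suc a ∷ α) = trans (≟ᵥ-∷ 0 (suc a) (replicate N 0) α)
    (trans (*-zeroˡ [ replicate N 0 ≟ᵥ α ]) (sym (*-zeroʳ (H (suc a)))))

one-coefficients-suc : ∀ {N} n (α : Vec ℕ N) → coefficients (const 1ℚ) (suc n) α ≡ 0ℚ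
one-coefficients-suc n [] = refl
one-coefficients-suc n (zero ∷ α) = trans (*-identityˡ _) (one-coefficients-suc n α)
one-coefficients-suc n (suc a ∷ α) = *-zeroˡ (shift (suc a) (λ m → coefficients (const 1ℚ) m α) (suc n))

-- ∑_β y^β h_β(x) = ∏ᵢ ∏ⱼ 1 / (1 - xᵢ yⱼ), in degree n and at the monomial x^α.
Cauchy : ∀ {N} Y n (α : Vec ℕ N) → Φ Y n (hCoeff α) ≡ coefficients (complete Y) n α
Cauchy [] zero α = one-coefficients (const 1ℚ) refl α
Cauchy [] (suc n) α = sym (one-coefficients-suc n α)
Cauchy {N} (y ∷ Y) n α = trans (anti-cong n (λ k m → cong (powℚ y k *_) (begin
  Φ Y m (λ β → hCoeff α (k ∷ β)) ≡⟨ Φ-cong Y m (λ β → trans (hCoeff-∷ α k β) (act-completeH k _ α)) ⟩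
  Φ Y m (λ β → ∑ₗ (expVecs N k) (λ ds → translate ds (λ α → hCoeff α β) α)) ≡⟨ Φ-∑ₗ Y m (expVecs N k) _ ⟩
  ∑ₗ (expVecs N k) (λ ds → Φ Y m (λ β → translate ds (λ α → hCoeff α β) α))
    ≡⟨ ∑ₗ-cong (expVecs N k)
    (λ ds → trans (Φ-translate Y m ds (λ β α → hCoeff α β) α) (translate-cong ds α (λ α → Cauchy Y m α))) ⟩
  ∑ₗ (expVecs N k) (λ ds → translate ds (coefficients (complete Y) m) α) ∎))) (coefficients-⊛ y (complete Y) n α)

-- The power sum expansion

mult-∷ : ∀ j x xs → mult j (x ∷ xs) ≡ mult j (x ∷ []) ℕ.+ mult j xs
mult-∷ j x xs = by-cases (x ℕ.≟ j)
  where
  by-cases : Dec (x ≡ j) → mult j (x ∷ xs) ≡ mult j (x ∷ []) ℕ.+ mult j xs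
  by-cases (yes refl) = trans (mult-≡ j xs) (cong (ℕ._+ mult j xs) (sym (mult-≡ j [])))
  by-cases (no h) = trans (mult-≢ xs h) (cong (ℕ._+ mult j xs) (sym (mult-≢ [] h)))

mult-ins : ∀ j k xs → mult j (ins k xs) ≡ mult j (k ∷ xs)
mult-ins j k [] = refl
mult-ins j k (x ∷ xs) with x ≤? k
... | yes _ = refl
... | no _ = begin
  mult j (x ∷ ins k xs)
    ≡⟨ trans (mult-∷ j x (ins k xs)) (cong (mult j (x ∷ []) ℕ.+_) (trans (mult-ins j k xs) (mult-∷ j k xs))) ⟩
  mult j (x ∷ []) ℕ.+ (mult j (k ∷ []) ℕ.+ mult j xs)
    ≡⟨ trans (sym (ℕₚ.+-assoc (mult j (x ∷ [])) _ _))
    (trans (cong (ℕ._+ mult j xs) (ℕₚ.+-comm (mult j (x ∷ [])) _)) (ℕₚ.+-assoc (mult j (k ∷ [])) _ _)) ⟩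
  mult j (k ∷ []) ℕ.+ (mult j (x ∷ []) ℕ.+ mult j xs)
    ≡⟨ sym (trans (mult-∷ j k (x ∷ xs)) (cong (mult j (k ∷ []) ℕ.+_) (mult-∷ j x xs))) ⟩
  mult j (k ∷ x ∷ xs) ∎

mult-single : ∀ i k → ℕtoℚ (mult i (k ∷ [])) ≡ δ i k
mult-single i k = by-cases (k ℕ.≟ i)
  where
  by-cases : Dec (k ≡ i) → ℕtoℚ (mult i (k ∷ [])) ≡ δ i k
  by-cases (yes refl) = trans (cong ℕtoℚ (mult-≡ i [])) (sym (δ-≡ i))
  by-cases (no h) = trans (cong ℕtoℚ (mult-≢ [] h)) (sym (δ-≢ (≢-sym h)))

∑-δ : ∀ B k (f : ℕ → ℚ) → k ℕ.< B → ∑ B (λ i → f i * δ i k) ≡ f k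
∑-δ (suc B) zero f l =
  trans (∑-suc B _) (trans (cong₂ _+_ (*-identityʳ (f 0)) (trans (∑-*ʳ0 B) refl)) (+-identityʳ (f 0)))
  where
  ∑-*ʳ0 : ∀ B → ∑ B (λ i → f (suc i) * 0ℚ) ≡ 0ℚ
  ∑-*ʳ0 B = trans (∑-cong B (λ i → *-comm (f (suc i)) 0ℚ)) (trans (∑-*ˡ B 0ℚ (f ∘ suc)) (*-zeroˡ (∑ B (f ∘ suc))))
∑-δ (suc B) (suc k) f (s≤s l) =
  trans (∑-suc B _) (trans (cong₂ _+_ (*-zeroʳ (f 0)) (∑-δ B k (f ∘ suc) l)) (+-identityˡ (f (suc k))))

∑-parts : ∀ {b n λ′} B → b ℕ.≤ B → Part b n λ′ → ∑ B (λ i → ℕtoℚ (suc i) * ℕtoℚ (mult (suc i) λ′)) ≡ ℕtoℚ n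
∑-parts B l [] = trans (∑-cong B (λ i → trans (*-zeroʳ (ℕtoℚ (suc i))) (sym (*-zeroˡ 0ℚ))))
  (trans (∑-*ˡ B 0ℚ (λ _ → 0ℚ)) (*-zeroˡ (∑ B (λ _ → 0ℚ))))
∑-parts B l (cons {k = k} {m} {λ′} h p) = begin
  ∑ B (λ i → ℕtoℚ (suc i) * ℕtoℚ (mult (suc i) (suc k ∷ λ′)))
    ≡⟨ ∑-cong B (λ i → trans
      (cong (ℕtoℚ (suc i) *_)
      (trans (cong ℕtoℚ (mult-∷ (suc i) (suc k) λ′))
      (trans (ℕtoℚ-+ (mult (suc i) (suc k ∷ [])) (mult (suc i) λ′))
      (cong (_+ ℕtoℚ (mult (suc i) λ′)) (mult-single (suc i) (suc k))))))
      (*-distribˡ-+ (ℕtoℚ (suc i)) (δ i k) (ℕtoℚ (mult (suc i) λ′)))) ⟩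
  ∑ B (λ i → ℕtoℚ (suc i) * δ i k + ℕtoℚ (suc i) * ℕtoℚ (mult (suc i) λ′)) ≡⟨ ∑-+ B _ _ ⟩
  ∑ B (λ i → ℕtoℚ (suc i) * δ i k) + ∑ B (λ i → ℕtoℚ (suc i) * ℕtoℚ (mult (suc i) λ′))
    ≡⟨ cong₂ _+_ (∑-δ B k (λ i → ℕtoℚ (suc i)) (ℕₚ.≤-trans h l)) (∑-parts B (ℕₚ.≤-trans h l) p) ⟩
  ℕtoℚ (suc k) + ℕtoℚ m ≡⟨ sym (ℕtoℚ-+ (suc k) m) ⟩
  ℕtoℚ (suc k ℕ.+ m) ∎

∑-shift : ∀ B n (A : ℕ → Series) → n ℕ.< B → ∑ B (λ i → shift i (A i) n) ≡ anti n A
∑-shift (suc B) zero A l =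
  trans (∑-suc B _) (trans (cong (A 0 0 +_) (∑0 B)) (trans (+-identityʳ (A 0 0)) (sym (anti-0 A))))
  where
  ∑0 : ∀ B → ∑ B (λ i → 0ℚ) ≡ 0ℚ
  ∑0 B = trans (∑-cong B (λ _ → sym (*-zeroˡ 0ℚ))) (trans (∑-*ˡ B 0ℚ (λ _ → 0ℚ)) (*-zeroˡ (∑ B (λ _ → 0ℚ))))
∑-shift (suc B) (suc n) A (s≤s l) =
  trans (∑-suc B _) (trans (cong (A 0 (suc n) +_) (∑-shift B n (A ∘ suc) l)) (sym (anti-suc n A)))

∣a∣ : ℕ → ℚ
∣a∣ k = ∣ coeffA k ∣

weightFactor : ℕ → ℕ → ℚ
weightFactor k m = recipℕ (m !) * powℚ (∣a∣ k) m

-- The coefficient of p_λ in exp ∑_{k ≤ B} |aₖ| pₖ. The bound `B` is separate from the size of the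
-- partition because the induction in `weighted-sum` lowers the size while `B` stays fixed.
weight : ℕ → List ℕ → ℚ
weight B λ′ = prodℚ (applyUpTo (λ i → weightFactor (suc i) (mult (suc i) λ′)) B)

∣pow∣ : ∀ x m → ∣ powℚ x m ∣ ≡ powℚ ∣ x ∣ m
∣pow∣ x zero = refl
∣pow∣ x (suc m) = trans (∣p*q∣≡∣p∣*∣q∣ x (powℚ x m)) (cong (∣ x ∣ *_) (∣pow∣ x m))

∣prod∣ : ∀ (f g : ℕ → ℚ) B → (∀ i → ∣ f i ∣ ≡ g i) → ∣ prodℚ (applyUpTo f B) ∣ ≡ prodℚ (applyUpTo g B)
∣prod∣ f g zero h = refl
∣prod∣ f g (suc B) h = trans (∣p*q∣≡∣p∣*∣q∣ (f 0) _) (cong₂ _*_ (h 0) (∣prod∣ (f ∘ suc) (g ∘ suc) B (h ∘ suc)))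

∣φ∣ : ∀ n λ′ → ∣ φ n λ′ ∣ ≡ ℕtoℚ ((2 ℕ.* n) !) * weight n λ′
∣φ∣ n λ′ = trans (∣p*q∣≡∣p∣*∣q∣ (ℕtoℚ ((2 ℕ.* n) !)) _) (cong₂ _*_ (0≤p⇒∣p∣≡p (0≤ℕtoℚ ((2 ℕ.* n) !)))
  (∣prod∣ _ _ n (λ i → trans (∣p*q∣≡∣p∣*∣q∣ (recipℕ (mult (suc i) λ′ !)) _)
    (cong₂ _*_ (0≤p⇒∣p∣≡p (0≤recip (mult (suc i) λ′ !))) (∣pow∣ (coeffA (suc i)) (mult (suc i) λ′))))))

prod-change : ∀ B k (f g : ℕ → ℚ) c d → k ℕ.< B → (∀ i → i ≢ k → f i ≡ g i) → c * f k ≡ d * g k →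
  c * prodℚ (applyUpTo f B) ≡ d * prodℚ (applyUpTo g B)
prod-change (suc B) zero f g c d l h e = begin
  c * (f 0 * prodℚ (applyUpTo (f ∘ suc) B)) ≡⟨ sym (*-assoc c (f 0) _) ⟩
  c * f 0 * prodℚ (applyUpTo (f ∘ suc) B) ≡⟨ cong₂ _*_ e (prod-cong B (λ i → h (suc i) (λ ()))) ⟩
  d * g 0 * prodℚ (applyUpTo (g ∘ suc) B) ≡⟨ *-assoc d (g 0) _ ⟩
  d * (g 0 * prodℚ (applyUpTo (g ∘ suc) B)) ∎
  where
  prod-cong : ∀ B {f g : ℕ → ℚ} → (∀ i → f i ≡ g i) → prodℚ (applyUpTo f B) ≡ prodℚ (applyUpTo g B)
  prod-cong zero h = refl
  prod-cong (suc B) h = cong₂ _*_ (h 0) (prod-cong B (h ∘ suc))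
prod-change (suc B) (suc k) f g c d (s≤s l) h e = begin
  c * (f 0 * F) ≡⟨ solve 3 (λ c x y → c :* (x :* y) := x :* (c :* y)) refl c (f 0) F ⟩
  f 0 * (c * F) ≡⟨ cong₂ _*_ (h 0 (λ ()))
    (prod-change B k (f ∘ suc) (g ∘ suc) c d l (λ i j → h (suc i) (j ∘ ℕₚ.suc-injective)) e) ⟩
  g 0 * (d * G) ≡⟨ solve 3 (λ c x y → x :* (c :* y) := c :* (x :* y)) refl d (g 0) G ⟩
  d * (g 0 * G) ∎
  where
  F = prodℚ (applyUpTo (f ∘ suc) B)
  G = prodℚ (applyUpTo (g ∘ suc) B)

-- Differentiation of the exponential: m aᵐ/m! = a · aᵐ⁻¹/(m-1)! in the factor of the inserted part,
-- the other factors being unchanged.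
weight-ins : ∀ B k λ′ → k ℕ.< B → ℕtoℚ (mult (suc k) (ins (suc k) λ′)) * weight B (ins (suc k) λ′) ≡ ∣a∣
  (suc k) * weight B λ′
weight-ins B k λ′ l = prod-change B k (λ i → weightFactor (suc i) (mult (suc i) (ins K λ′)))
  (λ i → weightFactor (suc i) (mult (suc i) λ′)) (ℕtoℚ (mult K (ins K λ′))) (∣a∣ K) l
  (λ i i≢k → cong (weightFactor (suc i))
    (trans (mult-ins (suc i) (suc k) λ′) (mult-≢ λ′ (λ e → i≢k (sym (ℕₚ.suc-injective e))))))
  (begin
    ℕtoℚ (mult K (ins K λ′)) * weightFactor K (mult K (ins K λ′))
      ≡⟨ cong (λ m → ℕtoℚ m * weightFactor K m) (trans (mult-ins K K λ′) (mult-≡ K λ′)) ⟩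
    ℕtoℚ (suc m) * (invfac (suc m) * (∣a∣ K * powℚ (∣a∣ K) m))
      ≡⟨ solve 4 (λ n i a p → n :* (i :* (a :* p)) := a :* ((n :* i) :* p)) refl (ℕtoℚ (suc m)) (invfac (suc m))
      (∣a∣ K) (powℚ (∣a∣ K) m) ⟩
    ∣a∣ K * (ℕtoℚ (suc m) * invfac (suc m) * powℚ (∣a∣ K) m)
      ≡⟨ cong (λ z → ∣a∣ K * (z * powℚ (∣a∣ K) m)) (invfac-suc m) ⟩
    ∣a∣ K * weightFactor K m ∎)
  where
  K = suc k
  m = mult K λ′

pCoeff : ∀ {N} → Vec ℕ N → List ℕ → ℚ
pCoeff α β = coeff p[ β ] α

pCoeff-∷ : ∀ {N} (α : Vec ℕ N) k β → pCoeff α (k ∷ β) ≡ act (powerSum N k) (λ α → pCoeff α β) α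
pCoeff-∷ {N} α k β = coeff-* (powerSum N k) p[ β ] α

pCoeff-ins : ∀ {N} (α : Vec ℕ N) k β → pCoeff α (ins k β) ≡ act (powerSum N k) (λ α → pCoeff α β) α
pCoeff-ins {N} α k [] = pCoeff-∷ α k []
pCoeff-ins {N} α k (x ∷ xs) with x ≤? k
... | yes _ = pCoeff-∷ α k (x ∷ xs)
... | no _ = begin
  pCoeff α (x ∷ ins k xs) ≡⟨ trans (pCoeff-∷ α x (ins k xs)) (act-cong (powerSum N x) α (λ α → pCoeff-ins α k xs)) ⟩
  act (powerSum N x) (act (powerSum N k) (λ α → pCoeff α xs)) α ≡⟨ act-comm (powerSum N x) (powerSum N k) _ α ⟩
  act (powerSum N k) (act (powerSum N x) (λ α → pCoeff α xs)) α
    ≡⟨ act-cong (powerSum N k) α (λ α → sym (pCoeff-∷ α x xs)) ⟩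
  act (powerSum N k) (λ α → pCoeff α (x ∷ xs)) α ∎

unit : ∀ {N} → ℕ → Fin N → Vec ℕ N
unit k i = Vec.tabulate (λ j → if ⌊ i Fin.≟ j ⌋ then k else 0)

unit-zero : ∀ {N} k → unit {suc N} k Fin.zero ≡ k ∷ replicate N 0
unit-zero {N} k = cong (k ∷_) (zeros N)
  where
  zeros : ∀ N → Vec.tabulate {n = N} (λ _ → 0) ≡ replicate N 0
  zeros zero = refl
  zeros (suc N) = cong (0 ∷_) (zeros N)

unit-suc : ∀ {N} k (i : Fin N) → unit k (Fin.suc i) ≡ 0 ∷ unit k i
unit-suc k i = cong (0 ∷_) (Vecₚ.tabulate-cong (λ j → cong (λ z → if z then k else 0) (by-cases j (i Fin.≟ j))))
  where
  by-cases : ∀ j → Dec (i ≡ j) → ⌊ Fin.suc i Fin.≟ Fin.suc j ⌋ ≡ ⌊ i Fin.≟ j ⌋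
  by-cases j (yes refl) = trans (⌊⌋-true (Fin.suc i Fin.≟ Fin.suc j) refl) (sym (⌊⌋-true (i Fin.≟ j) refl))
  by-cases j (no h) = trans (⌊⌋-false (Fin.suc i Fin.≟ Fin.suc j) (λ { refl → h refl }))
    (sym (⌊⌋-false (i Fin.≟ j) h))

act-powerSum : ∀ {N} k (u : Vec ℕ N → ℚ) α → act (powerSum N k) u α ≡ ∑ₗ (allFin N) (λ i → translate (unit k i) u α)
act-powerSum {N} k u α = trans (∑ₗ-map _ _ (allFin N))
  (∑ₗ-cong (allFin N) (λ i → *-identityˡ (translate (unit k i) u α)))

act-powerSum-suc : ∀ {N} k (u : Vec ℕ (suc N) → ℚ) x α → act (powerSum (suc N) k) u (x ∷ α) ≡ shift k
  (λ x′ → u (x′ ∷ α)) x + act (powerSum N k) (λ α′ → u (x ∷ α′)) α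
act-powerSum-suc {N} k u x α = begin
  act (powerSum (suc N) k) u (x ∷ α) ≡⟨ act-powerSum k u (x ∷ α) ⟩
  translate (unit k Fin.zero) u (x ∷ α) + ∑ₗ (tabulate Fin.suc) (λ i → translate (unit k i) u (x ∷ α))
    ≡⟨ cong₂ _+_ (trans (cong (λ z → translate z u (x ∷ α)) (unit-zero k))
      (shift-cong k (λ x′ → translate-0 (λ α′ → u (x′ ∷ α′)) α) x))
         (trans (cong (λ z → ∑ₗ z (λ i → translate (unit k i) u (x ∷ α))) (sym (map-tabulate id Fin.suc)))
           (trans (∑ₗ-map Fin.suc _ (allFin N))
           (∑ₗ-cong (allFin N) (λ i → cong (λ z → translate z u (x ∷ α)) (unit-suc k i))))) ⟩
  shift k (λ x′ → u (x′ ∷ α)) x + ∑ₗ (allFin N) (λ i → translate (unit k i) (λ α′ → u (x ∷ α′)) α)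
    ≡⟨ cong (shift k (λ x′ → u (x′ ∷ α)) x +_) (sym (act-powerSum k _ α)) ⟩
  shift k (λ x′ → u (x′ ∷ α)) x + act (powerSum N k) (λ α′ → u (x ∷ α′)) α ∎

θ-shift : ∀ k A n → ℕtoℚ n * shift k A n ≡ ℕtoℚ k * shift k A n + shift k (θ A) n
θ-shift zero A n = sym (≡0-+ (ℕtoℚ n * A n) (*-zeroˡ (A n)))
θ-shift (suc k) A zero = sym (trans (+-identityʳ _) (trans (*-zeroʳ (ℕtoℚ (suc k))) (sym (*-zeroˡ 0ℚ))))
θ-shift (suc k) A (suc n) = begin
  ℕtoℚ (suc n) * s ≡⟨ trans (cong (_* s) (ℕtoℚ-suc n))
    (solve 2 (λ n s → (con 1ℚ :+ n) :* s := s :+ n :* s) refl (ℕtoℚ n) s) ⟩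
  s + ℕtoℚ n * s ≡⟨ cong (s +_) (θ-shift k A n) ⟩
  s + (ℕtoℚ k * s + shift k (θ A) n)
    ≡⟨ trans (solve 3 (λ k s x → s :+ (k :* s :+ x) := (con 1ℚ :+ k) :* s :+ x) refl (ℕtoℚ k) s (shift k (θ A) n))
    (cong (λ z → z * s + shift k (θ A) n) (sym (ℕtoℚ-suc k))) ⟩
  ℕtoℚ (suc k) * s + shift k (θ A) n ∎
  where s = shift k A n

-- The degree operator multiplies ∏ᵢ H(xᵢ) by ∑ᵢ P(xᵢ) = ∑ₖ P k · pₖ(x). For H = 1/(1 - t) this is
-- Newton's identity n hₙ = ∑ pₖ hₙ₋ₖ.
coefficients-Euler : ∀ {N} P H → LogDer H P → ∀ n (α : Vec ℕ N) → ℕtoℚ n * coefficients H n α ≡ anti n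
  (λ k m → P k * act (powerSum N k) (coefficients H m) α)
coefficients-Euler P H ld n [] = trans (h n) (sym (anti-zero n (λ k m _ → *-zeroʳ (P k))))
  where
  h : ∀ n → ℕtoℚ n * const 1ℚ n ≡ 0ℚ
  h zero = refl
  h (suc n) = *-zeroʳ (ℕtoℚ (suc n))
coefficients-Euler {suc N} P H ld n (x ∷ α) = begin
  ℕtoℚ n * (H x * shift x Z n)
    ≡⟨ solve 3 (λ n h s → n :* (h :* s) := h :* (n :* s)) refl (ℕtoℚ n) (H x) (shift x Z n) ⟩
  H x * (ℕtoℚ n * shift x Z n) ≡⟨ cong (H x *_) (θ-shift x Z n) ⟩
  H x * (ℕtoℚ x * shift x Z n + shift x (θ Z) n)
    ≡⟨ solve 4 (λ h x s t → h :* (x :* s :+ t) := x :* h :* s :+ h :* t) refl (H x) (ℕtoℚ x) (shift x Z n)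
    (shift x (θ Z) n) ⟩
  θ H x * shift x Z n + H x * shift x (θ Z) n
    ≡⟨ cong₂ (λ u v → u * shift x Z n + H x * v) (ld x) (shift-cong x (λ r → coefficients-Euler P H ld r α) n) ⟩
  (P ⊛ H) x * shift x Z n + H x * shift x (λ r → anti r (λ k m → P k * X k m)) n
    ≡⟨ cong₂ _+_ (sym (coefficients-fold P H Z n x))
      (trans (cong (H x *_) (sym (anti-shift n x _))) (sym (anti-*ˡ n (H x) _))) ⟩
  anti n (λ k m → P k * shift k (λ x′ → H x′ * shift x′ Z m) x) + anti n (λ k m → H x * shift x (λ i → P k * X k i) m)
    ≡⟨ sym (anti-+ n _ _) ⟩
  anti n (λ k m → P k * shift k (λ x′ → H x′ * shift x′ Z m) x + H x * shift x (λ i → P k * X k i) m)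
    ≡⟨ anti-cong n (λ k m → sym (step k m)) ⟩
  anti n (λ k m → P k * act (powerSum (suc N) k) (coefficients H m) (x ∷ α)) ∎
  where
  Z : Series
  Z r = coefficients H r α
  X : ℕ → ℕ → ℚ
  X k m = act (powerSum N k) (coefficients H m) α
  step : ∀ k m → P k * act (powerSum (suc N) k) (coefficients H m) (x ∷ α) ≡ P k * shift k
    (λ x′ → H x′ * shift x′ Z m) x + H x * shift x (λ i → P k * X k i) m
  step k m = begin
    P k * act (powerSum (suc N) k) (coefficients H m) (x ∷ α)
      ≡⟨ cong (P k *_) (act-powerSum-suc k (coefficients H m) x α) ⟩
    P k * (s + act (powerSum N k) (λ α′ → H x * shift x (λ i → coefficients H i α′) m) α)
      ≡⟨ cong (λ z → P k * (s + z))
        (trans (act-*ˡ (powerSum N k) (H x) _ α)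
        (cong (H x *_) (act-shift (powerSum N k) x (λ i → coefficients H i) m α))) ⟩
    P k * (s + H x * shift x (X k) m)
      ≡⟨ solve 4 (λ p s h x → p :* (s :+ h :* x) := p :* s :+ h :* (p :* x)) refl (P k) s (H x) (shift x (X k) m) ⟩
    P k * s + H x * (P k * shift x (X k) m) ≡⟨ cong (λ z → P k * s + H x * z) (sym (shift-*ˡ x (P k) (X k) m)) ⟩
    P k * s + H x * shift x (λ i → P k * X k i) m ∎
    where s = shift k (λ x′ → H x′ * shift x′ Z m) x

-- sec √t, given by its constant term 1 and its logarithmic derivative.
secant : Series
secant = integrate pstar

pstar-0 : pstar 0 ≡ 0ℚ
pstar-0 = *-zeroˡ ∣ coeffA 0 ∣

-- The sum over partitions and ∏ᵢ sec √xᵢ obey the same recursion in the degree. For the product it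
-- is `coefficients-Euler`. For the sum, the factor n = ∑ i mᵢ is distributed over the part sizes,
-- and `partitionSum-ins` removes one part of the chosen size.
weighted-sum : ∀ {N} B n (α : Vec ℕ N) → n ℕ.≤ B → partitionSum B (λ λ′ → weight B λ′ * pCoeff α λ′) n ≡ coefficients
  secant n α
weighted-sum {N} B n α l = <-rec (λ n → ∀ α → n ℕ.≤ B → Z n α ≡ coefficients secant n α) step n α l
  where
  Z : ℕ → Vec ℕ N → ℚ
  Z n α = partitionSum B (λ λ′ → weight B λ′ * pCoeff α λ′) n
  prod-1 : ∀ B (f : ℕ → ℚ) → (∀ i → f i ≡ 1ℚ) → prodℚ (applyUpTo f B) ≡ 1ℚ
  prod-1 zero f h = refl
  prod-1 (suc B) f h = cong₂ _*_ (h 0) (prod-1 B (f ∘ suc) (h ∘ suc))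
  step : ∀ n → (∀ {m} → m ℕ.< n → ∀ α → m ℕ.≤ B → Z m α ≡ coefficients secant m α) → ∀ α → n ℕ.≤ B →
    Z n α ≡ coefficients secant n α
  step zero ih α _ = trans (+-identityʳ _)
    (trans (cong (_* pCoeff α []) (prod-1 B _ (λ _ → refl)))
    (trans (*-identityˡ (pCoeff α [])) (one-coefficients secant refl α)))
  step (suc n) ih α l = *-cancel-ℕ n (begin
    ℕtoℚ (suc n) * Z (suc n) α ≡⟨ sym (∑ₗ-*ˡ (ℕtoℚ (suc n)) _ (partsBounded (suc n) B (suc n))) ⟩
    partitionSum B (λ λ′ → ℕtoℚ (suc n) * W λ′) (suc n)
      ≡⟨ partitionSum-cong B (suc n)
      (λ λ′ p → trans (cong (_* W λ′) (sym (∑-parts B ℕₚ.≤-refl p)))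
      (trans (*-comm _ (W λ′)) (sym (∑-*ˡ B (W λ′) _)))) ⟩
    partitionSum B (λ λ′ → ∑ B (λ i → W λ′ * (ℕtoℚ (suc i) * ℕtoℚ (mult (suc i) λ′)))) (suc n)
      ≡⟨ sym (∑-∑ₗ B (partsBounded (suc n) B (suc n)) _) ⟩
    ∑ B (λ i → partitionSum B (λ λ′ → W λ′ * (ℕtoℚ (suc i) * ℕtoℚ (mult (suc i) λ′))) (suc n)) ≡⟨ ∑-cong< B term ⟩
    ∑ B (λ i → shift i (λ m → pstar (suc i) * act (powerSum N (suc i)) (coefficients secant m) α) n)
      ≡⟨ ∑-shift B n _ l ⟩
    anti n (λ i m → pstar (suc i) * act (powerSum N (suc i)) (coefficients secant m) α) ≡⟨ sym (+-identityˡ _) ⟩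
    0ℚ + anti n (λ i m → pstar (suc i) * act (powerSum N (suc i)) (coefficients secant m) α)
      ≡⟨ cong (_+ anti n (λ i m → pstar (suc i) * act (powerSum N (suc i)) (coefficients secant m) α))
        (sym (≡0-* X0 pstar-0)) ⟩
    pstar 0 * X0 + anti n (λ i m → pstar (suc i) * act (powerSum N (suc i)) (coefficients secant m) α)
      ≡⟨ sym (anti-suc n (λ k m → pstar k * act (powerSum N k) (coefficients secant m) α)) ⟩
    anti (suc n) (λ k m → pstar k * act (powerSum N k) (coefficients secant m) α)
      ≡⟨ sym (coefficients-Euler pstar secant (integrate-LogDer pstar pstar-0) (suc n) α) ⟩
    ℕtoℚ (suc n) * coefficients secant (suc n) α ∎)
    where
    W : List ℕ → ℚ
    W λ′ = weight B λ′ * pCoeff α λ′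
    X0 = act (powerSum N 0) (coefficients secant (suc n)) α
    term : ∀ i → i ℕ.< B → partitionSum B (λ λ′ → W λ′ * (ℕtoℚ (suc i) * ℕtoℚ (mult (suc i) λ′))) (suc n) ≡ shift i
      (λ m → pstar (suc i) * act (powerSum N (suc i)) (coefficients secant m) α) n
    term i i<B = trans (partitionSum-ins B i F i<B vanishes (suc n)) (shift-cong-≤ i n inner)
      where
      F : List ℕ → ℚ
      F λ′ = W λ′ * (ℕtoℚ (suc i) * ℕtoℚ (mult (suc i) λ′))
      vanishes : Vanishes (suc i) F
      vanishes λ′ e = trans (cong (λ z → W λ′ * (ℕtoℚ (suc i) * ℕtoℚ z)) e) (*-≡0 (W λ′) (*-zeroʳ (ℕtoℚ (suc i))))
      inner : ∀ m → m ℕ.≤ n → partitionSum B (F ∘ ins (suc i)) m ≡ pstar (suc i) * act (powerSum N (suc i))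
        (coefficients secant m) α
      inner m m≤n = begin
        partitionSum B (F ∘ ins (suc i)) m ≡⟨ ∑ₗ-cong (partsBounded m B m) (λ λ′ → begin
          weight B (ins (suc i) λ′) * pCoeff α (ins (suc i) λ′) *
            (ℕtoℚ (suc i) * ℕtoℚ (mult (suc i) (ins (suc i) λ′)))
            ≡⟨ solve 4 (λ w p i m → w :* p :* (i :* m) := i :* (m :* w) :* p) refl (weight B (ins (suc i) λ′))
              (pCoeff α (ins (suc i) λ′)) (ℕtoℚ (suc i)) (ℕtoℚ (mult (suc i) (ins (suc i) λ′))) ⟩
          ℕtoℚ (suc i) * (ℕtoℚ (mult (suc i) (ins (suc i) λ′)) * weight B (ins (suc i) λ′)) * pCoeff α
            (ins (suc i) λ′)
            ≡⟨ cong₂ (λ u v → ℕtoℚ (suc i) * u * v) (weight-ins B i λ′ i<B) (pCoeff-ins α (suc i) λ′) ⟩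
          ℕtoℚ (suc i) * (∣a∣ (suc i) * weight B λ′) * act (powerSum N (suc i)) (λ α → pCoeff α λ′) α
            ≡⟨ solve 4 (λ i a w x → i :* (a :* w) :* x := i :* a :* (w :* x)) refl (ℕtoℚ (suc i)) (∣a∣ (suc i))
              (weight B λ′) (act (powerSum N (suc i)) (λ α → pCoeff α λ′) α) ⟩
          pstar (suc i) * (weight B λ′ * act (powerSum N (suc i)) (λ α → pCoeff α λ′) α)
            ≡⟨ cong (pstar (suc i) *_) (sym (act-*ˡ (powerSum N (suc i)) (weight B λ′) _ α)) ⟩
          pstar (suc i) * act (powerSum N (suc i)) (λ α → weight B λ′ * pCoeff α λ′) α ∎) ⟩
        ∑ₗ (partsBounded m B m) (λ λ′ → pstar (suc i) * act (powerSum N (suc i)) (λ α → weight B λ′ * pCoeff α λ′) α)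
          ≡⟨ ∑ₗ-*ˡ (pstar (suc i)) _ (partsBounded m B m) ⟩
        pstar (suc i) * ∑ₗ (partsBounded m B m) (λ λ′ → act (powerSum N (suc i)) (λ α → weight B λ′ * pCoeff α λ′) α)
          ≡⟨ cong (pstar (suc i) *_) (sym (act-∑ₗ (powerSum N (suc i)) (partsBounded m B m) _ α)) ⟩
        pstar (suc i) * act (powerSum N (suc i)) (Z m) α
          ≡⟨ cong (pstar (suc i) *_)
          (act-cong (powerSum N (suc i)) α (λ α → ih (s≤s m≤n) α (ℕₚ.≤-trans m≤n (ℕₚ.≤-trans (ℕₚ.n≤1+n n) l)))) ⟩
        pstar (suc i) * act (powerSum N (suc i)) (coefficients secant m) α ∎

coeff-scaledA : ∀ n N α → coeff (scaledA n N) α ≡ ℕtoℚ ((2 ℕ.* n) !) * coefficients secant n α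
coeff-scaledA n N α = begin
  coeff (scaledA n N) α ≡⟨ coeff-sumP (λ λ′ → scaleP ∣ φ n λ′ ∣ p[ λ′ ]) (partitions n) α ⟩
  ∑ₗ (partitions n) (λ λ′ → coeff (scaleP ∣ φ n λ′ ∣ p[ λ′ ]) α)
    ≡⟨ ∑ₗ-cong (partitions n)
    (λ λ′ → trans (coeff-scale ∣ φ n λ′ ∣ p[ λ′ ] α)
    (trans (cong (_* pCoeff α λ′) (∣φ∣ n λ′)) (*-assoc (ℕtoℚ ((2 ℕ.* n) !)) (weight n λ′) (pCoeff α λ′)))) ⟩
  ∑ₗ (partitions n) (λ λ′ → ℕtoℚ ((2 ℕ.* n) !) * (weight n λ′ * pCoeff α λ′))
    ≡⟨ ∑ₗ-*ˡ (ℕtoℚ ((2 ℕ.* n) !)) _ (partitions n) ⟩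
  ℕtoℚ ((2 ℕ.* n) !) * ∑ₗ (partitions n) (λ λ′ → weight n λ′ * pCoeff α λ′)
    ≡⟨ cong (ℕtoℚ ((2 ℕ.* n) !) *_) (weighted-sum n n α ℕₚ.≤-refl) ⟩
  ℕtoℚ ((2 ℕ.* n) !) * coefficients secant n α ∎

-- Limits of rational sequences

-- Convergence to a known rational limit at the rate 1/M. This rate survives sums and products with
-- explicit constants, so that no ε is quantified over.
record Conv (f : ℕ → ℚ) (L : ℚ) : Set where
  constructor within
  field
    constant : ℚ
    bound : ∀ M → ℕtoℚ (suc M) * ∣ f M - L ∣ ≤ constant

Conv-0≤ : ∀ {f L} (c : Conv f L) → 0ℚ ≤ Conv.constant c
Conv-0≤ {f} {L} (within C h) = ≤-trans (*-nonNeg (0≤ℕtoℚ 1) (0≤∣p∣ (f 0 - L))) (h 0)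

Conv-cong : ∀ {f g L K} → (∀ M → f M ≡ g M) → L ≡ K → Conv f L → Conv g K
Conv-cong {L = L} e refl (within C h) = within C λ M → subst (λ z → ℕtoℚ (suc M) * ∣ z - L ∣ ≤ C) (e M) (h M)

Conv-const : ∀ c → Conv (λ _ → c) c
Conv-const c = within 0ℚ λ M →
  ≤-reflexive (trans (cong (λ z → ℕtoℚ (suc M) * ∣ z ∣) (+-inverseʳ c)) (*-zeroʳ (ℕtoℚ (suc M))))

Conv-+ : ∀ {f g L K} → Conv f L → Conv g K → Conv (λ M → f M + g M) (L + K)
Conv-+ {f} {g} {L} {K} (within C h) (within D k) = within (C + D) λ M →
  ≤-trans (*-monoˡ (0≤ℕtoℚ (suc M))
    (≤-trans (≤-reflexive
    (cong ∣_∣ (solve 4 (λ f g l k → f :+ g :- (l :+ k) := (f :- l) :+ (g :- k)) refl (f M) (g M) L K)))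
    (∣p+q∣≤∣p∣+∣q∣ (f M - L) (g M - K))))
    (≤-trans (≤-reflexive (*-distribˡ-+ (ℕtoℚ (suc M)) (∣ f M - L ∣) (∣ g M - K ∣))) (+-mono-≤ (h M) (k M)))

1≤ℕtoℚ : ∀ M → 1ℚ ≤ ℕtoℚ (suc M)
1≤ℕtoℚ M = ℕtoℚ-mono {1} {suc M} (s≤s z≤n)

Conv-bound : ∀ {f L} (c : Conv f L) M → ∣ f M ∣ ≤ Conv.constant c + ∣ L ∣
Conv-bound {f} {L} (within C h) M =
  ≤-trans (≤-reflexive (cong ∣_∣ (solve 2 (λ f l → f := (f :- l) :+ l) refl (f M) L)))
  (≤-trans (∣p+q∣≤∣p∣+∣q∣ (f M - L) L)
    (+-monoˡ-≤ ∣ L ∣ (≤-trans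
    (≤-trans (≤-reflexive (sym (*-identityˡ ∣ f M - L ∣))) (*-monoʳ (0≤∣p∣ (f M - L)) (1≤ℕtoℚ M))) (h M))))

Conv-* : ∀ {f g L K} → Conv f L → Conv g K → Conv (λ M → f M * g M) (L * K)
Conv-* {f} {g} {L} {K} c@(within C h) d@(within D k) = within (C * (D + ∣ K ∣) + ∣ L ∣ * D) λ M →
  ≤-trans (*-monoˡ (0≤ℕtoℚ (suc M))
    (≤-trans (≤-reflexive
    (cong ∣_∣ (solve 4 (λ f g l k → f :* g :- l :* k := (f :- l) :* g :+ l :* (g :- k)) refl (f M) (g M) L K)))
      (≤-trans (∣p+q∣≤∣p∣+∣q∣ ((f M - L) * g M) (L * (g M - K)))
        (≤-reflexive (cong₂ _+_ (∣p*q∣≡∣p∣*∣q∣ (f M - L) (g M)) (∣p*q∣≡∣p∣*∣q∣ L (g M - K)))))))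
    (≤-trans (≤-reflexive (solve 5 (λ n a b l d → n :* (a :* b :+ l :* d) := n :* a :* b :+ l :* (n :* d)) refl
      (ℕtoℚ (suc M)) (∣ f M - L ∣) (∣ g M ∣) (∣ L ∣) (∣ g M - K ∣)))
      (+-mono-≤ (*-mono (0≤∣p∣ (g M)) (Conv-0≤ {f} {L} c) (h M) (Conv-bound {g} {K} d M)) (*-monoˡ (0≤∣p∣ L) (k M))))

Conv-scale : ∀ c {f L} → Conv f L → Conv (λ M → c * f M) (c * L)
Conv-scale c {f} {L} = Conv-* (Conv-const c)

Conv-anti : ∀ n {f : ℕ → ℕ → ℕ → ℚ} {L : ℕ → ℕ → ℚ} → (∀ i j → i ℕ.+ j ≡ n → Conv (f i j) (L i j)) →
  Conv (λ M → anti n (λ i j → f i j M)) (anti n L)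
Conv-anti zero {f} {L} h = Conv-cong (λ M → sym (anti-0 (λ i j → f i j M))) (sym (anti-0 L)) (h 0 0 refl)
Conv-anti (suc n) {f} {L} h = Conv-cong (λ M → sym (anti-suc n (λ i j → f i j M))) (sym (anti-suc n L))
  (Conv-+ (h 0 (suc n) refl) (Conv-anti n (λ i j e → h (suc i) j (cong suc e))))

archimedean : ∀ q → ∃ λ N → q < ℕtoℚ (suc N)
archimedean q@(mkℚ n d _) =
  ℤ.∣ n ∣ , ≤-<-trans (toℚᵘ-cancel-≤
  (ℚᵘₚ.≤-trans (ℚᵘ.*≤* (bound n)) (ℚᵘₚ.≤-reflexive (ℚᵘₚ.≃-sym (/-num (ℤ.+ ℤ.∣ n ∣) 0)))))
  (subst₂ _<_ (+-identityˡ (ℕtoℚ ℤ.∣ n ∣)) (sym (ℕtoℚ-suc ℤ.∣ n ∣)) (+-monoˡ-< (ℕtoℚ ℤ.∣ n ∣) (0<ℕtoℚ 0)))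
  where
  bound : ∀ n → n ℤ.* ℤ.+ 1 ℤ.≤ ℤ.+ ℤ.∣ n ∣ ℤ.* ℤ.+ suc d
  bound (ℤ.+ m) = subst₂ ℤ._≤_ (sym (ℤₚ.*-identityʳ (ℤ.+ m))) (ℤₚ.pos-* m (suc d)) (ℤ.+≤+ (ℕₚ.m≤m*n m (suc d)))
  bound (ℤ.-[1+ m ]) = ℤ.-≤+

p≤∣p∣ : ∀ p → p ≤ ∣ p ∣
p≤∣p∣ p with ≤-total 0ℚ p
... | inj₁ h = ≤-reflexive (sym (0≤p⇒∣p∣≡p h))
... | inj₂ h = ≤-trans h (0≤∣p∣ p)

-p≤∣p∣ : ∀ p → - p ≤ ∣ p ∣
-p≤∣p∣ p = subst (- p ≤_) (∣-p∣≡∣p∣ p) (p≤∣p∣ (- p))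

bounded-multiples : ∀ C x → (∀ M → ℕtoℚ (suc M) * x ≤ C) → x ≤ 0ℚ
bounded-multiples C x bound with x ℚₚ.≤? 0ℚ
... | yes l = l
... | no ¬l = ⊥-elim (<-irrefl refl (<-≤-trans big (bound N)))
  where
  0<x : 0ℚ < x
  0<x = ≰⇒> ¬l
  x≢0 : NonZero x
  x≢0 = pos⇒nonZero x {{positive 0<x}}
  y : ℚ
  y = C * (1/ x) {{x≢0}}
  N = proj₁ (archimedean y)
  big : C < ℕtoℚ (suc N) * x
  big = subst (_< ℕtoℚ (suc N) * x) (trans (*-assoc C ((1/ x) {{x≢0}}) x) (*-≡1 C (*-inverseˡ x {{x≢0}})))
    (*-monoˡ-<-pos x {{positive 0<x}} (proj₂ (archimedean y)))

Conv-nonNeg : ∀ {f L} → Conv f L → (∀ M → 0ℚ ≤ f M) → 0ℚ ≤ L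
Conv-nonNeg {f} {L} (within C h) pos = subst (0ℚ ≤_) (solve 1 (λ l → :- :- l := l) refl L)
  (neg-antimono-≤ (bounded-multiples C (- L) (λ M →
  ≤-trans (*-monoˡ (0≤ℕtoℚ (suc M))
    (≤-trans (≤-reflexive (sym (+-identityˡ (- L)))) (≤-trans (+-monoˡ-≤ (- L) (pos M)) (p≤∣p∣ (f M - L))))) (h M))))

Conv-unique : ∀ {f L K} → Conv f L → Conv f K → L ≡ K
Conv-unique {f} {L} {K} c d = ≤-antisym (one c d) (one d c)
  where
  one : ∀ {L K} → Conv f L → Conv f K → L ≤ K
  one {L} {K} (within C h) (within D k) = subst₂ _≤_ (+-identityˡ L) (solve 2 (λ l k → (k :- l) :+ l := k) refl L K)
    (+-monoˡ-≤ L (subst (0ℚ ≤_) (solve 2 (λ l k → :- (l :- k) := k :- l) refl L K) (neg-antimono-≤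
    (bounded-multiples (C + D) (L - K)
      (λ M → ≤-trans (*-monoˡ (0≤ℕtoℚ (suc M))
      (≤-trans (≤-reflexive (solve 3 (λ f l k → l :- k := :- (f :- l) :+ (f :- k)) refl (f M) L K))
      (+-mono-≤ (-p≤∣p∣ (f M - L)) (p≤∣p∣ (f M - K)))))
      (≤-trans (≤-reflexive (*-distribˡ-+ (ℕtoℚ (suc M)) (∣ f M - L ∣) (∣ f M - K ∣))) (+-mono-≤ (h M) (k M))))))))

-- By `LogDer-step` each coefficient of `A` is a finite sum of products of coefficients of `P` and
-- earlier ones of `A`, so convergence passes from `P` to `A` degree by degree.
LogDer-Conv : ∀ {A P : ℕ → Series} {A∞ P∞ : Series} → (∀ M → P M 0 ≡ 0ℚ) → P∞ 0 ≡ 0ℚ →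
  (∀ M → A M 0 ≡ 1ℚ) → A∞ 0 ≡ 1ℚ →
  (∀ M → LogDer (A M) (P M)) → LogDer A∞ P∞ → (∀ n → Conv (λ M → P M n) (P∞ n)) → ∀ n → Conv (λ M → A M n) (A∞ n)
LogDer-Conv {A} {P} {A∞} {P∞} p0 p∞0 a0 a∞0 ld ld∞ c = <-rec _ step
  where
  step : ∀ n → (∀ {j} → j ℕ.< n → Conv (λ M → A M j) (A∞ j)) → Conv (λ M → A M n) (A∞ n)
  step zero ih = Conv-cong (λ M → sym (a0 M)) (sym a∞0) (Conv-const 1ℚ)
  step (suc n) ih = Conv-cong (λ M → value (A M) (P M) (p0 M) (ld M)) (value A∞ P∞ p∞0 ld∞)
    (Conv-scale (recipℕ (suc n)) {λ M → ((P M ∘ suc) ⊛ A M) n} {((P∞ ∘ suc) ⊛ A∞) n}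
      (Conv-anti n (λ i j e → Conv-* (c (suc i)) (ih (s≤s (≤-snd i j e))))))
    where
    value : ∀ A P → P 0 ≡ 0ℚ → LogDer A P → recipℕ (suc n) * ((P ∘ suc) ⊛ A) n ≡ A (suc n)
    value A P p l = trans (cong (recipℕ (suc n) *_) (sym (LogDer-step A P p l n)))
      (trans (sym (*-assoc (recipℕ (suc n)) (ℕtoℚ (suc n)) (A (suc n)))) (≡1-* (A (suc n)) (recip*ℕ n)))

-- The finite families 1/(2i+1)²

-- ρ j i = 1 / (j - i), with value 0 at j = i.
ρ : ℕ → ℕ → ℚ
ρ zero zero = 0ℚ
ρ zero (suc i) = - recipℕ (suc i)
ρ (suc j) zero = recipℕ (suc j)
ρ (suc j) (suc i) = ρ j i

ρ-diag : ∀ i → ρ i i ≡ 0ℚ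
ρ-diag zero = refl
ρ-diag (suc i) = ρ-diag i

ρ-antisym : ∀ i j → ρ i j ≡ - ρ j i
ρ-antisym zero zero = refl
ρ-antisym zero (suc j) = refl
ρ-antisym (suc i) zero = solve 1 (λ ξ → ξ := :- :- ξ) refl (recipℕ (suc i))
ρ-antisym (suc i) (suc j) = ρ-antisym i j

ρ-+ : ∀ i d → ρ (i ℕ.+ suc d) i ≡ recipℕ (suc d)
ρ-+ zero d = refl
ρ-+ (suc i) d = ρ-+ i d

ρ-reflect : ∀ a b c d → a ℕ.+ d ≡ c ℕ.+ b → ρ a b ≡ ρ c d
ρ-reflect zero zero c d e = trans (sym (ρ-diag d)) (cong (λ z → ρ z d) (trans e (ℕₚ.+-identityʳ c)))
ρ-reflect zero (suc b) c d e = sym (trans (ρ-antisym c d) (cong -_ (trans (cong (λ z → ρ z c) e) (ρ-+ c b))))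
ρ-reflect (suc a) zero c d e =
  sym (trans (cong (λ z → ρ z d) (trans (sym (ℕₚ.+-identityʳ c)) (trans (sym e) (ℕₚ.+-comm (suc a) d)))) (ρ-+ d a))
ρ-reflect (suc a) (suc b) c d e = ρ-reflect a b c d (ℕₚ.suc-injective (trans e (ℕₚ.+-suc c b)))

-- Partial sums of 1 / (j - i) - 1 / (i + j + 1) telescope in windows of length 2i + 1.
window : ℕ → ℕ → ℚ
window j i = ∑ (suc (i ℕ.+ i)) (λ r → ρ (j ℕ.+ r) i)

ξ : ℕ → ℚ
ξ i = recipℕ (suc (i ℕ.+ i))

ξ² : ℕ → ℚ
ξ² i = ξ i * ξ i

-- Consecutive windows differ only in their end points, and the index j + 2i + 1 lies at distance i
-- + j + 1 from i.
window-step : ∀ j i → ρ j i - recipℕ (suc (i ℕ.+ j)) ≡ window j i - window (suc j) i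
window-step j i = begin
  ρ j i - recipℕ (suc (i ℕ.+ j)) ≡⟨ cong (λ z → ρ j i - z) (sym end) ⟩
  ρ j i - ρ (j ℕ.+ suc m) i ≡⟨ solve 3 (λ a b s → a :- b := (a :+ s) :- (s :+ b)) refl (ρ j i) (ρ (j ℕ.+ suc m) i) s ⟩
  (ρ j i + s) - (s + ρ (j ℕ.+ suc m) i) ≡⟨ cong₂ _-_ first (sym last) ⟩
  window j i - window (suc j) i ∎
  where
  m = i ℕ.+ i
  s = ∑ m (λ r → ρ (j ℕ.+ suc r) i)
  end : ρ (j ℕ.+ suc m) i ≡ recipℕ (suc (i ℕ.+ j))
  end = trans (cong (λ z → ρ z i)
    (solveₙ 2 (λ i j → j +ₙ (conₙ 1 +ₙ (i +ₙ i)) =ₙ i +ₙ (conₙ 1 +ₙ (i +ₙ j))) refl i j)) (ρ-+ i (i ℕ.+ j))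
  first : ρ j i + s ≡ window j i
  first = sym (trans (∑-suc m (λ r → ρ (j ℕ.+ r) i)) (cong (λ z → ρ z i + s) (ℕₚ.+-identityʳ j)))
  last : window (suc j) i ≡ s + ρ (j ℕ.+ suc m) i
  last = trans (∑-cong (suc m) (λ r → cong (λ z → ρ z i) (sym (ℕₚ.+-suc j r)))) (∑-last m (λ r → ρ (j ℕ.+ suc r) i))

-- The indices 0, ..., 2i are symmetric about i, where `ρ` is odd.
window-0 : ∀ i → window 0 i ≡ 0ℚ
window-0 i = self-neg (begin
  window 0 i ≡⟨ anti-∑ m (λ r r′ → ρ r i) ⟩
  anti m (λ r r′ → ρ r i) ≡⟨ anti-cong≡ m (λ r r′ e → trans (ρ-reflect r i i r′ e) (ρ-antisym i r′)) ⟩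
  anti m (λ r r′ → - ρ r′ i) ≡⟨ anti-cong m (λ r r′ → solve 1 (λ ξ → :- ξ := con -1ℚ :* ξ) refl (ρ r′ i)) ⟩
  anti m (λ r r′ → -1ℚ * ρ r′ i) ≡⟨ anti-*ˡ m -1ℚ _ ⟩
  -1ℚ * anti m (λ r r′ → ρ r′ i) ≡⟨ cong (-1ℚ *_) (sym (anti-comm m (λ r r′ → ρ r i))) ⟩
  -1ℚ * anti m (λ r r′ → ρ r i) ≡⟨ cong (-1ℚ *_) (sym (anti-∑ m (λ r r′ → ρ r i))) ⟩
  -1ℚ * window 0 i ∎)
  where
  m = i ℕ.+ i
  self-neg : ∀ {w} → w ≡ -1ℚ * w → w ≡ 0ℚ
  self-neg {w} e = begin
    w ≡⟨ solve 1 (λ w → w := con ½ :* (w :+ w)) refl w ⟩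
    ½ * (w + w) ≡⟨ cong (λ z → ½ * (w + z)) e ⟩
    ½ * (w + -1ℚ * w) ≡⟨ solve 1 (λ w → con ½ :* (w :+ con -1ℚ :* w) := con 0ℚ) refl w ⟩
    0ℚ ∎

window-sum : ∀ n i → ∑ n (λ j → ρ j i - recipℕ (suc (i ℕ.+ j))) ≡ - window n i
window-sum n i = trans (go n) (trans (cong (_- window n i) (window-0 i)) (+-identityˡ (- window n i)))
  where
  go : ∀ n → ∑ n (λ j → ρ j i - recipℕ (suc (i ℕ.+ j))) ≡ window 0 i - window n i
  go zero = trans (∑-0 _) (sym (+-inverseʳ (window 0 i)))
  go (suc n) = trans (∑-last n _)
    (trans (cong₂ _+_ (go n) (window-step n i))
    (solve 3 (λ a b c → (a :- b) :+ (b :- c) := a :- c) refl (window 0 i) (window n i) (window (suc n) i)))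

¼ : ℚ
¼ = ½ * ½

-- κ i j = 1 / ((2j + 1)² - (2i + 1)²), with value 0 at i = j.
κ : ℕ → ℕ → ℚ
κ i j = ¼ * (ρ j i * recipℕ (suc (i ℕ.+ j)))

κ-antisym : ∀ i j → κ i j ≡ - κ j i
κ-antisym i j = trans (cong₂ (λ u v → ¼ * (u * recipℕ (suc v))) (ρ-antisym j i) (ℕₚ.+-comm i j))
  (solve 3 (λ q r s → q :* (:- r :* s) := :- (q :* (r :* s))) refl ¼ (ρ i j) (recipℕ (suc (j ℕ.+ i))))

κ-diag : ∀ i → κ i i ≡ 0ℚ
κ-diag i = trans (cong (λ z → ¼ * (z * ξ i)) (ρ-diag i)) (*-≡0 ¼ (*-zeroˡ (ξ i)))

odd : ℕ → ℚ
odd i = ℕtoℚ (suc (i ℕ.+ i))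

ξ*odd : ∀ i → ξ i * odd i ≡ 1ℚ
ξ*odd i = recip*ℕ (i ℕ.+ i)

ξ²*odd² : ∀ i → ξ² i * (odd i * odd i) ≡ 1ℚ
ξ²*odd² i = trans (solve 2 (λ ξ a → ξ :* ξ :* (a :* a) := (ξ :* a) :* (ξ :* a)) refl (ξ i) (odd i))
  (cong₂ _*_ (ξ*odd i) (ξ*odd i))

data Order (i : ℕ) : ℕ → Set where
  equal : Order i i
  above : ∀ d → Order i (i ℕ.+ suc d)
  below : ∀ d j → i ≡ j ℕ.+ suc d → Order i j

order : ∀ i j → Order i j
order i j with ℕₚ.<-cmp i j
... | tri≈ _ refl _ = equal
... | tri< l _ _ = subst (Order i) (trans (ℕₚ.+-suc i (j ∸ suc i)) (ℕₚ.m+[n∸m]≡n l)) (above (j ∸ suc i))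
... | tri> _ _ l = below (i ∸ suc j) j (sym (trans (ℕₚ.+-suc j (i ∸ suc j)) (ℕₚ.m+[n∸m]≡n l)))

-- 1/(ab) = (1/a - 1/b)/(b - a) for the odd squares a and b, where b - a = 4 (j - i)(i + j + 1).
ξ²*ξ²-above : ∀ i d → ξ² i * ξ² (i ℕ.+ suc d) ≡ κ i (i ℕ.+ suc d) * (ξ² i - ξ² (i ℕ.+ suc d))
ξ²*ξ²-above i d = sym (begin
  ¼ * (ρ j i * σ) * (ξ² i - ξ² j) ≡⟨ cong (λ z → ¼ * (z * σ) * (ξ² i - ξ² j)) (ρ-+ i d) ⟩
  ¼ * (η * σ) * (ξ² i - ξ² j)
    ≡⟨ cong₂ (λ u v → ¼ * (η * σ) * (u - v)) (expand (ξ² i) (ξ²*odd² j)) (expand (ξ² j) (ξ²*odd² i)) ⟩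
  ¼ * (η * σ) * (ξ² i * (ξ² j * (odd j * odd j)) - ξ² j * (ξ² i * (odd i * odd i)))
    ≡⟨ cong (λ z → ¼ * (η * σ) * (ξ² i * (ξ² j * z) - ξ² j * (ξ² i * (odd i * odd i)))) squares ⟩
  ¼ * (η * σ) * (ξ² i * (ξ² j * (odd i * odd i + ℕtoℚ 4 * (D * E))) - ξ² j * (ξ² i * (odd i * odd i)))
    ≡⟨ solve 7 (λ η σ u v o d e → con ¼ :* (η :* σ) :* (u :* (v :* (o :+ con (ℕtoℚ 4) :* (d :* e))) :- v :* (u :* o))
      := (η :* d) :* (σ :* e) :* (u :* v)) refl η σ (ξ² i) (ξ² j) (odd i * odd i) D E ⟩
  η * D * (σ * E) * (ξ² i * ξ² j) ≡⟨ cong₂ (λ u v → u * v * (ξ² i * ξ² j)) (recip*ℕ d) (recip*ℕ (i ℕ.+ j)) ⟩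
  1ℚ * 1ℚ * (ξ² i * ξ² j) ≡⟨ *-identityˡ (ξ² i * ξ² j) ⟩
  ξ² i * ξ² j ∎)
  where
  j = i ℕ.+ suc d
  η = recipℕ (suc d)
  σ = recipℕ (suc (i ℕ.+ j))
  D = ℕtoℚ (suc d)
  E = ℕtoℚ (suc (i ℕ.+ j))
  expand : ∀ u {w} → w ≡ 1ℚ → u ≡ u * w
  expand u refl = sym (*-identityʳ u)
  squares : odd j * odd j ≡ odd i * odd i + ℕtoℚ 4 * (D * E)
  squares = begin
    odd j * odd j ≡⟨ sym (ℕtoℚ-* (suc (j ℕ.+ j)) (suc (j ℕ.+ j))) ⟩
    ℕtoℚ (suc (j ℕ.+ j) ℕ.* suc (j ℕ.+ j)) ≡⟨ cong ℕtoℚ (solveₙ 2 (λ i d → let j = i +ₙ (conₙ 1 +ₙ d) in (conₙ 1 +ₙ (j +ₙ j)) *ₙ (conₙ 1 +ₙ (j +ₙ j)) =ₙ (conₙ 1 +ₙ (i +ₙ i)) *ₙ (conₙ 1 +ₙ (i +ₙ i)) +ₙ conₙ 4 *ₙ ((conₙ 1 +ₙ d) *ₙ (conₙ 1 +ₙ (i +ₙ j)))) refl i d) ⟩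
    ℕtoℚ (suc (i ℕ.+ i) ℕ.* suc (i ℕ.+ i) ℕ.+ 4 ℕ.* (suc d ℕ.* suc (i ℕ.+ j)))
      ≡⟨ trans (ℕtoℚ-+ (suc (i ℕ.+ i) ℕ.* suc (i ℕ.+ i)) (4 ℕ.* (suc d ℕ.* suc (i ℕ.+ j))))
        (cong₂ _+_ (ℕtoℚ-* (suc (i ℕ.+ i)) (suc (i ℕ.+ i)))
        (trans (ℕtoℚ-* 4 (suc d ℕ.* suc (i ℕ.+ j))) (cong (ℕtoℚ 4 *_) (ℕtoℚ-* (suc d) (suc (i ℕ.+ j)))))) ⟩
    odd i * odd i + ℕtoℚ 4 * (D * E) ∎

ξ²*ξ² : ∀ i j → i ≢ j → ξ² i * ξ² j ≡ κ i j * (ξ² i - ξ² j)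
ξ²*ξ² i j i≢j = by-cases j i≢j (order i j)
  where
  by-cases : ∀ {i} j → i ≢ j → Order i j → ξ² i * ξ² j ≡ κ i j * (ξ² i - ξ² j)
  by-cases j i≢j equal = ⊥-elim (i≢j refl)
  by-cases {i} _ i≢j (above d) = ξ²*ξ²-above i d
  by-cases {i} j i≢j (below d _ refl) = begin
    ξ² i * ξ² j ≡⟨ *-comm (ξ² i) (ξ² j) ⟩
    ξ² j * ξ² i ≡⟨ ξ²*ξ²-above j d ⟩
    κ j i * (ξ² j - ξ² i) ≡⟨ cong (_* (ξ² j - ξ² i)) (κ-antisym j i) ⟩
    - κ i j * (ξ² j - ξ² i) ≡⟨ solve 3 (λ k u v → :- k :* (v :- u) := k :* (u :- v)) refl (κ i j) (ξ² i) (ξ² j) ⟩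
    κ i j * (ξ² i - ξ² j) ∎

-- Partial fractions, from 2i + 1 = (i + j + 1) - (j - i). On the diagonal `κ` and `ρ` are 0 by
-- convention while 1/(i + j + 1) is not; the `δ`-term makes up for this.
κ-partial : ∀ i j → ℕtoℚ 4 * odd i * κ i j - ξ i * δ j i ≡ ρ j i - recipℕ (suc (i ℕ.+ j))
κ-partial i j = by-cases j (order i j)
  where
  by-cases : ∀ {i} j → Order i j → ℕtoℚ 4 * odd i * κ i j - ξ i * δ j i ≡ ρ j i - recipℕ (suc (i ℕ.+ j))
  by-cases {i} _ equal = begin
    ℕtoℚ 4 * odd i * κ i i - ξ i * δ i i ≡⟨ cong₂ (λ u v → ℕtoℚ 4 * odd i * u - ξ i * v) (κ-diag i) (δ-≡ i) ⟩
    ℕtoℚ 4 * odd i * 0ℚ - ξ i * 1ℚ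
      ≡⟨ solve 2 (λ o ξ → con (ℕtoℚ 4) :* o :* con 0ℚ :- ξ :* con 1ℚ := con 0ℚ :- ξ) refl (odd i) (ξ i) ⟩
    0ℚ - ξ i ≡⟨ cong (_- ξ i) (sym (ρ-diag i)) ⟩
    ρ i i - ξ i ∎
  by-cases {i} _ (above d) = begin
    ℕtoℚ 4 * odd i * κ i j′ - ξ i * δ j′ i
      ≡⟨ cong₂ (λ u v → ℕtoℚ 4 * odd i * (¼ * (u * σ)) - ξ i * v) (ρ-+ i d)
      (δ-≢ (λ e → ℕₚ.m≢1+m+n i (trans (sym e) (ℕₚ.+-suc i d)))) ⟩
    ℕtoℚ 4 * odd i * (¼ * (η * σ)) - ξ i * 0ℚ
      ≡⟨ solve 4 (λ o η σ ξ → con (ℕtoℚ 4) :* o :* (con ¼ :* (η :* σ)) :- ξ :* con 0ℚ := o :* (η :* σ)) refl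
      (odd i) η σ (ξ i) ⟩
    odd i * (η * σ) ≡⟨ cong (_* (η * σ))
      (trans (solve 2 (λ o d → o := (o :+ d) :- d) refl (odd i) D)
      (cong (_- D) (trans (sym (ℕtoℚ-+ (suc (i ℕ.+ i)) (suc d)))
      (cong ℕtoℚ (solveₙ 2 (λ i d → (conₙ 1 +ₙ (i +ₙ i)) +ₙ (conₙ 1 +ₙ d) =ₙ conₙ 1 +ₙ (i +ₙ (i +ₙ (conₙ 1 +ₙ d))))
      refl i d))))) ⟩
    (E - D) * (η * σ) ≡⟨ solve 4 (λ e d η σ → (e :- d) :* (η :* σ) := η :* (σ :* e) :- (η :* d) :* σ) refl E D η σ ⟩
    η * (σ * E) - η * D * σ ≡⟨ cong₂ (λ u v → η * u - v * σ) (recip*ℕ (i ℕ.+ j′)) (recip*ℕ d) ⟩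
    η * 1ℚ - 1ℚ * σ ≡⟨ cong₂ _-_ (trans (*-identityʳ η) (sym (ρ-+ i d))) (*-identityˡ σ) ⟩
    ρ j′ i - σ ∎
    where
    j′ = i ℕ.+ suc d
    η = recipℕ (suc d)
    σ = recipℕ (suc (i ℕ.+ j′))
    D = ℕtoℚ (suc d)
    E = ℕtoℚ (suc (i ℕ.+ j′))
  by-cases {i} j (below d _ refl) = begin
    ℕtoℚ 4 * odd i * κ i j - ξ i * δ j i
      ≡⟨ cong₂ (λ u v → ℕtoℚ 4 * odd i * (¼ * (u * σ)) - ξ i * v) ρ≡
      (δ-≢ (λ e → ℕₚ.m≢1+m+n j (trans e (ℕₚ.+-suc j d)))) ⟩
    ℕtoℚ 4 * odd i * (¼ * (- η * σ)) - ξ i * 0ℚ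
      ≡⟨ solve 4 (λ o η σ ξ → con (ℕtoℚ 4) :* o :* (con ¼ :* (:- η :* σ)) :- ξ :* con 0ℚ := o :* (:- η :* σ)) refl
      (odd i) η σ (ξ i) ⟩
    odd i * (- η * σ) ≡⟨ cong (_* (- η * σ))
      (trans (cong ℕtoℚ (solveₙ 2
      (λ j d → conₙ 1 +ₙ ((j +ₙ (conₙ 1 +ₙ d)) +ₙ (j +ₙ (conₙ 1 +ₙ d))) =ₙ (conₙ 1 +ₙ ((j +ₙ (conₙ 1 +ₙ d)) +ₙ j)) +ₙ
      (conₙ 1 +ₙ d)) refl j d)) (ℕtoℚ-+ (suc (i ℕ.+ j)) (suc d))) ⟩
    (E + D) * (- η * σ) ≡⟨ solve 4 (λ e d η σ → (e :+ d) :* (:- η :* σ) := :- η :* (σ :* e) :- (η :* d) :* σ) refl E D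
      η σ ⟩
    - η * (σ * E) - η * D * σ ≡⟨ cong₂ (λ u v → - η * u - v * σ) (recip*ℕ (i ℕ.+ j)) (recip*ℕ d) ⟩
    - η * 1ℚ - 1ℚ * σ ≡⟨ cong₂ _-_ (trans (*-identityʳ (- η)) (sym ρ≡)) (*-identityˡ σ) ⟩
    ρ j i - σ ∎
    where
    η = recipℕ (suc d)
    σ = recipℕ (suc (i ℕ.+ j))
    D = ℕtoℚ (suc d)
    E = ℕtoℚ (suc (i ℕ.+ j))
    ρ≡ : ρ j i ≡ - η
    ρ≡ = trans (ρ-antisym j i) (cong -_ (ρ-+ j d))

-- The truncation of ∑ⱼ 1 / ((2j + 1)² - (2i + 1)²) = 1 / (4 (2i + 1)²).
κ-sum : ∀ n i → i ℕ.< n → ∑ n (κ i) ≡ ¼ * (ξ² i - ξ i * window n i)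
κ-sum n i l = begin
  K ≡⟨ solve 1 (λ k → k := con ¼ :* (con (ℕtoℚ 4) :* (con 1ℚ :* k))) refl K ⟩
  ¼ * (ℕtoℚ 4 * (1ℚ * K)) ≡⟨ cong (λ z → ¼ * (ℕtoℚ 4 * (z * K))) (sym (ξ*odd i)) ⟩
  ¼ * (ℕtoℚ 4 * (ξ i * odd i * K))
    ≡⟨ cong (¼ *_) (solve 3 (λ ξ o k → con (ℕtoℚ 4) :* (ξ :* o :* k) := ξ :* ξ :+ ξ :* (con (ℕtoℚ 4) :* o :* k :- ξ))
    refl (ξ i) (odd i) K) ⟩
  ¼ * (ξ² i + ξ i * (ℕtoℚ 4 * odd i * K - ξ i)) ≡⟨ cong (λ z → ¼ * (ξ² i + ξ i * z)) total ⟩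
  ¼ * (ξ² i + ξ i * - window n i)
    ≡⟨ solve 3 (λ u ξ w → con ¼ :* (u :+ ξ :* :- w) := con ¼ :* (u :- ξ :* w)) refl (ξ² i) (ξ i) (window n i) ⟩
  ¼ * (ξ² i - ξ i * window n i) ∎
  where
  K = ∑ n (κ i)
  total : ℕtoℚ 4 * odd i * K - ξ i ≡ - window n i
  total = begin
    ℕtoℚ 4 * odd i * K - ξ i ≡⟨ cong₂ _-_ (sym (∑-*ˡ n (ℕtoℚ 4 * odd i) (κ i))) (sym (∑-δ n i (λ _ → ξ i) l)) ⟩
    ∑ n (λ j → ℕtoℚ 4 * odd i * κ i j) - ∑ n (λ j → ξ i * δ j i)
      ≡⟨ solve 2 (λ u v → u :- v := u :+ con -1ℚ :* v) refl (∑ n (λ j → ℕtoℚ 4 * odd i * κ i j))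
      (∑ n (λ j → ξ i * δ j i)) ⟩
    ∑ n (λ j → ℕtoℚ 4 * odd i * κ i j) + -1ℚ * ∑ n (λ j → ξ i * δ j i)
      ≡⟨ cong (∑ n (λ j → ℕtoℚ 4 * odd i * κ i j) +_) (sym (∑-*ˡ n -1ℚ (λ j → ξ i * δ j i))) ⟩
    ∑ n (λ j → ℕtoℚ 4 * odd i * κ i j) + ∑ n (λ j → -1ℚ * (ξ i * δ j i)) ≡⟨ sym (∑-+ n _ _) ⟩
    ∑ n (λ j → ℕtoℚ 4 * odd i * κ i j + -1ℚ * (ξ i * δ j i))
      ≡⟨ ∑-cong n (λ j → trans
      (solve 2 (λ u v → u :+ con -1ℚ :* v := u :- v) refl (ℕtoℚ 4 * odd i * κ i j) (ξ i * δ j i)) (κ-partial i j)) ⟩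
    ∑ n (λ j → ρ j i - recipℕ (suc (i ℕ.+ j))) ≡⟨ window-sum n i ⟩
    - window n i ∎

-- The quadratic relation for the power sums of 1/(2i+1)², with its error.

geometric : ∀ n u w → (u - w) * anti n (λ i j → powℚ u i * powℚ w j) ≡ powℚ u (suc n) - powℚ w (suc n)
geometric zero u w = trans (cong ((u - w) *_) (anti-0 _))
  (solve 2 (λ u w → (u :- w) :* (con 1ℚ :* con 1ℚ) := u :* con 1ℚ :- w :* con 1ℚ) refl u w)
geometric (suc n) u w = begin
  (u - w) * anti (suc n) (λ i j → powℚ u i * powℚ w j) ≡⟨ cong ((u - w) *_) (anti-suc n _) ⟩
  (u - w) * (1ℚ * W + anti n (λ i j → u * powℚ u i * powℚ w j))
    ≡⟨ cong (λ z → (u - w) * (1ℚ * W + z))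
    (trans (anti-cong n (λ i j → *-assoc u (powℚ u i) (powℚ w j))) (anti-*ˡ n u _)) ⟩
  (u - w) * (1ℚ * W + u * A)
    ≡⟨ solve 4 (λ u w p a → (u :- w) :* (con 1ℚ :* p :+ u :* a) := (u :- w) :* p :+ u :* ((u :- w) :* a)) refl u w W
    A ⟩
  (u - w) * W + u * ((u - w) * A) ≡⟨ cong (λ z → (u - w) * W + u * z) (geometric n u w) ⟩
  (u - w) * W + u * (powℚ u (suc n) - W)
    ≡⟨ solve 4 (λ u w p q → (u :- w) :* p :+ u :* (q :- p) := u :* q :- w :* p) refl u w W (powℚ u (suc n)) ⟩
  powℚ u (suc (suc n)) - powℚ w (suc (suc n)) ∎
  where
  W = powℚ w (suc n)
  A = anti n (λ i j → powℚ u i * powℚ w j)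

-- Off the diagonal, `κ i j` is the product of the two nodes over their difference, which is the
-- factor in front of the geometric sum. On the diagonal there are n + 1 equal summands, recorded by
-- the `δ`-term.
pair-sum : ∀ n i j → anti n (λ a b → powℚ (ξ² i) (suc a) * powℚ (ξ² j) (suc b)) ≡ κ i j *
  (powℚ (ξ² i) (suc n) - powℚ (ξ² j) (suc n)) + ℕtoℚ (suc n) * powℚ (ξ² i) (suc (suc n)) * δ j i
pair-sum n i j = by-cases (i ℕ.≟ j)
  where
  c = ℕtoℚ (suc n) * powℚ (ξ² i) (suc (suc n))
  by-cases : Dec (i ≡ j) → anti n (λ a b → powℚ (ξ² i) (suc a) * powℚ (ξ² j) (suc b)) ≡ κ i j *
    (powℚ (ξ² i) (suc n) - powℚ (ξ² j) (suc n)) + c * δ j i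
  by-cases (yes refl) = begin
    anti n (λ a b → powℚ (ξ² i) (suc a) * powℚ (ξ² i) (suc b))
      ≡⟨ anti-cong≡ n (λ a b e → trans (sym (pow-+ (ξ² i) (suc a) (suc b)))
      (cong (λ z → powℚ (ξ² i) (suc z)) (trans (ℕₚ.+-suc a b) (cong suc e)))) ⟩
    anti n (λ _ _ → powℚ (ξ² i) (suc (suc n))) ≡⟨ anti-const n _ ⟩
    c ≡⟨ solve 2 (λ c p → c := con 0ℚ :* (p :- p) :+ c :* con 1ℚ) refl c (powℚ (ξ² i) (suc n)) ⟩
    0ℚ * (powℚ (ξ² i) (suc n) - powℚ (ξ² i) (suc n)) + c * 1ℚ
      ≡⟨ cong₂ (λ u v → u * (powℚ (ξ² i) (suc n) - powℚ (ξ² i) (suc n)) + c * v) (sym (κ-diag i)) (sym (δ-≡ i)) ⟩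
    κ i i * (powℚ (ξ² i) (suc n) - powℚ (ξ² i) (suc n)) + c * δ i i ∎
  by-cases (no h) = begin
    anti n (λ a b → powℚ (ξ² i) (suc a) * powℚ (ξ² j) (suc b))
      ≡⟨ anti-cong n (λ a b → solve 4 (λ u p w q → u :* p :* (w :* q) := u :* w :* (p :* q)) refl (ξ² i)
      (powℚ (ξ² i) a) (ξ² j) (powℚ (ξ² j) b)) ⟩
    anti n (λ a b → ξ² i * ξ² j * (powℚ (ξ² i) a * powℚ (ξ² j) b)) ≡⟨ anti-*ˡ n (ξ² i * ξ² j) _ ⟩
    ξ² i * ξ² j * A ≡⟨ cong (_* A) (ξ²*ξ² i j h) ⟩
    κ i j * (ξ² i - ξ² j) * A
      ≡⟨ trans (*-assoc (κ i j) (ξ² i - ξ² j) A) (cong (κ i j *_) (geometric n (ξ² i) (ξ² j))) ⟩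
    κ i j * (powℚ (ξ² i) (suc n) - powℚ (ξ² j) (suc n))
      ≡⟨ sym (+-≡0 (κ i j * (powℚ (ξ² i) (suc n) - powℚ (ξ² j) (suc n))) (*-≡0 c (δ-≢ (λ e → h (sym e))))) ⟩
    κ i j * (powℚ (ξ² i) (suc n) - powℚ (ξ² j) (suc n)) + c * δ j i ∎
    where A = anti n (λ a b → powℚ (ξ² i) a * powℚ (ξ² j) b)

ζ : ℕ → ℕ → ℚ
ζ N k = ∑ N (λ i → powℚ (ξ² i) k)

-- The error caused by stopping the sum of `κ i j` over j at N; each row i contributes its final
-- window.
remainder : ℕ → ℕ → ℚ
remainder N n = ∑ N (λ i → powℚ (ξ² i) (suc n) * (ξ i * window N i))

∑-*ʳ : ∀ n c f → ∑ n (λ i → f i * c) ≡ ∑ n f * c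
∑-*ʳ n c f = trans (∑-cong n (λ i → *-comm (f i) c)) (trans (∑-*ˡ n c f) (*-comm c (∑ n f)))

-- Sum `pair-sum` over all i and j. As `κ` is antisymmetric, its two halves agree, and by `κ-sum`
-- each gives a quarter of the next power sum up to the error. With the n + 1 from the diagonal this
-- makes n + 3/2.
ζ-Riccati : ∀ N n → anti n (λ a b → ζ N (suc a) * ζ N (suc b)) ≡ (ℕtoℚ n + 3/2) * ζ N (suc (suc n)) - ½ * remainder N
  n
ζ-Riccati N n = begin
  anti n (λ a b → ζ N (suc a) * ζ N (suc b))
    ≡⟨ anti-cong n (λ a b → trans (sym (∑-*ʳ N (ζ N (suc b)) _))
      (∑-cong N (λ i → sym (∑-*ˡ N (powℚ (ξ² i) (suc a)) _)))) ⟩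
  anti n (λ a b → ∑ N (λ i → ∑ N (λ j → powℚ (ξ² i) (suc a) * powℚ (ξ² j) (suc b))))
    ≡⟨ sym (∑-anti N n (λ i a b → ∑ N (λ j → powℚ (ξ² i) (suc a) * powℚ (ξ² j) (suc b)))) ⟩
  ∑ N (λ i → anti n (λ a b → ∑ N (λ j → powℚ (ξ² i) (suc a) * powℚ (ξ² j) (suc b))))
    ≡⟨ ∑-cong N (λ i → trans (sym (∑-anti N n (λ j a b → powℚ (ξ² i) (suc a) * powℚ (ξ² j) (suc b))))
    (∑-cong N (pair-sum n i))) ⟩
  ∑ N (λ i → ∑ N (λ j → κ i j * (P i - P j) + C i * δ j i))
    ≡⟨ ∑-cong N (λ i → trans (∑-+ N _ _)
    (cong₂ _+_ (∑-cong N (λ j → solve 3 (λ k p q → k :* (p :- q) := k :* p :+ (:- k) :* q) refl (κ i j) (P i) (P j)))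
    refl)) ⟩
  ∑ N (λ i → ∑ N (λ j → κ i j * P i + - κ i j * P j) + ∑ N (λ j → C i * δ j i)) ≡⟨ ∑-+ N _ _ ⟩
  ∑ N (λ i → ∑ N (λ j → κ i j * P i + - κ i j * P j)) + ∑ N (λ i → ∑ N (λ j → C i * δ j i))
    ≡⟨ cong₂ _+_ (trans (∑-cong N (λ i → ∑-+ N _ _)) (∑-+ N _ _)) (∑-cong< N (λ i l → ∑-δ N i (λ _ → C i) l)) ⟩
  ∑ N (λ i → ∑ N (λ j → κ i j * P i)) + ∑ N (λ i → ∑ N (λ j → - κ i j * P j)) + ∑ N C
    ≡⟨ cong₂ _+_ (cong (D +_)
      (trans (∑-swap N N (λ i j → - κ i j * P j))
      (∑-cong N (λ j → ∑-cong N (λ i → cong (_* P j) (sym (κ-antisym j i))))))) (∑-*ˡ N (ℕtoℚ (suc n)) _) ⟩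
  D + D + ℕtoℚ (suc n) * ζₙ ≡⟨ cong (λ z → z + z + ℕtoℚ (suc n) * ζₙ) D≡ ⟩
  ¼ * (ζₙ - e) + ¼ * (ζₙ - e) + ℕtoℚ (suc n) * ζₙ ≡⟨ cong (λ z → ¼ * (ζₙ - e) + ¼ * (ζₙ - e) + z * ζₙ) (ℕtoℚ-suc n) ⟩
  ¼ * (ζₙ - e) + ¼ * (ζₙ - e) + (1ℚ + ℕtoℚ n) * ζₙ
    ≡⟨ solve 3 (λ z e n → con ¼ :* (z :- e) :+ con ¼ :* (z :- e) :+ (con 1ℚ :+ n) :* z :=
    (n :+ con 3/2) :* z :- con ½ :* e) refl ζₙ e (ℕtoℚ n) ⟩
  (ℕtoℚ n + 3/2) * ζₙ - ½ * e ∎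
  where
  P C : ℕ → ℚ
  P i = powℚ (ξ² i) (suc n)
  C i = ℕtoℚ (suc n) * powℚ (ξ² i) (suc (suc n))
  D = ∑ N (λ i → ∑ N (λ j → κ i j * P i))
  ζₙ = ζ N (suc (suc n))
  e = remainder N n
  D≡ : D ≡ ¼ * (ζₙ - e)
  D≡ = begin
    D ≡⟨ ∑-cong< N (λ i l → trans (∑-*ʳ N (P i) (κ i)) (cong (_* P i) (κ-sum N i l))) ⟩
    ∑ N (λ i → ¼ * (ξ² i - ξ i * window N i) * P i)
      ≡⟨ ∑-cong N (λ i → solve 3 (λ u v p → con ¼ :* (u :- v) :* p := con ¼ :* (u :* p :+ con -1ℚ :* (p :* v))) refl
      (ξ² i) (ξ i * window N i) (P i)) ⟩
    ∑ N (λ i → ¼ * (ξ² i * P i + -1ℚ * (P i * (ξ i * window N i))))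
      ≡⟨ trans (∑-*ˡ N ¼ _) (cong (¼ *_) (trans (∑-+ N _ _) (cong (ζₙ +_) (∑-*ˡ N -1ℚ _)))) ⟩
    ¼ * (ζₙ + -1ℚ * e) ≡⟨ solve 2 (λ z e → con ¼ :* (z :+ con -1ℚ :* e) := con ¼ :* (z :- e)) refl ζₙ e ⟩
    ¼ * (ζₙ - e) ∎

∑-const : ∀ n c → ∑ n (λ _ → c) ≡ ℕtoℚ n * c
∑-const zero c = trans (∑-0 _) (sym (*-zeroˡ c))
∑-const (suc n) c = trans (∑-suc n _)
  (trans (cong (c +_) (∑-const n c))
  (trans (solve 2 (λ c n → c :+ n :* c := (con 1ℚ :+ n) :* c) refl c (ℕtoℚ n)) (cong (_* c) (sym (ℕtoℚ-suc n)))))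

ξ²-nonNeg : ∀ i → 0ℚ ≤ ξ² i
ξ²-nonNeg i = *-nonNeg (0≤recip (suc (i ℕ.+ i))) (0≤recip (suc (i ℕ.+ i)))

ξ²≤1 : ∀ i → ξ² i ≤ 1ℚ
ξ²≤1 i = *-mono (0≤recip (suc (i ℕ.+ i))) (0≤ℕtoℚ 1) ξ≤1 ξ≤1
  where
  ξ≤1 : ξ i ≤ 1ℚ
  ξ≤1 = recip-antimono {0} {i ℕ.+ i} (s≤s z≤n)

pow≤ : ∀ {y} n → 0ℚ ≤ y → y ≤ 1ℚ → powℚ y (suc n) ≤ y
pow≤ {y} n h l = ≤-trans (*-monoˡ h (pow≤1 n)) (≤-reflexive (*-identityʳ y))
  where
  pow≤1 : ∀ n → powℚ y n ≤ 1ℚ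
  pow≤1 zero = ≤-refl
  pow≤1 (suc n) = *-mono (pow-nonNeg n h) (0≤ℕtoℚ 1) l (pow≤1 n)

window-shifted : ∀ i v r → ρ (suc (i ℕ.+ v) ℕ.+ r) i ≡ recipℕ (suc (v ℕ.+ r))
window-shifted i v r =
  trans (cong (λ z → ρ z i) (solveₙ 3 (λ i v r → conₙ 1 +ₙ (i +ₙ v) +ₙ r =ₙ i +ₙ (conₙ 1 +ₙ (v +ₙ r))) refl i v r))
  (ρ-+ i (v ℕ.+ r))

window-nonNeg : ∀ i v → 0ℚ ≤ window (suc (i ℕ.+ v)) i
window-nonNeg i v = ∑-nonNeg (suc (i ℕ.+ i)) _
  (λ r → subst (0ℚ ≤_) (sym (window-shifted i v r)) (0≤recip (suc (v ℕ.+ r))))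

-- `ξ i` times the window is the average of its 2i + 1 terms, the first of which, 1/(v + 1), is the
-- largest.
window-≤ : ∀ i v → ξ i * window (suc (i ℕ.+ v)) i ≤ recipℕ (suc v)
window-≤ i v = ≤-trans
  (*-monoˡ (0≤recip (suc (i ℕ.+ i)))
  (∑-mono< (suc (i ℕ.+ i))
  (λ r _ → ≤-trans (≤-reflexive (window-shifted i v r)) (recip-antimono (s≤s (ℕₚ.m≤m+n v r))))))
  (≤-reflexive (trans (cong (ξ i *_) (∑-const (suc (i ℕ.+ i)) (recipℕ (suc v))))
    (trans (sym (*-assoc (ξ i) (odd i) (recipℕ (suc v)))) (≡1-* (recipℕ (suc v)) (ξ*odd i)))))

-- Put N = i + v + 1. The term is at most `ξ² i`/(v + 1), and N ≤ (2i + 1) + 2(v + 1) splits N times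
-- this into 1/((2i + 1)(v + 1)) ≤ 1/N and 2 `ξ² i`. Both parts can be summed over the N rows.
remainder-term-≤ : ∀ n i v → ℕtoℚ (suc (i ℕ.+ v)) * (powℚ (ξ² i) (suc n) * (ξ i * window (suc (i ℕ.+ v)) i)) ≤ recipℕ
  (suc (i ℕ.+ v)) + ℕtoℚ 2 * ξ² i
remainder-term-≤ n i v =
  ≤-trans (*-mono (*-nonNeg (pow-nonNeg (suc n) (ξ²-nonNeg i))
  (*-nonNeg (0≤recip (suc (i ℕ.+ i))) (window-nonNeg i v)))
  (+-nonNeg (0≤ℕtoℚ (suc (i ℕ.+ i))) (*-nonNeg (0≤ℕtoℚ 2) (0≤ℕtoℚ (suc v))))
    N≤ (*-mono (*-nonNeg (0≤recip (suc (i ℕ.+ i))) (window-nonNeg i v)) (ξ²-nonNeg i) (pow≤ n (ξ²-nonNeg i) (ξ²≤1 i))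
      (window-≤ i v)))
  (≤-trans (≤-reflexive split)
    (+-monoˡ-≤ (ℕtoℚ 2 * ξ² i)
    (≤-trans (≤-reflexive (sym (recip-* (suc (i ℕ.+ i)) (suc v))))
    (recip-antimono {i ℕ.+ v} {v ℕ.+ (i ℕ.+ i) ℕ.* suc v} N≤prod))))
  where
  y = recipℕ (suc v)
  V′ = ℕtoℚ (suc v)
  N≤ : ℕtoℚ (suc (i ℕ.+ v)) ≤ odd i + ℕtoℚ 2 * V′
  N≤ = ≤-trans (ℕtoℚ-mono
    (ℕₚ.≤-trans (ℕₚ.m≤m+n (suc (i ℕ.+ v)) (i ℕ.+ suc (suc v)))
    (ℕₚ.≤-reflexive (solveₙ 2 (λ i v → conₙ 1 +ₙ (i +ₙ v) +ₙ (i +ₙ (conₙ 2 +ₙ v)) =ₙ conₙ 1 +ₙ (i +ₙ i) +ₙ conₙ 2 *ₙ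
    (conₙ 1 +ₙ v)) refl i v))))
    (≤-reflexive (trans (ℕtoℚ-+ (suc (i ℕ.+ i)) (2 ℕ.* suc v)) (cong (odd i +_) (ℕtoℚ-* 2 (suc v)))))
  N≤prod : suc (i ℕ.+ v) ℕ.≤ suc (v ℕ.+ (i ℕ.+ i) ℕ.* suc v)
  N≤prod = s≤s (ℕₚ.≤-trans (ℕₚ.≤-reflexive (ℕₚ.+-comm i v))
    (ℕₚ.+-monoʳ-≤ v (ℕₚ.≤-trans (ℕₚ.m≤m+n i i) (ℕₚ.m≤m*n (i ℕ.+ i) (suc v)))))
  split : (odd i + ℕtoℚ 2 * V′) * (ξ² i * y) ≡ ξ i * y + ℕtoℚ 2 * ξ² i
  split = begin
    (odd i + ℕtoℚ 2 * V′) * (ξ² i * y)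
      ≡⟨ solve 4 (λ o v ξ y → (o :+ con (ℕtoℚ 2) :* v) :* (ξ :* ξ :* y) :=
      (ξ :* o) :* ξ :* y :+ con (ℕtoℚ 2) :* (ξ :* ξ) :* (y :* v)) refl (odd i) V′ (ξ i) y ⟩
    ξ i * odd i * ξ i * y + ℕtoℚ 2 * ξ² i * (y * V′)
      ≡⟨ cong₂ (λ a b → a * ξ i * y + ℕtoℚ 2 * ξ² i * b) (ξ*odd i) (recip*ℕ v) ⟩
    1ℚ * ξ i * y + ℕtoℚ 2 * ξ² i * 1ℚ
      ≡⟨ solve 3 (λ ξ y c → con 1ℚ :* ξ :* y :+ c :* con 1ℚ := ξ :* y :+ c) refl (ξ i) y (ℕtoℚ 2 * ξ² i) ⟩
    ξ i * y + ℕtoℚ 2 * ξ² i ∎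

ζ₁ : ℕ → ℚ
ζ₁ N = ∑ N ξ²

remainder-nonNeg : ∀ M n → 0ℚ ≤ remainder (suc M) n
remainder-nonNeg M n = subst (_≤ remainder (suc M) n) (trans (∑-const (suc M) 0ℚ) (*-zeroʳ (ℕtoℚ (suc M))))
  (∑-mono< (suc M) λ i l → term i l)
  where
  term : ∀ i → i ℕ.< suc M → 0ℚ ≤ powℚ (ξ² i) (suc n) * (ξ i * window (suc M) i)
  term i (s≤s l) = *-nonNeg (pow-nonNeg (suc n) (ξ²-nonNeg i))
    (*-nonNeg (0≤recip (suc (i ℕ.+ i)))
    (subst (λ z → 0ℚ ≤ window (suc z) i) (ℕₚ.m+[n∸m]≡n l) (window-nonNeg i (M ∸ i))))

remainder-≤ : ∀ M n → ℕtoℚ (suc M) * remainder (suc M) n ≤ 1ℚ + ℕtoℚ 2 * ζ₁ (suc M)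
remainder-≤ M n = ≤-trans (≤-reflexive (sym (∑-*ˡ (suc M) (ℕtoℚ (suc M)) _)))
  (≤-trans (∑-mono< (suc M) term) (≤-reflexive (trans (∑-+ (suc M) _ _)
  (cong₂ _+_ (trans (∑-const (suc M) (recipℕ (suc M))) (trans (*-comm (ℕtoℚ (suc M)) (recipℕ (suc M))) (recip*ℕ M)))
    (∑-*ˡ (suc M) (ℕtoℚ 2) ξ²)))))
  where
  term : ∀ i → i ℕ.< suc M → ℕtoℚ (suc M) * (powℚ (ξ² i) (suc n) * (ξ i * window (suc M) i)) ≤ recipℕ
    (suc M) + ℕtoℚ 2 * ξ² i
  term i (s≤s l) = subst (λ z → ℕtoℚ (suc z) * (powℚ (ξ² i) (suc n) * (ξ i * window (suc z) i)) ≤ recipℕ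
    (suc z) + ℕtoℚ 2 * ξ² i) (ℕₚ.m+[n∸m]≡n l) (remainder-term-≤ n i (M ∸ i))

-- The scaled nodes and their limits.

1≤ζ₁ : ∀ M → 1ℚ ≤ ζ₁ (suc M)
1≤ζ₁ M = ≤-trans (≤-reflexive (sym (+-identityʳ 1ℚ)))
  (≤-trans (+-monoʳ-≤ 1ℚ (∑-nonNeg M (ξ² ∘ suc) (ξ²-nonNeg ∘ suc))) (≤-reflexive (sym (∑-suc M ξ²))))

ζ₁-positive : ∀ M → Positive (ζ₁ (suc M))
ζ₁-positive M = positive (<-≤-trans (0<ℕtoℚ 0) (1≤ζ₁ M))

ζ₁-inverse : ℕ → ℚ
ζ₁-inverse M = (1/ ζ₁ (suc M)) {{pos⇒nonZero (ζ₁ (suc M)) {{ζ₁-positive M}}}}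

-- The scale that makes the first power sum of the nodes equal to 1/2.
τ : ℕ → ℚ
τ M = ½ * ζ₁-inverse M

τ*ζ₁ : ∀ M → τ M * ζ₁ (suc M) ≡ ½
τ*ζ₁ M = trans (*-assoc ½ (ζ₁-inverse M) (ζ₁ (suc M)))
  (*-≡1 ½ (*-inverseˡ (ζ₁ (suc M)) {{pos⇒nonZero (ζ₁ (suc M)) {{ζ₁-positive M}}}}))

τ-nonNeg : ∀ M → 0ℚ ≤ τ M
τ-nonNeg M = *-nonNeg (nonNegative⁻¹ ½) (<⇒≤ (positive⁻¹ (ζ₁-inverse M) {{1/pos⇒pos (ζ₁ (suc M)) {{ζ₁-positive M}}}}))

τ≤½ : ∀ M → τ M ≤ ½
τ≤½ M = ≤-trans (≤-reflexive (sym (*-identityʳ (τ M))))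
  (≤-trans (*-monoˡ (τ-nonNeg M) (1≤ζ₁ M)) (≤-reflexive (τ*ζ₁ M)))

nodes : ℕ → List ℚ
nodes M = applyUpTo (λ i → τ M * ξ² i) (suc M)

nodes-nonNeg : ∀ M → All (0ℚ ≤_) (nodes M)
nodes-nonNeg M = Allₚ.applyUpTo⁺₂ _ (suc M) (λ i → *-nonNeg (τ-nonNeg M) (ξ²-nonNeg i))

π : ℕ → Series
π M = powerSums (nodes M)

powerSums-applyUpTo : ∀ (f : ℕ → ℚ) n k → powerSums (applyUpTo f n) (suc k) ≡ ∑ n (λ i → powℚ (f i) (suc k))
powerSums-applyUpTo f zero k = sym (∑-0 _)
powerSums-applyUpTo f (suc n) k = trans (cong (powℚ (f 0) (suc k) +_) (powerSums-applyUpTo (f ∘ suc) n k))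
  (sym (∑-suc n (λ i → powℚ (f i) (suc k))))

pow-* : ∀ u v k → powℚ (u * v) k ≡ powℚ u k * powℚ v k
pow-* u v zero = refl
pow-* u v (suc k) = trans (cong (u * v *_) (pow-* u v k))
  (solve 4 (λ u v a b → u :* v :* (a :* b) := u :* a :* (v :* b)) refl u v (powℚ u k) (powℚ v k))

π-suc : ∀ M k → π M (suc k) ≡ powℚ (τ M) (suc k) * ζ (suc M) (suc k)
π-suc M k = trans (powerSums-applyUpTo (λ i → τ M * ξ² i) (suc M) k)
  (trans (∑-cong (suc M) (λ i → pow-* (τ M) (ξ² i) (suc k))) (∑-*ˡ (suc M) (powℚ (τ M) (suc k)) _))

π-1 : ∀ M → π M 1 ≡ ½
π-1 M = trans (π-suc M 0) (trans (cong₂ _*_ (*-identityʳ (τ M)) (∑-cong (suc M) (λ i → *-identityʳ (ξ² i)))) (τ*ζ₁ M))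

ε : ℕ → ℕ → ℚ
ε M n = ½ * powℚ (τ M) (suc (suc n)) * remainder (suc M) n

-- The relation is homogeneous of degree n + 2 in the nodes, so scaling by τ multiplies it by τⁿ⁺²,
-- the error included.
π-Riccati : ∀ M n → anti n (λ i j → π M (suc i) * π M (suc j)) + ε M n ≡ (ℕtoℚ n + 3/2) * π M (suc (suc n))
π-Riccati M n = begin
  anti n (λ i j → π M (suc i) * π M (suc j)) + ε M n
    ≡⟨ cong (_+ ε M n) (trans (anti-cong≡ n term) (trans (anti-*ˡ n S₂ _) (cong (S₂ *_) (ζ-Riccati (suc M) n)))) ⟩
  S₂ * ((ℕtoℚ n + 3/2) * ζₙ - ½ * e) + ½ * S₂ * e
    ≡⟨ solve 4 (λ τ k z e → τ :* (k :* z :- con ½ :* e) :+ con ½ :* τ :* e := k :* (τ :* z)) refl S₂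
    (ℕtoℚ n + 3/2) ζₙ e ⟩
  (ℕtoℚ n + 3/2) * (S₂ * ζₙ) ≡⟨ cong ((ℕtoℚ n + 3/2) *_) (sym (π-suc M (suc n))) ⟩
  (ℕtoℚ n + 3/2) * π M (suc (suc n)) ∎
  where
  S₂ = powℚ (τ M) (suc (suc n))
  ζₙ = ζ (suc M) (suc (suc n))
  e = remainder (suc M) n
  term : ∀ i j → i ℕ.+ j ≡ n → π M (suc i) * π M (suc j) ≡ S₂ * (ζ (suc M) (suc i) * ζ (suc M) (suc j))
  term i j e = begin
    π M (suc i) * π M (suc j) ≡⟨ cong₂ _*_ (π-suc M i) (π-suc M j) ⟩
    A * z * (B * w) ≡⟨ solve 4 (λ a z b w → a :* z :* (b :* w) := a :* b :* (z :* w)) refl A z B w ⟩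
    A * B * (z * w) ≡⟨ cong (_* (z * w))
      (trans (sym (pow-+ (τ M) (suc i) (suc j)))
      (cong (λ k → powℚ (τ M) (suc k)) (trans (ℕₚ.+-suc i j) (cong suc e)))) ⟩
    S₂ * (z * w) ∎
    where
    A = powℚ (τ M) (suc i)
    B = powℚ (τ M) (suc j)
    z = ζ (suc M) (suc i)
    w = ζ (suc M) (suc j)

-- The normalization τ ζ₁ = ½ absorbs the growth of ζ₁ in the bound of the remainder: ½ τ (1 + 2 ζ₁)
-- = ½ τ + ½ ≤ 1.
ε-Conv : ∀ n → Conv (λ M → ε M n) 0ℚ
ε-Conv n = within 1ℚ bound
  where
  bound : ∀ M → ℕtoℚ (suc M) * ∣ ε M n - 0ℚ ∣ ≤ 1ℚ
  bound M = ≤-trans (≤-reflexive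
    (cong (ℕtoℚ (suc M) *_)
    (trans (cong ∣_∣ (+-identityʳ (ε M n)))
    (0≤p⇒∣p∣≡p (*-nonNeg (*-nonNeg (nonNegative⁻¹ ½) (pow-nonNeg (suc (suc n)) (τ-nonNeg M)))
    (remainder-nonNeg M n))))))
    (≤-trans (≤-reflexive (solve 3 (λ k τ e → k :* (con ½ :* τ :* e) := con ½ :* τ :* (k :* e)) refl (ℕtoℚ (suc M)) S₂
      (remainder (suc M) n)))
    (≤-trans (*-mono (*-nonNeg (0≤ℕtoℚ (suc M)) (remainder-nonNeg M n)) (*-nonNeg (nonNegative⁻¹ ½) (τ-nonNeg M))
       (*-monoˡ (nonNegative⁻¹ ½) (pow≤ (suc n) (τ-nonNeg M) (≤-trans (τ≤½ M) ½≤1))) (remainder-≤ M n))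
    (≤-trans (≤-reflexive (solve 2 (λ τ z → con ½ :* τ :* (con 1ℚ :+ con (ℕtoℚ 2) :* z) := con ½ :* τ :+ τ :* z) refl
      (τ M) (ζ₁ (suc M))))
    (≤-trans (≤-reflexive (cong (½ * τ M +_) (τ*ζ₁ M)))
      (+-monoˡ-≤ ½ (≤-trans (*-mono (τ-nonNeg M) (0≤ℕtoℚ 1) ½≤1 (τ≤½ M)) (≤-reflexive (*-identityˡ ½))))))))
    where
    S₂ = powℚ (τ M) (suc (suc n))
    ½≤1 : ½ ≤ 1ℚ
    ½≤1 = recip-antimono {0} {1} (s≤s z≤n)

-- The relation gives each coefficient as a fixed multiple of a polynomial in earlier ones, so a
-- perturbation that tends to 0 disappears degree by degree.
Riccati-Conv : ∀ (p : ℕ → Series) (r : Series) (E : ℕ → Series) → (∀ M → p M 0 ≡ ½) → r 0 ≡ ½ →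
  (∀ M n → anti n (λ i j → p M i * p M j) + E M n ≡ (ℕtoℚ n + 3/2) * p M (suc n)) →
    (∀ n → anti n (λ i j → r i * r j) ≡ (ℕtoℚ n + 3/2) * r (suc n)) →
  (∀ n → Conv (λ M → E M n) 0ℚ) → ∀ n → Conv (λ M → p M n) (r n)
Riccati-Conv p r E p0 r0 pR rR E0 = <-rec _ step
  where
  step : ∀ n → (∀ {j} → j ℕ.< n → Conv (λ M → p M j) (r j)) → Conv (λ M → p M n) (r n)
  step zero ih = Conv-cong (λ M → sym (p0 M)) (sym r0) (Conv-const ½)
  step (suc n) ih = Conv-cong (λ M → trans (cong (c *_) (pR M n)) (cancel (p M (suc n))))
    (trans (cong (c *_) (trans (+-identityʳ (anti n (λ i j → r i * r j))) (rR n))) (cancel (r (suc n))))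
    (Conv-scale c {λ M → anti n (λ i j → p M i * p M j) + E M n} (Conv-+
      (Conv-anti n (λ i j e → Conv-* (ih (s≤s (≤-fst i j e))) (ih (s≤s (≤-snd i j e))))) (E0 n)))
    where
    -- 2/(2n + 3), the inverse of n + 3/2.
    c = ℕtoℚ 2 * recipℕ (3 ℕ.+ (n ℕ.+ n))
    cancel : ∀ y → c * ((ℕtoℚ n + 3/2) * y) ≡ y
    cancel y = begin
      c * ((ℕtoℚ n + 3/2) * y)
        ≡⟨ solve 3 (λ r n y → con (ℕtoℚ 2) :* r :* ((n :+ con 3/2) :* y) := r :* (con (ℕtoℚ 3) :+ (n :+ n)) :* y) refl
        (recipℕ (3 ℕ.+ (n ℕ.+ n))) (ℕtoℚ n) y ⟩
      recipℕ (3 ℕ.+ (n ℕ.+ n)) * (ℕtoℚ 3 + (ℕtoℚ n + ℕtoℚ n)) * y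
        ≡⟨ cong (λ z → recipℕ (3 ℕ.+ (n ℕ.+ n)) * z * y)
        (sym (trans (ℕtoℚ-+ 3 (n ℕ.+ n)) (cong (ℕtoℚ 3 +_) (ℕtoℚ-+ n n)))) ⟩
      recipℕ (3 ℕ.+ (n ℕ.+ n)) * ℕtoℚ (3 ℕ.+ (n ℕ.+ n)) * y ≡⟨ ≡1-* y (recip*ℕ (2 ℕ.+ (n ℕ.+ n))) ⟩
      y ∎

q⁺-0 : q⁺ 0 ≡ ½
q⁺-0 = trans (*-identityˡ (q 0)) q-0

π-Conv : ∀ n → Conv (λ M → π M n) (pstar n)
π-Conv zero = Conv-cong (λ M → sym (powerSums-0 (nodes M))) (sym pstar-0) (Conv-const 0ℚ)
π-Conv (suc n) = subst (Conv (λ M → π M (suc n))) (sym (pstar-suc n))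
  (Riccati-Conv (λ M → π M ∘ suc) q⁺ ε π-1 q⁺-0 π-Riccati q⁺-Riccati ε-Conv n)

complete-Conv : ∀ n → Conv (λ M → complete (nodes M) n) (secant n)
complete-Conv = LogDer-Conv (λ M → powerSums-0 (nodes M)) pstar-0 (λ M → complete-0 (nodes M)) refl
  (λ M → complete-LogDer (nodes M)) (integrate-LogDer pstar pstar-0) π-Conv

elementary-Conv : ∀ n → Conv (λ M → elementary (nodes M) n) (cosh n)
elementary-Conv = LogDer-Conv {P = λ M → signed (π M)} (λ M → cong (λ z → - (1ℚ * z)) (powerSums-0 (nodes M))) Q-0
  (λ M → elementary-0 (nodes M)) refl (λ M → elementary-LogDer (nodes M)) cosh-LogDer
  (λ n → Conv-cong (λ M → neg-* (powℚ -1ℚ n) (π M n)) (trans (neg-* (powℚ -1ℚ n) (pstar n)) (sym (Q≡signed-pstar n)))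
    (Conv-scale (- powℚ -1ℚ n) {λ M → π M n} (π-Conv n)))
  where
  neg-* : ∀ u v → - u * v ≡ - (u * v)
  neg-* u v = sym (neg-distribˡ-* u v)

shift-Conv : ∀ k {A : ℕ → Series} {L} n → (∀ n → Conv (λ M → A M n) (L n)) → Conv (λ M → shift k (A M) n)
  (shift k L n)
shift-Conv zero n h = h n
shift-Conv (suc k) zero h = Conv-const 0ℚ
shift-Conv (suc k) (suc n) h = shift-Conv k n h

coefficients-Conv : ∀ {N} n (α : Vec ℕ N) → Conv (λ M → coefficients (complete (nodes M)) n α)
  (coefficients secant n α)
coefficients-Conv n [] = Conv-const (const 1ℚ n)
coefficients-Conv n (k ∷ α) = Conv-*
  (complete-Conv k) (shift-Conv k n (λ m → coefficients-Conv m α))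

-- Integrality of the limits

IsInteger : ℚ → Set
IsInteger y = ∃ λ z → y ≡ ℤtoℚ z

IsInteger-+ : ∀ {u v} → IsInteger u → IsInteger v → IsInteger (u + v)
IsInteger-+ (z , e) (w , f) = z ℤ.+ w , trans (cong₂ _+_ e f) (sym (ℤtoℚ-+ z w))

IsInteger-* : ∀ {u v} → IsInteger u → IsInteger v → IsInteger (u * v)
IsInteger-* (z , e) (w , f) = z ℤ.* w , trans (cong₂ _*_ e f) (sym (ℤtoℚ-* z w))

IsInteger-neg : ∀ {u} → IsInteger u → IsInteger (- u)
IsInteger-neg (z , e) = ℤ.- z , trans (cong -_ e) (sym (ℤtoℚ-neg z))

IsInteger-≟ₗ : ∀ y z → IsInteger [ y ≟ₗ z ]
IsInteger-≟ₗ y z with ≡-dec ℕ._≟_ y z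
... | yes _ = ℤ.+ 1 , refl
... | no _ = ℤ.+ 0 , refl

IsInteger-Δ : ∀ ℓ {F} → (∀ β → IsInteger (F β)) → ∀ β → IsInteger (Δ ℓ F β)
IsInteger-Δ zero h β = h β
IsInteger-Δ (suc ℓ) h [] = ℤ.+ 0 , refl
IsInteger-Δ (suc ℓ) h (zero ∷ β) = IsInteger-Δ (suc ℓ) (h ∘ (0 ∷_)) β
IsInteger-Δ (suc ℓ) h (suc b ∷ β) = IsInteger-+ (IsInteger-Δ (suc ℓ) (h ∘ (suc b ∷_)) β)
  (IsInteger-Δ ℓ (h ∘ (b ∷_)) β)

-- The limit is carried as data together with its integrality, since the same recursion produces
-- both.
record Integral (n : ℕ) (f : ℕ → ℚ) : Set where
  constructor integral
  field
    limit : ℚ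
    converges : Conv f limit
    isInteger : IsInteger (ℕtoℚ ((2 ℕ.* n) !) * limit)

Integral-zero : ∀ n {f} → (∀ M → f M ≡ 0ℚ) → Integral n f
Integral-zero n h = integral 0ℚ (Conv-cong (λ M → sym (h M)) refl (Conv-const 0ℚ))
  (ℤ.+ 0 , *-zeroʳ (ℕtoℚ ((2 ℕ.* n) !)))

Integral-+ : ∀ n {f g} → Integral n f → Integral n g → Integral n (λ M → f M + g M)
Integral-+ n (integral L c i) (integral K d j) = integral (L + K) (Conv-+ c d)
  (subst IsInteger (sym (*-distribˡ-+ (ℕtoℚ ((2 ℕ.* n) !)) L K)) (IsInteger-+ i j))

Integral-scale : ∀ n {f k} → IsInteger k → Integral n f → Integral n (λ M → k * f M)
Integral-scale n {f} {k} i (integral L c j) = integral (k * L) (Conv-scale k c)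
  (subst IsInteger (solve 3 (λ k n l → k :* (n :* l) := n :* (k :* l)) refl k (ℕtoℚ ((2 ℕ.* n) !)) L)
  (IsInteger-* i j))

Integral-cong : ∀ n {f g} → (∀ M → f M ≡ g M) → Integral n f → Integral n g
Integral-cong n e (integral L c i) = integral L (Conv-cong e refl c) i

Integral-∑ₗ : ∀ n {A : Set} {P : A → Set} {xs : List A} {f : A → ℕ → ℚ} → All P xs → (∀ x → P x → Integral n (f x)) →
  Integral n (λ M → ∑ₗ xs (λ x → f x M))
Integral-∑ₗ n [] h = Integral-zero n (λ _ → refl)
Integral-∑ₗ n (p ∷ ps) h = Integral-+ n (h _ p) (Integral-∑ₗ n ps h)

Part-0 : ∀ {n ν} → Part 0 n ν → ν ≡ []
Part-0 [] = refl

Part-length : ∀ {b n ν} → Part b n ν → length ν ℕ.≤ n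
Part-length [] = z≤n
Part-length (cons {k = k} {m} l p) = s≤s (ℕₚ.≤-trans (Part-length p) (ℕₚ.m≤n+m m k))

Part-sum : ∀ {b n ν} → Part b n ν → sum ν ≡ n
Part-sum [] = refl
Part-sum (cons {k = k} l p) = cong (suc k ℕ.+_) (Part-sum p)

Part-pred-sum : ∀ {b n ν} → Part b n ν → sum (map ℕ.pred ν) ℕ.+ length ν ≡ n
Part-pred-sum [] = refl
Part-pred-sum (cons {k = k} {m} {ν} l p) =
  trans (solveₙ 3 (λ k τ l → k +ₙ τ +ₙ (conₙ 1 +ₙ l) =ₙ conₙ 1 +ₙ (k +ₙ (τ +ₙ l))) refl k (sum (map ℕ.pred ν))
  (length ν)) (cong (λ z → suc (k ℕ.+ z)) (Part-pred-sum p))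

canon-Part : ∀ {b n ν} → Part b n ν → canon ν ≡ ν
canon-Part [] = refl
canon-Part (cons {k = k} l p) = trans (cong (ins (suc k)) (canon-Part p)) (ins-Part p)

canon-pred-Part : ∀ {b n ν} → Part (suc b) n ν → ∃ λ m → Part b m (canon (map ℕ.pred ν))
canon-pred-Part [] = 0 , []
canon-pred-Part (cons {k = zero} l p) = proj₁ (canon-pred-Part p) , Part-mono z≤n (proj₂ (canon-pred-Part p))
canon-pred-Part (cons {k = suc k} (s≤s l) p) = _ , Part-ins l (Part-mono l (proj₂ (canon-pred-Part p)))

-- Lowering all parts and dropping zeros loses only the number of parts equal to 1, and the length
-- restores it.
canon-pred-injective : ∀ {b c n m ν μ} → Part b n ν → Part c m μ → length ν ≡ length μ → canon (map ℕ.pred ν) ≡ canon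
  (map ℕ.pred μ) → ν ≡ μ
canon-pred-injective [] [] _ _ = refl
canon-pred-injective (cons {k = zero} l p) (cons {k = zero} l′ p′) e f =
  cong (1 ∷_) (canon-pred-injective p p′ (ℕₚ.suc-injective e) f)
-- A leading part 1 forces all parts to be 1, so nothing is left after lowering; a leading part of
-- at least 2 leaves a nonempty list.
canon-pred-injective (cons {k = zero} l p) (cons {k = suc k} l′ p′) e f with () ← trans
  (sym (Part-0 (proj₂ (canon-pred-Part p)))) (trans f (ins-Part (proj₂ (canon-pred-Part p′))))
canon-pred-injective (cons {k = suc k} l p) (cons {k = zero} l′ p′) e f with () ← trans
  (sym (Part-0 (proj₂ (canon-pred-Part p′)))) (trans (sym f) (ins-Part (proj₂ (canon-pred-Part p))))
canon-pred-injective (cons {k = suc k} l p) (cons {k = suc k′} l′ p′) e f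
  with ∷-injective (trans (sym (ins-Part (proj₂ (canon-pred-Part p))))
    (trans f (ins-Part (proj₂ (canon-pred-Part p′)))))
... | refl , g = cong (suc (suc k) ∷_) (canon-pred-injective p p′ (ℕₚ.suc-injective e) g)

monomial-empty : ∀ Y → monomial Y 0 [] ≡ 1ℚ
monomial-empty Y = trans
  (Φ-cong≡ Y 0 (λ β e →
  trans (cong ([_≟ₗ [] ]) (Part-0 (subst (λ z → Part 0 z (canon β)) e (Part-canon 0 β (ℕₚ.≤-reflexive e))))) refl))
  (go Y)
  where
  go : ∀ Y → Φ Y 0 (λ _ → 1ℚ) ≡ 1ℚ
  go [] = refl
  go (y ∷ Y) = trans (anti-0 _) (trans (*-identityˡ _) (go Y))

-- For ℓ = length ν, e_ℓ times the monomial function of ν - (1,…,1) is that of ν plus terms of greater length.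
monomial-expansion : ∀ Y {n ν} → Part n n ν → let ℓ = length ν; μ = map ℕ.pred ν in
  monomial Y n ν ≡ elementary Y ℓ * monomial Y (sum μ) (canon μ) + ∑ₗ (partitions n)
    (λ ν′ → - (Δ ℓ (λ β → [ canon β ≟ₗ canon μ ]) ν′ - [ ν ≟ₗ ν′ ]) * monomial Y n ν′)
monomial-expansion Y {n} {ν} p = sym (begin
  elementary Y ℓ * monomial Y (sum μ) (canon μ) + ∑ₗ (partitions n) (λ ν′ → - (D ν′ - [ ν ≟ₗ ν′ ]) * monomial Y n ν′)
    ≡⟨ cong₂ _+_ (trans (elementary-Φ Y ℓ (sum μ) _)
      (trans (cong (λ z → Φ Y z D) (Part-pred-sum p))
      (Φ-monomial Y n (Δ-resp ℓ (λ h → cong ([_≟ₗ canon μ ]) (canon-resp h))))))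
        (trans (∑ₗ-cong (partitions n)
          (λ ν′ → solve 3 (λ d i m → :- (d :- i) :* m := i :* m :+ con -1ℚ :* (d :* m)) refl (D ν′) [ ν ≟ₗ ν′ ]
          (monomial Y n ν′))) (trans (∑ₗ-+ _ _ (partitions n))
          (cong₂ _+_ (partitionSum-pick (monomial Y n) p) (∑ₗ-*ˡ -1ℚ _ (partitions n))))) ⟩
  A + (monomial Y n ν + -1ℚ * A) ≡⟨ solve 2 (λ a m → a :+ (m :+ con -1ℚ :* a) := m) refl A (monomial Y n ν) ⟩
  monomial Y n ν ∎)
  where
  ℓ = length ν
  μ = map ℕ.pred ν
  D : List ℕ → ℚ
  D = Δ ℓ (λ β → [ canon β ≟ₗ canon μ ])
  A = ∑ₗ (partitions n) (λ ν′ → D ν′ * monomial Y n ν′)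

-- Triangularity by length. With fewer than ℓ parts there are not ℓ entries to lower; with exactly ℓ
-- parts all are lowered, and by `canon-pred-injective` only `ν` itself yields ν - (1,...,1), with
-- the coefficient 1 that is subtracted.
expansion-coefficient : ∀ {n ν ν′} → Part n n ν → Part n n ν′ → length ν′ ℕ.≤ length ν →
  - (Δ (length ν) (λ β → [ canon β ≟ₗ canon (map ℕ.pred ν) ]) ν′ - [ ν ≟ₗ ν′ ]) ≡ 0ℚ
expansion-coefficient {n} {ν} {ν′} p p′ l with ℕₚ.m≤n⇒m<n∨m≡n l
... | inj₁ l< = cong₂ (λ u v → - (u - v)) (Δ-length< (length ν) _ ν′ l<)
    (≟ₗ-≢ (λ e → ℕₚ.<⇒≢ l< (cong length (sym e))))
... | inj₂ l≡ = trans
    (cong (λ u → - (u - [ ν ≟ₗ ν′ ]))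
    (trans (cong (λ z → Δ z (λ β → [ canon β ≟ₗ canon (map ℕ.pred ν) ]) ν′) (sym l≡))
    (trans (Δ-length _ p′) (by-cases (≡-dec ℕ._≟_ ν ν′)))))
    (cong -_ (+-inverseʳ [ ν ≟ₗ ν′ ]))
  where
  by-cases : Dec (ν ≡ ν′) → [ canon (map ℕ.pred ν′) ≟ₗ canon (map ℕ.pred ν) ] ≡ [ ν ≟ₗ ν′ ]
  by-cases (yes refl) = trans (≟ₗ-≡ (canon (map ℕ.pred ν))) (sym (≟ₗ-≡ ν))
  by-cases (no h) = trans (≟ₗ-≢ (λ e → h (sym (canon-pred-injective p′ p l≡ e)))) (sym (≟ₗ-≢ h))

-- The factor 1/(2ℓ)! and the change from (2m)! to (2n)! combine to the binomial coefficient C(2n,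
-- 2ℓ).
Integral-cosh-* : ∀ {m ℓ n e f} → m ℕ.+ ℓ ≡ n → Conv e (cosh ℓ) → Integral m f → Integral n (λ M → e M * f M)
Integral-cosh-* {m} {ℓ} {n} m+ℓ≡n e (integral L c int) = integral (cosh ℓ * L) (Conv-* e c)
  (subst IsInteger (sym value) (IsInteger-* (ℤ.+ ((2 ℕ.* n) choose (2 ℕ.* ℓ)) , refl) int))
  where
  N! = ℕtoℚ ((2 ℕ.* n) !)
  M! = ℕtoℚ ((2 ℕ.* m) !)
  2ℓ≤2n : 2 ℕ.* ℓ ℕ.≤ 2 ℕ.* n
  2ℓ≤2n = ℕₚ.*-monoʳ-≤ 2 (subst (ℓ ℕ.≤_) m+ℓ≡n (ℕₚ.m≤n+m ℓ m))
  2m≡ : 2 ℕ.* m ≡ 2 ℕ.* n ∸ 2 ℕ.* ℓ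
  2m≡ = sym (trans (sym (ℕₚ.*-distribˡ-∸ 2 n ℓ)) (cong (2 ℕ.*_) (trans (cong (_∸ ℓ) (sym m+ℓ≡n)) (ℕₚ.m+n∸n≡m m ℓ))))
  value : N! * (cosh ℓ * L) ≡ ℕtoℚ ((2 ℕ.* n) choose (2 ℕ.* ℓ)) * (M! * L)
  value = begin
    N! * (cosh ℓ * L) ≡⟨ solve 3 (λ n c l → n :* (c :* l) := n :* c :* con 1ℚ :* l) refl N! (cosh ℓ) L ⟩
    N! * cosh ℓ * 1ℚ * L ≡⟨ cong (λ z → N! * cosh ℓ * z * L) (sym (invfac*! (2 ℕ.* m))) ⟩
    N! * cosh ℓ * (invfac (2 ℕ.* m) * M!) * L
      ≡⟨ solve 5 (λ n c i m l → n :* c :* (i :* m) :* l := n :* (c :* i) :* (m :* l)) refl N! (cosh ℓ)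
      (invfac (2 ℕ.* m)) M! L ⟩
    N! * (cosh ℓ * invfac (2 ℕ.* m)) * (M! * L) ≡⟨ cong (λ z → N! * (cosh ℓ * invfac z) * (M! * L)) 2m≡ ⟩
    N! * (cosh ℓ * invfac (2 ℕ.* n ∸ 2 ℕ.* ℓ)) * (M! * L) ≡⟨ cong (_* (M! * L)) (sym (binomial 2ℓ≤2n)) ⟩
    ℕtoℚ ((2 ℕ.* n) choose (2 ℕ.* ℓ)) * (M! * L) ∎

monomial-Integral-step : ∀ n ν → Part n n ν → Integral (sum (map ℕ.pred ν))
  (λ M → monomial (nodes M) (sum (map ℕ.pred ν)) (canon (map ℕ.pred ν))) →
  (∀ ν′ → Part n n ν′ → length ν ℕ.< length ν′ → Integral n (λ M → monomial (nodes M) n ν′)) →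
    Integral n (λ M → monomial (nodes M) n ν)
monomial-Integral-step n ν p lower longer = Integral-cong n (λ M → sym (monomial-expansion (nodes M) p)) (Integral-+ n
  (Integral-cosh-* {ℓ = length ν} (Part-pred-sum p) (elementary-Conv (length ν)) lower)
    (Integral-∑ₗ n (All-Part n n n) (λ ν′ p′ → rest ν′ p′ (ℕₚ.≤-<-connex (length ν′) (length ν)))))
  where
  k : List ℕ → ℚ
  k ν′ = - (Δ (length ν) (λ β → [ canon β ≟ₗ canon (map ℕ.pred ν) ]) ν′ - [ ν ≟ₗ ν′ ])
  rest : ∀ ν′ → Part n n ν′ → length ν′ ℕ.≤ length ν ⊎ length ν ℕ.< length ν′ →
    Integral n (λ M → k ν′ * monomial (nodes M) n ν′)
  rest ν′ p′ (inj₁ short) = Integral-zero n (λ M → ≡0-* (monomial (nodes M) n ν′) (expansion-coefficient p p′ short))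
  rest ν′ p′ (inj₂ long) =
    Integral-scale n (IsInteger-neg
    (IsInteger-+ (IsInteger-Δ (length ν) (λ β → IsInteger-≟ₗ (canon β) (canon (map ℕ.pred ν))) ν′)
    (IsInteger-neg (IsInteger-≟ₗ ν ν′)))) (longer ν′ p′ long)

-- Induction on n and, for fixed n, downwards on the length of ν.
monomial-Integral : ∀ n ν → Part n n ν → Integral n (λ M → monomial (nodes M) n ν)
monomial-Integral = <-rec _ step
  where
  step : ∀ n → (∀ {m} → m ℕ.< n → ∀ ν → Part m m ν → Integral m (λ M → monomial (nodes M) m ν)) → ∀ ν → Part n n ν →
    Integral n (λ M → monomial (nodes M) n ν)
  step n ih ν p = go (suc n) ν p (ℕₚ.m≤m+n (suc n) (length ν))
    where
    pred-sum< : ∀ {n ν} → Part n n ν → ν ≢ [] → sum (map ℕ.pred ν) ℕ.< n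
    pred-sum< [] h = ⊥-elim (h refl)
    pred-sum< {n} {ν} p@(cons _ _) h = subst (sum (map ℕ.pred ν) ℕ.<_) (Part-pred-sum p)
      (ℕₚ.m<m+n (sum (map ℕ.pred ν)) (s≤s z≤n))
    empty : ∀ {n} → Part n n [] → Integral n (λ M → monomial (nodes M) n [])
    empty [] = integral 1ℚ (Conv-cong (λ M → sym (monomial-empty (nodes M))) refl (Conv-const 1ℚ)) (ℤ.+ 1 , refl)
    -- `d` exceeds n minus the length of `ν`, so it can drop as the length grows; at 0 the length
    -- would be greater than n.
    go : ∀ d ν → Part n n ν → n ℕ.< d ℕ.+ length ν → Integral n (λ M → monomial (nodes M) n ν)
    go zero ν p l = ⊥-elim (ℕₚ.<⇒≱ l (Part-length p))
    go (suc d) [] p l = empty p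
    go (suc d) (y ∷ ν) p l = monomial-Integral-step n (y ∷ ν) p
      (ih (pred-sum< p (λ ())) _ (Part-canon _ (map ℕ.pred (y ∷ ν)) ℕₚ.≤-refl))
      (λ ν′ p′ long → go d ν′ p′
        (ℕₚ.<-≤-trans l (ℕₚ.≤-trans (ℕₚ.≤-reflexive (sym (ℕₚ.+-suc d (suc (length ν))))) (ℕₚ.+-monoʳ-≤ d long))))

nonNeg-integer : ∀ {y} → 0ℚ ≤ y → ((z , _) : IsInteger y) → y ≡ ℕtoℚ ℤ.∣ z ∣
nonNeg-integer h (ℤ.+ m , e) = e
nonNeg-integer h (ℤ.-[1+ m ] , refl) = ⊥-elim (<-irrefl refl (≤-<-trans h (neg-antimono-< (0<ℕtoℚ m))))

-- The coefficients of the h-expansion.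

canon-Integral : ∀ n λ′ → sum λ′ ≡ n → Integral n (λ M → monomial (nodes M) n (canon λ′))
canon-Integral n λ′ e = monomial-Integral n (canon λ′)
  (subst (λ m → Part n m (canon λ′)) e (Part-canon n λ′ (ℕₚ.≤-reflexive e)))

-- Coefficients are to be given on all lists, but integrality is known on partitions of n. Hence the
-- test on the sum, the passage to `canon λ′`, and the default 0; on a partition `canon` changes
-- nothing.
h-coefficient : ∀ n (λ′ : List ℕ) → Dec (sum λ′ ≡ n) → ℕ
h-coefficient n λ′ (yes e) = ℤ.∣ proj₁ (Integral.isInteger (canon-Integral n λ′ e)) ∣
h-coefficient n λ′ (no _) = 0

h-coefficient-limit : ∀ n {λ′} → Part n n λ′ → ∀ d → Conv (λ M → ℕtoℚ ((2 ℕ.* n) !) * monomial (nodes M) n λ′)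
  (ℕtoℚ (h-coefficient n λ′ d))
h-coefficient-limit n p (no ¬e) = ⊥-elim (¬e (Part-sum p))
h-coefficient-limit n {λ′} p (yes e) =
  Conv-cong (λ M → cong (λ ν → ℕtoℚ ((2 ℕ.* n) !) * monomial (nodes M) n ν) (canon-Part p))
  (nonNeg-integer (*-nonNeg (0≤ℕtoℚ ((2 ℕ.* n) !))
    (Conv-nonNeg (Integral.converges R) (λ M → monomial-nonNeg n (canon λ′) (nodes-nonNeg M))))
    (Integral.isInteger R))
  (Conv-scale (ℕtoℚ ((2 ℕ.* n) !)) (Integral.converges R))
  where R = canon-Integral n λ′ e

Conv-∑ₗ-All : ∀ {A : Set} {P : A → Set} {xs : List A} {f : A → ℕ → ℚ} {L : A → ℚ} → All P xs →
  (∀ x → P x → Conv (f x) (L x)) → Conv (λ M → ∑ₗ xs (λ x → f x M)) (∑ₗ xs L)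
Conv-∑ₗ-All [] h = Conv-const 0ℚ
Conv-∑ₗ-All {xs = y ∷ ys} {f} {L} (p ∷ ps) h = Conv-+ (h y p) (Conv-∑ₗ-All ps h)

theorem5p1 : (n : ℕ) → ∃ λ (c : List ℕ → ℕ) →
    (N : ℕ) → scaledA n N ≈P hCombination n c N
theorem5p1 n = c , λ N α → trans (coeff-scaledA n N α)
  (sym (trans (coeff-sumP (λ λ′ → scaleP (ℕtoℚ (c λ′)) h[ λ′ ]) (partitions n) α)
    (trans (∑ₗ-cong (partitions n) (λ λ′ → coeff-scale (ℕtoℚ (c λ′)) h[ λ′ ] α))
      -- Both sides are limits of one sequence, the coefficients of (2n)! ∏ᵢⱼ 1/(1 - xᵢ yⱼ): the
      -- h-expansion through Cauchy's identity, the product of secants through the convergence of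
      -- each factor.
      (Conv-unique {λ M → F * coefficients (complete (nodes M)) n α} (h-limit N α)
      (Conv-scale F (coefficients-Conv n α))))))
  where
  c : List ℕ → ℕ
  c λ′ = h-coefficient n λ′ (sum λ′ ℕ.≟ n)
  F = ℕtoℚ ((2 ℕ.* n) !)
  h-limit : ∀ N (α : Vec ℕ N) → Conv (λ M → F * coefficients (complete (nodes M)) n α)
    (∑ₗ (partitions n) (λ λ′ → ℕtoℚ (c λ′) * hCoeff α λ′))
  h-limit N α = Conv-cong expand refl
    (Conv-∑ₗ-All {f = λ λ′ M → F * monomial (nodes M) n λ′ * hCoeff α λ′} (All-Part n n n)
      (λ λ′ p → Conv-* (h-coefficient-limit n p (sum λ′ ℕ.≟ n)) (Conv-const (hCoeff α λ′))))
    where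
    expand : ∀ M → ∑ₗ (partitions n) (λ λ′ → F * monomial (nodes M) n λ′ * hCoeff α λ′) ≡ F * coefficients
      (complete (nodes M)) n α
    expand M = trans (∑ₗ-cong (partitions n)
      (λ λ′ → solve 3 (λ f m h → f :* m :* h := f :* (h :* m)) refl F (monomial (nodes M) n λ′) (hCoeff α λ′)))
      (trans (∑ₗ-*ˡ F _ (partitions n))
        (cong (F *_) (trans (sym (Φ-monomial (nodes M) n (hCoeff-resp α))) (Cauchy (nodes M) n α))))
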